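{- Fix an integer $k\geq1$. Let $C_k(r)=\mathrm{AO}(K_{k,\ldots,k})$, where there are $r$ parts, each of size $k$. Then, as $r\to\infty$, $$C_k(r)=e^{ -(k-1)/2}(kr)!\left(1-\frac{(k-1)(5k-7)}{24kr}+O(r^{ -2})\right).$$
   Context: $\mathrm{AO}(G)$ is the number of acyclic orientations of $G$; $K_{k,\ldots,k}$ is the complete multipartite graph with all parts of size $k$. The implicit constant may depend on the fixed $k$. -}

module Defs where

open import Data.Bool using (true; false)
open import Data.Fin using (Fin; toℕ; quotient)
open import Data.Fin.Properties using (all?; any?; toℕ<n; toℕ-injective) renaming (_≟_ to _≟ᶠ_)
open import Data.Fin.Subset using (Subset) renaming (_∈_ to _∈ˢ_)
open import Data.Fin.Subset.Properties using () renaming (_∈?_ to _∈ˢ?_)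
open import Data.Integer using (1ℤ; +_)
import Data.Integer as ℤ
import Data.Integer.Properties as ℤ
open import Data.List using (List; []; _∷_; length; filter; cartesianProductWith)
open import Data.List.Membership.Propositional using (_∈_)
open import Data.List.Membership.Propositional.Properties using (∈-cartesianProductWith⁺)
open import Data.List.Relation.Unary.All using ([]; _∷_)
open import Data.List.Relation.Unary.AllPairs using ([]; _∷_)
open import Data.List.Relation.Unary.Any using (here; there)
open import Data.List.Relation.Unary.Unique.Propositional using (Unique)
open import Data.List.Relation.Unary.Unique.Propositional.Properties using (cartesianProductWith⁺)
open import Data.Nat using (ℕ; zero; suc; NonZero; _!)
import Data.Nat as ℕ
import Data.Nat.Properties as ℕ
open import Data.Nat.Properties using (_!≢0; m*n≢0; m^n≢0)
open import Data.Product using (∃; ∃-syntax; _×_; _,_; proj₁; proj₂)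
open import Data.Rational using (ℚ; 0ℚ; 1ℚ)
import Data.Rational as ℚ
import Data.Rational.Properties as ℚ
import Data.Rational.Unnormalised as ℚᵘ
import Data.Rational.Unnormalised.Properties as ℚᵘ
open import Data.Sum using (_⊎_; inj₁; inj₂)
open import Data.Vec using (Vec; []; _∷_; lookup)
open import Data.Vec.Properties using (∷-injective)
open import Function using (_∘_)
open import Level using (0ℓ)
open import Relation.Binary using (Rel; Decidable; Symmetric; Irreflexive)
open import Relation.Binary.Construct.Closure.Transitive using (TransClosure; [_]; _∷_; _++_)
open import Relation.Binary.PropositionalEquality
  using (_≡_; _≢_; refl; sym; trans; cong; cong₂; subst; subst₂; module ≡-Reasoning)
open import Relation.Nullary using (Dec; yes; no; ¬_; ¬?; contradiction)
open import Relation.Nullary.Decidable using (map′; _×-dec_; _⊎-dec_; _→-dec_)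
import Relation.Unary as U

record Graph (n : ℕ) : Set₁ where
  field
    Adj    : Rel (Fin n) 0ℓ
    adj?   : Decidable Adj
    symm   : Symmetric Adj
    irrefl : Irreflexive _≡_ Adj

-- Row i of the adjacency matrix is the set of out-neighbours of i.
Digraph : ℕ → Set
Digraph n = Vec (Subset n) n

Arc : ∀ {n} → Digraph n → Rel (Fin n) 0ℓ
Arc D i j = j ∈ˢ lookup D i

arc? : ∀ {n} (D : Digraph n) → Decidable (Arc D)
arc? D i j = j ∈ˢ? lookup D i

IsOrientation : ∀ {n} → Graph n → Digraph n → Set
IsOrientation G D =
  (∀ i j → Arc D i j → Adj i j) ×
  (∀ i j → Adj i j → (Arc D i j ⊎ Arc D j i) × ¬ (Arc D i j × Arc D j i))
  where open Graph G

Acyclic : ∀ {n} → Digraph n → Set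
Acyclic D = ∀ i → ¬ TransClosure (Arc D) i i

IsAcyclicOrientation : ∀ {n} → Graph n → Digraph n → Set
IsAcyclicOrientation G D = IsOrientation G D × Acyclic D

isOrientation? : ∀ {n} (G : Graph n) → U.Decidable (IsOrientation G)
isOrientation? G D =
  (all? λ i → all? λ j → arc? D i j →-dec adj? i j) ×-dec
  (all? λ i → all? λ j → adj? i j →-dec
    ((arc? D i j ⊎-dec arc? D j i) ×-dec ¬? (arc? D i j ×-dec arc? D j i)))
  where open Graph G

-- Reachability is decided by the Floyd–Warshall recursion: Path m i j holds if
-- there is a nonempty walk from i to j whose interior vertices are all < m.
module Reachability {n} {R : Rel (Fin n) 0ℓ} (R? : Decidable R) where

  Path : ℕ → Rel (Fin n) 0ℓ
  Path zero    i j = R i j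
  Path (suc m) i j = Path m i j ⊎ (∃[ v ] toℕ v ≡ m × Path m i v × Path m v j)

  path? : ∀ m → Decidable (Path m)
  path? zero    i j = R? i j
  path? (suc m) i j = path? m i j ⊎-dec
    any? λ v → (toℕ v ℕ.≟ m) ×-dec path? m i v ×-dec path? m v j

  path⇒⁺ : ∀ m {i j} → Path m i j → TransClosure R i j
  path⇒⁺ zero    r                      = [ r ]
  path⇒⁺ (suc m) (inj₁ p)               = path⇒⁺ m p
  path⇒⁺ (suc m) (inj₂ (_ , _ , p , q)) = path⇒⁺ m p ++ path⇒⁺ m q

  weaken : ∀ m {i j} → R i j → Path m i j
  weaken zero    r = r
  weaken (suc m) r = inj₁ (weaken m r)

  private
    upTo : ∀ {m i v} → toℕ v ≡ m → Path (suc m) i v → Path m i v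
    upTo     v≡m (inj₁ p)                 = p
    upTo {v = v} v≡m (inj₂ (w , w≡m , p , _))
      with refl ← toℕ-injective {i = w} {v} (trans w≡m (sym v≡m)) = p

    from : ∀ {m v j} → toℕ v ≡ m → Path (suc m) v j → Path m v j
    from     v≡m (inj₁ p)                 = p
    from {v = v} v≡m (inj₂ (w , w≡m , _ , q))
      with refl ← toℕ-injective {i = w} {v} (trans w≡m (sym v≡m)) = q

  concat : ∀ m {i v j} → toℕ v ℕ.< m → Path m i v → Path m v j → Path m i j
  concat (suc m) {v = v} v<1+m p q with toℕ v ℕ.≟ m
  ... | yes v≡m = inj₂ (v , v≡m , upTo v≡m p , from v≡m q)
  ... | no  v≢m = go p q
    where
    v<m : toℕ v ℕ.< m
    v<m = ℕ.≤∧≢⇒< (ℕ.s≤s⁻¹ v<1+m) v≢m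

    go : ∀ {i j} → Path (suc m) i v → Path (suc m) v j → Path (suc m) i j
    go (inj₁ p)                 (inj₁ q)                 = inj₁ (concat m v<m p q)
    go (inj₁ p)                 (inj₂ (w , e , q₁ , q₂)) = inj₂ (w , e , concat m v<m p q₁ , q₂)
    go (inj₂ (w , e , p₁ , p₂)) (inj₁ q)                 = inj₂ (w , e , p₁ , concat m v<m p₂ q)
    go (inj₂ (w , e , p₁ , _))  (inj₂ (x , f , _ , q₂))
      with refl ← toℕ-injective {i = w} {x} (trans e (sym f)) = inj₂ (w , e , p₁ , q₂)

  ⁺⇒path : ∀ {i j} → TransClosure R i j → Path n i j
  ⁺⇒path [ r ]            = weaken n r
  ⁺⇒path (_∷_ {y = y} r p) = concat n (toℕ<n y) (weaken n r) (⁺⇒path p)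

  reachable? : Decidable (TransClosure R)
  reachable? i j = map′ (path⇒⁺ n) ⁺⇒path (path? n i j)

acyclic? : ∀ {n} → U.Decidable (Acyclic {n})
acyclic? D = all? λ i → ¬? (Reachability.reachable? (arc? D) i i)

isAcyclicOrientation? : ∀ {n} (G : Graph n) → U.Decidable (IsAcyclicOrientation G)
isAcyclicOrientation? G D = isOrientation? G D ×-dec acyclic? D

vectors : ∀ {A : Set} → List A → ∀ n → List (Vec A n)
vectors xs zero    = [] ∷ []
vectors xs (suc n) = cartesianProductWith _∷_ xs (vectors xs n)

digraphs : ∀ n → List (Digraph n)
digraphs n = vectors (vectors (false ∷ true ∷ []) n) n

AO : ∀ {n} → Graph n → ℕ
AO {n} G = length (filter (isAcyclicOrientation? G) (digraphs n))

-- The enumeration lists every digraph exactly once, so AO is a cardinality.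

vectors-unique : ∀ {A : Set} {xs : List A} → Unique xs → ∀ n → Unique (vectors xs n)
vectors-unique u zero    = [] ∷ []
vectors-unique u (suc n) = cartesianProductWith⁺ _∷_ ∷-injective u (vectors-unique u n)

vectors-complete : ∀ {A : Set} {xs : List A} → (∀ x → x ∈ xs) → ∀ {n} (v : Vec A n) → v ∈ vectors xs n
vectors-complete c []      = here refl
vectors-complete c (x ∷ v) = ∈-cartesianProductWith⁺ _∷_ (c x) (vectors-complete c v)

digraphs-unique : ∀ n → Unique (digraphs n)
digraphs-unique n = vectors-unique (vectors-unique (((λ ()) ∷ []) ∷ [] ∷ []) n) n

digraphs-complete : ∀ {n} (D : Digraph n) → D ∈ digraphs n
digraphs-complete = vectors-complete (vectors-complete λ { false → here refl ; true → there (here refl) })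

-- K_{k,…,k} with r parts: the parts are the fibres of quotient k : Fin (r * k) → Fin r,
-- i.e. consecutive blocks of k vertices.
completeMultipartite : ∀ k r → Graph (r ℕ.* k)
completeMultipartite k r = record
  { Adj    = λ i j → part i ≢ part j
  ; adj?   = λ i j → ¬? (part i ≟ᶠ part j)
  ; symm   = λ i≁j → i≁j ∘ sym
  ; irrefl = λ { refl i≁i → i≁i refl }
  }
  where
  part : Fin (r ℕ.* k) → Fin r
  part = quotient k

C : ℕ → ℕ → ℕ
C k r = AO (completeMultipartite k r)

module Cauchy where
  open import Data.Rational using (_+_; _*_; _-_; -_; ∣_∣; _≤_; _<_; NonNegative)
  open import Data.Rational.Solver using (module +-*-Solver)
  open +-*-Solver using (solve; _:+_; _:*_; _:-_; :-_; _:=_; con)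
  open ℚ.≤-Reasoning

  IsCauchy : (ℕ → ℚ) → Set
  IsCauchy s = ∀ ε → 0ℚ < ε → ∃[ N ] (∀ m n → N ℕ.≤ m → N ℕ.≤ n → ∣ s m - s n ∣ ≤ ε)

  identity1 : ∀ d → d + d ≡ d * (1ℚ + 1ℚ)
  identity1 = solve 1 (λ d → d :+ d := d :* (con 1ℚ :+ con 1ℚ)) refl

  identity2 : ∀ p q → p - q ≡ - (q - p)
  identity2 = solve 2 (λ p q → p :- q := :- (q :- p)) refl

  identity3 : ∀ a b → - (a - b) ≡ b - a
  identity3 = solve 2 (λ a b → :- (a :- b) := b :- a) refl

  identity4 : ∀ p q → p ≡ (p - q) + q
  identity4 = solve 2 (λ p q → p := (p :- q) :+ q) refl

  identity5 : ∀ a b → (a + b) - b ≡ a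
  identity5 = solve 2 (λ a b → (a :+ b) :- b := a) refl

  identity6 : ∀ a b c d → (a + b) - (c + d) ≡ (a - c) + (b - d)
  identity6 = solve 4 (λ a b c d → (a :+ b) :- (c :+ d) := (a :- c) :+ (b :- d)) refl

  identity7 : ∀ a b → (- a) - (- b) ≡ b - a
  identity7 = solve 2 (λ a b → (:- a) :- (:- b) := b :- a) refl

  identity8 : ∀ a b c d → a * b - c * d ≡ a * (b - d) + (a - c) * d
  identity8 = solve 4 (λ a b c d → a :* b :- c :* d := a :* (b :- d) :+ (a :- c) :* d) refl

  identity9 : ∀ b c d → b * d + d * c ≡ d * (b + c)
  identity9 = solve 3 (λ b c d → b :* d :+ d :* c := d :* (b :+ c)) refl

  ι : ℕ → ℚ
  ι n = + n ℚ./ 1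

  ι-toℚᵘ : ∀ n → ℚ.toℚᵘ (ι n) ℚᵘ.≃ ℚᵘ.mkℚᵘ (+ n) 0
  ι-toℚᵘ n = ℚ.toℚᵘ-fromℚᵘ (ℚᵘ.mkℚᵘ (+ n) 0)

  /-toℚᵘ : ∀ i d → ℚ.toℚᵘ (i ℚ./ suc d) ℚᵘ.≃ ℚᵘ.mkℚᵘ i d
  /-toℚᵘ i d = ℚ.toℚᵘ-fromℚᵘ (ℚᵘ.mkℚᵘ i d)

  ι-mono : ∀ {m n} → m ℕ.≤ n → ι m ≤ ι n
  ι-mono {m} {n} m≤n = ℚ.toℚᵘ-cancel-≤
    (ℚᵘ.≤-respˡ-≃ (ℚᵘ.≃-sym (ι-toℚᵘ m)) (ℚᵘ.≤-respʳ-≃ (ℚᵘ.≃-sym (ι-toℚᵘ n))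
      (ℚᵘ.*≤* (ℤ.*-monoʳ-≤-nonNeg (+ 1) (ℤ.+≤+ m≤n)))))

  archimedean : ∀ p → ∃[ n ] p ≤ ι n
  archimedean p@(ℚ.mkℚ i d _) = ℤ.∣ i ∣ , ℚ.toℚᵘ-cancel-≤
    (ℚᵘ.≤-respʳ-≃ (ℚᵘ.≃-sym (ι-toℚᵘ ℤ.∣ i ∣)) (ℚᵘ.*≤* lemma))
    where
    i≤∣i∣ : ∀ i → i ℤ.≤ + ℤ.∣ i ∣
    i≤∣i∣ (+ _)        = ℤ.≤-refl
    i≤∣i∣ (ℤ.-[1+ _ ]) = ℤ.-≤+

    lemma : i ℤ.* + 1 ℤ.≤ + ℤ.∣ i ∣ ℤ.* + suc d
    lemma = ℤ.≤-trans (ℤ.*-monoʳ-≤-nonNeg (+ 1) (i≤∣i∣ i))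
                      (ℤ.*-monoˡ-≤-nonNeg (+ ℤ.∣ i ∣) (ℤ.+≤+ (ℕ.s≤s ℕ.z≤n)))

  recip : (n : ℕ) .{{_ : NonZero n}} → ℚ
  recip n = 1ℤ ℚ./ n

  recip-* : ∀ m n .{{_ : NonZero m}} .{{_ : NonZero n}} .{{_ : NonZero (m ℕ.* n)}} →
            recip (m ℕ.* n) ≡ recip m * recip n
  recip-* (suc m) (suc n) = ℚ.toℚᵘ-injective (begin′
    ℚ.toℚᵘ (recip (suc m ℕ.* suc n))               ≈⟨ /-toℚᵘ 1ℤ (n ℕ.+ m ℕ.* suc n) ⟩
    ℚᵘ.mkℚᵘ 1ℤ m ℚᵘ.* ℚᵘ.mkℚᵘ 1ℤ n                 ≈⟨ ℚᵘ.*-cong (/-toℚᵘ 1ℤ m) (/-toℚᵘ 1ℤ n) ⟨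
    ℚ.toℚᵘ (recip (suc m)) ℚᵘ.* ℚ.toℚᵘ (recip (suc n)) ≈⟨ ℚ.toℚᵘ-homo-* (recip (suc m)) (recip (suc n)) ⟨
    ℚ.toℚᵘ (recip (suc m) * recip (suc n))         ∎′)
    where open import Relation.Binary.Reasoning.Setoid ℚᵘ.≃-setoid using (step-≈-⟩; step-≈-⟨) renaming (begin_ to begin′_; _∎ to _∎′)

  ι*recip : ∀ n .{{_ : NonZero n}} → ι n * recip n ≡ 1ℚ
  ι*recip (suc n) = ℚ.toℚᵘ-injective (begin′
    ℚ.toℚᵘ (ι (suc n) * recip (suc n))               ≈⟨ ℚ.toℚᵘ-homo-* (ι (suc n)) (recip (suc n)) ⟩
    ℚ.toℚᵘ (ι (suc n)) ℚᵘ.* ℚ.toℚᵘ (recip (suc n))   ≈⟨ ℚᵘ.*-cong (ι-toℚᵘ (suc n)) (/-toℚᵘ 1ℤ n) ⟩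
    ℚᵘ.mkℚᵘ (+ suc n) 0 ℚᵘ.* ℚᵘ.mkℚᵘ 1ℤ n            ≈⟨ ℚᵘ.*≡* (cong +_ lemma) ⟩
    ℚᵘ.1ℚᵘ                                           ∎′)
    where
    open import Relation.Binary.Reasoning.Setoid ℚᵘ.≃-setoid using (step-≈-⟩; step-≈-⟨) renaming (begin_ to begin′_; _∎ to _∎′)
    lemma : suc n ℕ.* 1 ℕ.* 1 ≡ suc (n ℕ.+ 0 ℕ.+ 0)
    lemma = trans (ℕ.*-identityʳ _) (trans (ℕ.*-identityʳ _) (cong suc (sym (trans (ℕ.+-identityʳ _) (ℕ.+-identityʳ _)))))

  recip-nonNeg : ∀ n .{{_ : NonZero n}} → NonNegative (recip n)
  recip-nonNeg n = ℚ.normalize-nonNeg 1 n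

  *-mono-nonNeg : ∀ {p q r s} → 0ℚ ≤ p → p ≤ q → 0ℚ ≤ r → r ≤ s → p * r ≤ q * s
  *-mono-nonNeg {p} {q} {r} {s} 0≤p p≤q 0≤r r≤s = ℚ.≤-trans
    (ℚ.*-monoʳ-≤-nonNeg r {{ℚ.nonNegative 0≤r}} p≤q)
    (ℚ.*-monoˡ-≤-nonNeg q {{ℚ.nonNegative (ℚ.≤-trans 0≤p p≤q)}} r≤s)

  divide : ∀ ε b → 0ℚ < ε → 0ℚ < b → ∃[ δ ] 0ℚ < δ × δ * b ≡ ε
  divide ε b 0<ε 0<b =
    ε * b⁻¹ ,
    ℚ.positive⁻¹ (ε * b⁻¹) {{ℚ.pos*pos⇒pos ε {{ℚ.positive 0<ε}} b⁻¹ {{ℚ.1/pos⇒pos b {{ℚ.positive 0<b}}}}}} ,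
    trans (ℚ.*-assoc ε b⁻¹ b) (trans (cong (ε *_) (ℚ.*-inverseˡ b {{b≢0}})) (ℚ.*-identityʳ ε))
    where
    b≢0 = ℚ.>-nonZero 0<b
    b⁻¹ = (ℚ.1/ b) {{b≢0}}

  halve : ∀ ε → 0ℚ < ε → ∃[ δ ] 0ℚ < δ × δ + δ ≡ ε
  halve ε 0<ε with divide ε (1ℚ + 1ℚ) 0<ε (ℚ.positive⁻¹ (1ℚ + 1ℚ))
  ... | δ , 0<δ , eq = δ , 0<δ , trans (identity1 δ) eq

  ∣p-q∣≡∣q-p∣ : ∀ p q → ∣ p - q ∣ ≡ ∣ q - p ∣
  ∣p-q∣≡∣q-p∣ p q = trans (cong ∣_∣ (identity2 p q)) (ℚ.∣-p∣≡∣p∣ (q - p))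

  ∣p∣≤ : ∀ p q → p ≤ q → - p ≤ q → ∣ p ∣ ≤ q
  ∣p∣≤ p q p≤q -p≤q with ℚ.∣p∣≡p∨∣p∣≡-p p
  ... | inj₁ eq = subst (_≤ q) (sym eq) p≤q
  ... | inj₂ eq = subst (_≤ q) (sym eq) -p≤q

  ∣∣p∣-∣q∣∣≤∣p-q∣ : ∀ p q → ∣ ∣ p ∣ - ∣ q ∣ ∣ ≤ ∣ p - q ∣
  ∣∣p∣-∣q∣∣≤∣p-q∣ p q = ∣p∣≤ _ _ (half p q) (begin
    - (∣ p ∣ - ∣ q ∣)  ≡⟨ identity3 ∣ p ∣ ∣ q ∣ ⟩
    ∣ q ∣ - ∣ p ∣      ≤⟨ half q p ⟩
    ∣ q - p ∣          ≡⟨ ∣p-q∣≡∣q-p∣ q p ⟩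
    ∣ p - q ∣          ∎)
    where
    half : ∀ p q → ∣ p ∣ - ∣ q ∣ ≤ ∣ p - q ∣
    half p q = begin
      ∣ p ∣ - ∣ q ∣                ≡⟨ cong (λ t → ∣ t ∣ - ∣ q ∣) (identity4 p q) ⟩
      ∣ (p - q) + q ∣ - ∣ q ∣      ≤⟨ ℚ.+-monoˡ-≤ (- ∣ q ∣) (ℚ.∣p+q∣≤∣p∣+∣q∣ (p - q) q) ⟩
      (∣ p - q ∣ + ∣ q ∣) - ∣ q ∣  ≡⟨ identity5 ∣ p - q ∣ ∣ q ∣ ⟩
      ∣ p - q ∣                    ∎

  const-cauchy : ∀ q → IsCauchy (λ _ → q)
  const-cauchy q ε 0<ε = 0 , λ _ _ _ _ → begin
    ∣ q - q ∣  ≡⟨ cong ∣_∣ (ℚ.+-inverseʳ q) ⟩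
    0ℚ         ≤⟨ ℚ.<⇒≤ 0<ε ⟩
    ε          ∎

  sum-close : ∀ a b c d {δ} → ∣ a - c ∣ ≤ δ → ∣ b - d ∣ ≤ δ → ∣ (a + b) - (c + d) ∣ ≤ δ + δ
  sum-close a b c d {δ} a-c≤ b-d≤ = begin
    ∣ (a + b) - (c + d) ∣    ≡⟨ cong ∣_∣ (identity6 a b c d) ⟩
    ∣ (a - c) + (b - d) ∣    ≤⟨ ℚ.∣p+q∣≤∣p∣+∣q∣ (a - c) (b - d) ⟩
    ∣ a - c ∣ + ∣ b - d ∣    ≤⟨ ℚ.+-mono-≤ {∣ a - c ∣} {δ} {∣ b - d ∣} {δ} a-c≤ b-d≤ ⟩
    δ + δ                    ∎

  +-cauchy : ∀ {s t} → IsCauchy s → IsCauchy t → IsCauchy (λ n → s n + t n)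
  +-cauchy {s} {t} cs ct ε 0<ε = split (halve ε 0<ε)
    where
    Close : ℕ → Set
    Close K = ∀ m n → K ℕ.≤ m → K ℕ.≤ n → ∣ (s m + t m) - (s n + t n) ∣ ≤ ε

    split : (∃[ δ ] 0ℚ < δ × δ + δ ≡ ε) → ∃ Close
    split (δ , 0<δ , δ+δ≡ε) = M ℕ.⊔ N , close
      where
      M N : ℕ
      M = proj₁ (cs δ 0<δ)
      N = proj₁ (ct δ 0<δ)

      close : Close (M ℕ.⊔ N)
      close m n ≤m ≤n = subst (∣ (s m + t m) - (s n + t n) ∣ ≤_) δ+δ≡ε
        (sum-close (s m) (t m) (s n) (t n)
          (proj₂ (cs δ 0<δ) m n (ℕ.m⊔n≤o⇒m≤o M N ≤m) (ℕ.m⊔n≤o⇒m≤o M N ≤n))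
          (proj₂ (ct δ 0<δ) m n (ℕ.m⊔n≤o⇒n≤o M N ≤m) (ℕ.m⊔n≤o⇒n≤o M N ≤n)))

  neg-cauchy : ∀ {s} → IsCauchy s → IsCauchy (λ n → - s n)
  neg-cauchy {s} cs ε 0<ε with cs ε 0<ε
  ... | N , h = N , λ m n ≤m ≤n → begin
    ∣ - s m - - s n ∣  ≡⟨ cong ∣_∣ (identity7 (s m) (s n)) ⟩
    ∣ s n - s m ∣      ≤⟨ h n m ≤n ≤m ⟩
    ε                  ∎

  abs-cauchy : ∀ {s} → IsCauchy s → IsCauchy (λ n → ∣ s n ∣)
  abs-cauchy {s} cs ε 0<ε with cs ε 0<ε
  ... | N , h = N , λ m n ≤m ≤n → ℚ.≤-trans (∣∣p∣-∣q∣∣≤∣p-q∣ (s m) (s n)) (h m n ≤m ≤n)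

  EventuallyBounded : (ℕ → ℚ) → Set
  EventuallyBounded s = ∃[ b ] 0ℚ < b × ∃[ N ] (∀ n → N ℕ.≤ n → ∣ s n ∣ ≤ b)

  eventually-bounded : ∀ {s} → IsCauchy s → EventuallyBounded s
  eventually-bounded {s} cs with cs 1ℚ (ℚ.positive⁻¹ 1ℚ)
  ... | N , h = 1ℚ + ∣ s N ∣ , ℚ.+-mono-<-≤ (ℚ.positive⁻¹ 1ℚ) (ℚ.0≤∣p∣ (s N)) , N , λ n N≤n → begin
    ∣ s n ∣                    ≡⟨ cong ∣_∣ (identity4 (s n) (s N)) ⟩
    ∣ (s n - s N) + s N ∣      ≤⟨ ℚ.∣p+q∣≤∣p∣+∣q∣ (s n - s N) (s N) ⟩
    ∣ s n - s N ∣ + ∣ s N ∣    ≤⟨ ℚ.+-monoˡ-≤ ∣ s N ∣ (h n N N≤n ℕ.≤-refl) ⟩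
    1ℚ + ∣ s N ∣               ∎

  product-close : ∀ a b c d {β γ δ} → ∣ a ∣ ≤ β → ∣ d ∣ ≤ γ → ∣ a - c ∣ ≤ δ → ∣ b - d ∣ ≤ δ →
                  ∣ a * b - c * d ∣ ≤ δ * (β + γ)
  product-close a b c d {β} {γ} {δ} a≤ d≤ a-c≤ b-d≤ = begin
    ∣ a * b - c * d ∣                        ≡⟨ cong ∣_∣ (identity8 a b c d) ⟩
    ∣ a * (b - d) + (a - c) * d ∣            ≤⟨ ℚ.∣p+q∣≤∣p∣+∣q∣ (a * (b - d)) ((a - c) * d) ⟩
    ∣ a * (b - d) ∣ + ∣ (a - c) * d ∣        ≡⟨ cong₂ _+_ (ℚ.∣p*q∣≡∣p∣*∣q∣ a (b - d)) (ℚ.∣p*q∣≡∣p∣*∣q∣ (a - c) d) ⟩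
    ∣ a ∣ * ∣ b - d ∣ + ∣ a - c ∣ * ∣ d ∣    ≤⟨ ℚ.+-mono-≤ {∣ a ∣ * ∣ b - d ∣} {β * δ} {∣ a - c ∣ * ∣ d ∣} {δ * γ}
                                                 (*-mono-nonNeg {∣ a ∣} {β} {∣ b - d ∣} {δ} (ℚ.0≤∣p∣ a) a≤ (ℚ.0≤∣p∣ (b - d)) b-d≤)
                                                 (*-mono-nonNeg {∣ a - c ∣} {δ} {∣ d ∣} {γ} (ℚ.0≤∣p∣ (a - c)) a-c≤ (ℚ.0≤∣p∣ d) d≤) ⟩
    β * δ + δ * γ                            ≡⟨ identity9 β γ δ ⟩
    δ * (β + γ)                              ∎

  *-cauchy : ∀ {s t} → IsCauchy s → IsCauchy t → IsCauchy (λ n → s n * t n)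
  *-cauchy {s} {t} cs ct ε 0<ε = split (eventually-bounded cs) (eventually-bounded ct)
    where
    Close : ℕ → Set
    Close K = ∀ m n → K ℕ.≤ m → K ℕ.≤ n → ∣ s m * t m - s n * t n ∣ ≤ ε

    split : EventuallyBounded s → EventuallyBounded t → ∃ Close
    split (b , 0<b , B , hb) (c , 0<c , D , hc) = scale (divide ε (b + c) 0<ε (ℚ.+-mono-< 0<b 0<c))
      where
      scale : (∃[ δ ] 0ℚ < δ × δ * (b + c) ≡ ε) → ∃ Close
      scale (δ , 0<δ , δ[b+c]≡ε) = K , close
        where
        M N K : ℕ
        M = proj₁ (cs δ 0<δ)
        N = proj₁ (ct δ 0<δ)
        K = (B ℕ.⊔ D) ℕ.⊔ (M ℕ.⊔ N)

        close : Close K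
        close m n K≤m K≤n = subst (∣ s m * t m - s n * t n ∣ ≤_) δ[b+c]≡ε
          (product-close (s m) (t m) (s n) (t n)
            (hb m (ℕ.m⊔n≤o⇒m≤o B D BD≤m)) (hc n (ℕ.m⊔n≤o⇒n≤o B D BD≤n))
            (proj₂ (cs δ 0<δ) m n (ℕ.m⊔n≤o⇒m≤o M N MN≤m) (ℕ.m⊔n≤o⇒m≤o M N MN≤n))
            (proj₂ (ct δ 0<δ) m n (ℕ.m⊔n≤o⇒n≤o M N MN≤m) (ℕ.m⊔n≤o⇒n≤o M N MN≤n)))
          where
          BD≤m = ℕ.m⊔n≤o⇒m≤o (B ℕ.⊔ D) (M ℕ.⊔ N) K≤m
          MN≤m = ℕ.m⊔n≤o⇒n≤o (B ℕ.⊔ D) (M ℕ.⊔ N) K≤m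
          BD≤n = ℕ.m⊔n≤o⇒m≤o (B ℕ.⊔ D) (M ℕ.⊔ N) K≤n
          MN≤n = ℕ.m⊔n≤o⇒n≤o (B ℕ.⊔ D) (M ℕ.⊔ N) K≤n

-- The power series of the exponential function at a rational argument.
module Exponential where
  open import Data.Rational using (_+_; _*_; _-_; ∣_∣; _≤_; _<_)
  open import Data.Rational.Solver using (module +-*-Solver)
  open +-*-Solver using (solve; _:+_; _:*_; _:-_; _:=_)
  open ℚ.≤-Reasoning
  open Cauchy
  open import Algebra.Definitions.RawSemiring ℚ.+-*-rawSemiring using (_^_)

  term : ℚ → ℕ → ℚ
  term q i = (q ^ i) * ((1ℤ ℚ./ (i !)) {{i !≢0}})

  partialSum : ℚ → ℕ → ℚ
  partialSum q zero    = 0ℚ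
  partialSum q (suc n) = partialSum q n + term q n

  private module Convergence (q : ℚ) where
    ring1 : ∀ q p r f → q * p * (r * f) ≡ p * f * (q * r)
    ring1 = solve 4 (λ q p r f → q :* p :* (r :* f) := p :* f :* (q :* r)) refl

    ring2 : ∀ a q r → a * (q * r) + a * (q * r) ≡ a * ((q + q) * r)
    ring2 = solve 3 (λ a q r → a :* (q :* r) :+ a :* (q :* r) := a :* ((q :+ q) :* r)) refl

    ring3 : ∀ s t u → (s + t) - u ≡ (s - u) + t
    ring3 = solve 3 (λ s t u → (s :+ t) :- u := (s :- u) :+ t) refl

    ring4 : ∀ a q r → a * (q * r) + a * (q * r) ≡ (a + a) * q * r
    ring4 = solve 3 (λ a q r → a :* (q :* r) :+ a :* (q :* r) := (a :+ a) :* q :* r) refl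

    ring5 : ∀ i e r → i * e * r ≡ i * r * e
    ring5 = solve 3 (λ i e r → i :* e :* r := i :* r :* e) refl

    S : ℕ → ℚ
    S = partialSum q

    a : ℕ → ℚ
    a i = ∣ term q i ∣

    0≤a : ∀ i → 0ℚ ≤ a i
    0≤a i = ℚ.0≤∣p∣ (term q i)

    Q : ℚ
    Q = ∣ q ∣

    0≤Q : 0ℚ ≤ Q
    0≤Q = ℚ.0≤∣p∣ q

    term-suc : ∀ i → term q (suc i) ≡ term q i * (q * recip (suc i))
    term-suc i = begin-equality
      q ^ suc i * recip (suc i !) {{suc i !≢0}}
        ≡⟨ cong (q ^ suc i *_) (recip-* (suc i) (i !) {{_}} {{i !≢0}} {{suc i !≢0}}) ⟩
      q * q ^ i * (recip (suc i) * recip (i !) {{i !≢0}})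
        ≡⟨ ring1 q (q ^ i) (recip (suc i)) (recip (i !) {{i !≢0}}) ⟩
      term q i * (q * recip (suc i)) ∎

    a-suc : ∀ i → a (suc i) ≡ a i * (Q * recip (suc i))
    a-suc i = begin-equality
      ∣ term q (suc i) ∣                            ≡⟨ cong ∣_∣ (term-suc i) ⟩
      ∣ term q i * (q * recip (suc i)) ∣            ≡⟨ ℚ.∣p*q∣≡∣p∣*∣q∣ (term q i) (q * recip (suc i)) ⟩
      a i * ∣ q * recip (suc i) ∣                   ≡⟨ cong (a i *_) (ℚ.∣p*q∣≡∣p∣*∣q∣ q (recip (suc i))) ⟩
      a i * (Q * ∣ recip (suc i) ∣)                 ≡⟨ cong (λ r → a i * (Q * r)) (ℚ.0≤p⇒∣p∣≡p (ℚ.nonNegative⁻¹ _ {{recip-nonNeg (suc i)}})) ⟩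
      a i * (Q * recip (suc i))                     ∎

    -- From index K on, each term is at most half of its predecessor.
    K : ℕ
    K = proj₁ (archimedean (Q + Q))

    halving : ∀ i → K ℕ.≤ i → a (suc i) + a (suc i) ≤ a i
    halving i K≤i = begin
      a (suc i) + a (suc i)            ≡⟨ cong₂ _+_ (a-suc i) (a-suc i) ⟩
      a i * (Q * r) + a i * (Q * r)    ≡⟨ ring2 (a i) Q r ⟩
      a i * ((Q + Q) * r)              ≤⟨ ℚ.*-monoˡ-≤-nonNeg (a i) {{ℚ.∣-∣-nonNeg (term q i)}} bound ⟩
      a i * 1ℚ                         ≡⟨ ℚ.*-identityʳ (a i) ⟩
      a i                              ∎
      where
      r = recip (suc i)
      bound : (Q + Q) * r ≤ 1ℚ
      bound = begin
        (Q + Q) * r    ≤⟨ ℚ.*-monoʳ-≤-nonNeg r {{recip-nonNeg (suc i)}}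
                            (ℚ.≤-trans (proj₂ (archimedean (Q + Q))) (ι-mono (ℕ.m≤n⇒m≤1+n K≤i))) ⟩
        ι (suc i) * r  ≡⟨ ι*recip (suc i) ⟩
        1ℚ             ∎

    a≤aK : ∀ d → a (d ℕ.+ K) ≤ a K
    a≤aK zero    = ℚ.≤-refl
    a≤aK (suc d) = begin
      a (suc d ℕ.+ K)                          ≡⟨ ℚ.+-identityʳ _ ⟨
      a (suc d ℕ.+ K) + 0ℚ                     ≤⟨ ℚ.+-monoʳ-≤ (a (suc d ℕ.+ K)) (0≤a (suc d ℕ.+ K)) ⟩
      a (suc d ℕ.+ K) + a (suc d ℕ.+ K)        ≤⟨ halving (d ℕ.+ K) (ℕ.m≤n+m K d) ⟩
      a (d ℕ.+ K)                              ≤⟨ a≤aK d ⟩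
      a K                                      ∎

    tail : ∀ n d → K ℕ.≤ n → ∣ S (d ℕ.+ n) - S n ∣ + (a (d ℕ.+ n) + a (d ℕ.+ n)) ≤ a n + a n
    tail n zero    K≤n = begin
      ∣ S n - S n ∣ + (a n + a n)  ≡⟨ cong (λ t → ∣ t ∣ + (a n + a n)) (ℚ.+-inverseʳ (S n)) ⟩
      0ℚ + (a n + a n)             ≡⟨ ℚ.+-identityˡ (a n + a n) ⟩
      a n + a n                    ∎
    tail n (suc d) K≤n = begin
      ∣ (S m + term q m) - S n ∣ + (a (suc m) + a (suc m))
        ≤⟨ ℚ.+-mono-≤ step (halving m (ℕ.≤-trans K≤n (ℕ.m≤n+m n d))) ⟩
      (∣ S m - S n ∣ + a m) + a m
        ≡⟨ ℚ.+-assoc ∣ S m - S n ∣ (a m) (a m) ⟩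
      ∣ S m - S n ∣ + (a m + a m)
        ≤⟨ tail n d K≤n ⟩
      a n + a n ∎
      where
      m = d ℕ.+ n
      step : ∣ (S m + term q m) - S n ∣ ≤ ∣ S m - S n ∣ + a m
      step = begin
        ∣ (S m + term q m) - S n ∣  ≡⟨ cong ∣_∣ (ring3 (S m) (term q m) (S n)) ⟩
        ∣ (S m - S n) + term q m ∣  ≤⟨ ℚ.∣p+q∣≤∣p∣+∣q∣ (S m - S n) (term q m) ⟩
        ∣ S m - S n ∣ + a m         ∎

    tail-≤ : ∀ {n m} → K ℕ.≤ n → n ℕ.≤ m → ∣ S m - S n ∣ ≤ a n + a n
    tail-≤ {n} {m} K≤n n≤m = subst (λ m → ∣ S m - S n ∣ ≤ a n + a n) (ℕ.m∸n+n≡m n≤m) (begin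
      ∣ S (d ℕ.+ n) - S n ∣                                      ≡⟨ ℚ.+-identityʳ _ ⟨
      ∣ S (d ℕ.+ n) - S n ∣ + 0ℚ                                 ≤⟨ ℚ.+-monoʳ-≤ ∣ S (d ℕ.+ n) - S n ∣ (ℚ.+-mono-≤ (0≤a (d ℕ.+ n)) (0≤a (d ℕ.+ n))) ⟩
      ∣ S (d ℕ.+ n) - S n ∣ + (a (d ℕ.+ n) + a (d ℕ.+ n))        ≤⟨ tail n d K≤n ⟩
      a n + a n                                                  ∎)
      where d = m ℕ.∸ n

    -- 2 a (i + 1) ≤ B / (i + 1) for i ≥ K, so the terms tend to 0.
    B : ℚ
    B = (a K + a K) * Q

    a-small : ∀ ε → 0ℚ < ε → ∃[ N ] (∀ n → N ℕ.≤ n → K ℕ.≤ n × a n + a n ≤ ε)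
    a-small ε 0<ε = suc (M ℕ.⊔ K) , λ { (suc i) (ℕ.s≤s ≤i) →
      ℕ.m≤n⇒m≤1+n (ℕ.m⊔n≤o⇒n≤o M K ≤i) , bound i (ℕ.m⊔n≤o⇒m≤o M K ≤i) (ℕ.m⊔n≤o⇒n≤o M K ≤i) }
      where
      ε≢0 = ℚ.>-nonZero 0<ε
      ε⁻¹ = (ℚ.1/ ε) {{ε≢0}}
      M : ℕ
      M = proj₁ (archimedean (B * ε⁻¹))

      B≤ : ∀ i → M ℕ.≤ i → B ≤ ι (suc i) * ε
      B≤ i M≤i = begin
        B              ≡⟨ ℚ.*-identityʳ B ⟨
        B * 1ℚ         ≡⟨ cong (B *_) (ℚ.*-inverseˡ ε {{ε≢0}}) ⟨
        B * (ε⁻¹ * ε)  ≡⟨ ℚ.*-assoc B ε⁻¹ ε ⟨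
        B * ε⁻¹ * ε    ≤⟨ ℚ.*-monoʳ-≤-nonNeg ε {{ℚ.nonNegative (ℚ.<⇒≤ 0<ε)}}
                            (ℚ.≤-trans (proj₂ (archimedean (B * ε⁻¹))) (ι-mono (ℕ.m≤n⇒m≤1+n M≤i))) ⟩
        ι (suc i) * ε  ∎

      a≤ : ∀ i → K ℕ.≤ i → a i ≤ a K
      a≤ i K≤i = subst (λ i → a i ≤ a K) (ℕ.m∸n+n≡m K≤i) (a≤aK (i ℕ.∸ K))

      bound : ∀ i → M ℕ.≤ i → K ℕ.≤ i → a (suc i) + a (suc i) ≤ ε
      bound i M≤i K≤i = begin
        a (suc i) + a (suc i)          ≡⟨ cong₂ _+_ (a-suc i) (a-suc i) ⟩
        a i * (Q * r) + a i * (Q * r)  ≡⟨ ring4 (a i) Q r ⟩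
        (a i + a i) * Q * r            ≤⟨ ℚ.*-monoʳ-≤-nonNeg r {{recip-nonNeg (suc i)}}
                                            (ℚ.*-monoʳ-≤-nonNeg Q {{ℚ.nonNegative 0≤Q}} (ℚ.+-mono-≤ (a≤ i K≤i) (a≤ i K≤i))) ⟩
        B * r                          ≤⟨ ℚ.*-monoʳ-≤-nonNeg r {{recip-nonNeg (suc i)}} (B≤ i M≤i) ⟩
        ι (suc i) * ε * r              ≡⟨ ring5 (ι (suc i)) ε r ⟩
        ι (suc i) * r * ε              ≡⟨ cong (_* ε) (ι*recip (suc i)) ⟩
        1ℚ * ε                         ≡⟨ ℚ.*-identityˡ ε ⟩
        ε                              ∎
        where r = recip (suc i)

    cauchy : IsCauchy S
    cauchy ε 0<ε with a-small ε 0<ε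
    ... | N , h = N , close
      where
      one-sided : ∀ m n → N ℕ.≤ n → n ℕ.≤ m → ∣ S m - S n ∣ ≤ ε
      one-sided m n N≤n n≤m = ℚ.≤-trans (tail-≤ (proj₁ (h n N≤n)) n≤m) (proj₂ (h n N≤n))

      close : ∀ m n → N ℕ.≤ m → N ℕ.≤ n → ∣ S m - S n ∣ ≤ ε
      close m n N≤m N≤n with ℕ.≤-total n m
      ... | inj₁ n≤m = one-sided m n N≤n n≤m
      ... | inj₂ m≤n = subst (_≤ ε) (∣p-q∣≡∣q-p∣ (S n) (S m)) (one-sided n m N≤m m≤n)

  partialSum-cauchy : ∀ q → IsCauchy (partialSum q)
  partialSum-cauchy q = Convergence.cauchy q

-- Real numbers are Cauchy sequences of rationals, with _≈_ as equality.

module Real where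
  open Cauchy using (IsCauchy)

  record ℝ : Set where
    constructor mkℝ
    field
      seq      : ℕ → ℚ
      isCauchy : IsCauchy seq

  open ℝ public

  infix 4 _≈_ _≤_

  _≈_ : Rel ℝ 0ℓ
  x ≈ y = ∀ ε → 0ℚ ℚ.< ε → ∃[ N ] (∀ n → N ℕ.≤ n → ℚ.∣ seq x n ℚ.- seq y n ∣ ℚ.≤ ε)

  _≤_ : Rel ℝ 0ℓ
  x ≤ y = ∀ ε → 0ℚ ℚ.< ε → ∃[ N ] (∀ n → N ℕ.≤ n → seq x n ℚ.≤ seq y n ℚ.+ ε)

  ⌜_⌝ : ℚ → ℝ
  ⌜ q ⌝ = mkℝ (λ _ → q) (Cauchy.const-cauchy q)

  fromℕ : ℕ → ℝ
  fromℕ n = ⌜ + n ℚ./ 1 ⌝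

  1ℝ : ℝ
  1ℝ = ⌜ 1ℚ ⌝

  infix  8 -_
  infixl 7 _*_
  infixl 6 _+_ _-_

  _+_ : ℝ → ℝ → ℝ
  mkℝ s cs + mkℝ t ct = mkℝ (λ n → s n ℚ.+ t n) (Cauchy.+-cauchy {s} {t} cs ct)

  -_ : ℝ → ℝ
  - mkℝ s cs = mkℝ (λ n → ℚ.- s n) (Cauchy.neg-cauchy {s} cs)

  _-_ : ℝ → ℝ → ℝ
  x - y = x + (- y)

  _*_ : ℝ → ℝ → ℝ
  mkℝ s cs * mkℝ t ct = mkℝ (λ n → s n ℚ.* t n) (Cauchy.*-cauchy {s} {t} cs ct)

  ∣_∣ : ℝ → ℝ
  ∣ mkℝ s cs ∣ = mkℝ (λ n → ℚ.∣ s n ∣) (Cauchy.abs-cauchy {s} cs)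

  exp : ℚ → ℝ
  exp q = mkℝ (Exponential.partialSum q) (Exponential.partialSum-cauchy q)

open Real public

Sequence : Set
Sequence = (r : ℕ) .{{_ : NonZero r}} → ℝ

infix 4 _∈O_

_∈O_ : Sequence → Sequence → Set
f ∈O g = ∃[ M ] ∃[ R ] (∀ r .{{_ : NonZero r}} → R ℕ.≤ r → ∣ f r ∣ ≤ M * ∣ g r ∣)

r^-2 : Sequence
r^-2 r = ⌜ (1ℤ ℚ./ (r ℕ.^ 2)) {{m^n≢0 r 2}} ⌝

module Submission where

-- Write S(k, j) for the Stirling numbers and q_k(z) = Σ_i (−1)^i S(k, k − i) z^i.  Deleting
-- sources one at a time shows that AO(K_{κ_1,…,κ_r}) satisfies the recursion which integration
-- by parts gives for ∫_0^∞ e^(−t) ∏_i t^(κ_i) q_{κ_i}(1/t) dt, so the two agree.  With N = k r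
-- and b_m = [z^m] q_k^r this reads C_k(r) / N! = Σ_m b_m (N − m)! / N!.  To second order
-- q_k = exp(a z) (1 + σ z²), so b_m / r^m = a^m/m! + (σ/r) a^(m−2)/(m−2)! + O(r^(−2)), while
-- r^m (N − m)! / N! = k^(−m) (1 + m(m − 1)/(2N)) + O(r^(−2)); both errors are dominated by r^(−2)
-- times the coefficients of an exponential series, so summation over m gives e^(a/k) and its
-- 1/r correction.

open import Defs hiding (_≈_; _≤_; _+_; _*_; _-_; -_; ∣_∣)
open import Data.Bool using (Bool; true; false; if_then_else_)
open import Data.Empty using (⊥; ⊥-elim)
open import Data.Fin using (Fin; zero; suc; quotient; remQuot; combine)
open import Data.Fin.Induction using (spo-wellFounded)
open import Data.Fin.Properties using (all?; any?; combine-remQuot; remQuot-combine; combine-injectiveʳ) renaming (_≟_ to _≟ᶠ_)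
open import Data.Integer as ℤ using (ℤ)
import Data.Integer.Properties as ℤ
import Data.Integer.Tactic.RingSolver as ℤ-Solver
open import Data.List using (List; []; _∷_; length; filter; map; _++_; allFin)
open import Data.List.Membership.Propositional using (_∈_; find)
open import Data.List.Membership.Propositional.Properties using (∈-filter⁺; ∈-filter⁻; ∈-map⁺; ∈-map⁻; ∈-allFin; ∈-∃++; ∈-++⁺ˡ; ∈-++⁺ʳ; ∈-++⁻)
open import Data.List.Properties using (length-map; length-++; length-tabulate; ++-identityʳ; filter-≐)
open import Data.List.Relation.Unary.All as All using (All; []; _∷_)
import Data.List.Relation.Unary.All.Properties as All
open import Data.List.Relation.Unary.AllPairs as AllPairs using (AllPairs; []; _∷_)
import Data.List.Relation.Unary.AllPairs.Properties as AllPairs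
open import Data.List.Relation.Unary.Any as Any using (Any; here; there)
open import Data.List.Relation.Unary.Unique.Propositional using (Unique)
import Data.List.Relation.Unary.Unique.Propositional.Properties as Unique
open import Data.Nat as ℕ using (ℕ; zero; suc; NonZero; _!)
import Data.Nat.Properties as ℕ
open import Data.Nat.Properties using (m*n≢0; _!≢0)
open import Data.Product using (∃; ∃-syntax; _×_; _,_; proj₁; proj₂)
open import Data.Rational as ℚ using (ℚ; 0ℚ; 1ℚ; ½)
import Data.Rational.Properties as ℚ
import Data.Rational.Unnormalised as ℚᵘ
import Data.Rational.Unnormalised.Properties as ℚᵘ
open import Data.Sum using (_⊎_; inj₁; inj₂; [_,_]′)
open import Data.Vec using (Vec; lookup; tabulate)
open import Data.Vec.Functional using (updateAt)
open import Data.Vec.Functional.Properties using (updateAt-updates; updateAt-minimal; updateAt-id-local)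
open import Data.Vec.Properties using (lookup∘tabulate; tabulate∘lookup; tabulate-cong; []=⇒lookup; lookup⇒[]=)
open import Function using (_∘_; id; it)
open import Induction.WellFounded using (Acc; acc)
open import Level using (0ℓ)
open import Relation.Binary using (Rel; Decidable; IsStrictPartialOrder)
open import Relation.Binary.Construct.Closure.Transitive using (TransClosure; [_]; _∷_) renaming (_++_ to _++⁺_)
open import Relation.Binary.PropositionalEquality
  using (_≡_; _≢_; refl; sym; trans; cong; cong₂; subst; subst₂; isEquivalence; module ≡-Reasoning)
open import Relation.Nullary using (Dec; yes; no; ¬_; ¬?; contradiction; does)
open import Relation.Nullary.Decidable using (_×-dec_; _⊎-dec_; dec⇒maybe)
import Relation.Unary as U
open import Tactic.RingSolver using (solve-∀)
open import Tactic.RingSolver.Core.AlmostCommutativeRing using (AlmostCommutativeRing; fromCommutativeRing)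

open import Algebra.Definitions.RawSemiring ℚ.+-*-rawSemiring using (_^_)
open Cauchy using (ι; /-toℚᵘ; ι-mono; recip; recip-*; ι*recip; recip-nonNeg; *-mono-nonNeg; EventuallyBounded; eventually-bounded; divide)
open Exponential using (term; partialSum; partialSum-cauchy)

-- The enumeration counts orientations by the part that contains the sources, as the total minus the
-- number with no source in that part. The restricted count has as many vertices as the total, so
-- induction on vertices alone would be circular. Only the difference is computed: moving the
-- vertices of the part into the forbidden list one at a time costs one deletion each, hence
-- involves smaller graphs only. On the side of the integrals the same telescoping is the
-- commutation rule (1 - D) t = t (1 - D) - 1 with D = d/dt.
--
-- In the analysis the summation range grows with r while all constants must not. Majorants of the
-- base series are therefore normalised to scale 1, so that an r-th power is majorised by exp(r A z)
-- and z ↦ z/r removes r again. For m > (k - 1) r the weight r^m (N - m)! / N! is out of control,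
-- but b_m = 0 there, and the comparison series itself has to be shown small.
--
-- The remainder is not estimated as a limit of unknown form: it is defined by solving the claimed
-- equation for it, with exp(-e) as the inverse of exp(e).

module Analysis where
  open import Data.Rational using (_+_; _*_; _-_; -_; ∣_∣; _≤_; _<_)
  open ℚ.≤-Reasoning

  -- Arithmetic and inequalities of rationals

  ℚ-ring : AlmostCommutativeRing 0ℓ 0ℓ
  ℚ-ring = fromCommutativeRing ℚ.+-*-commutativeRing (λ x → dec⇒maybe (0ℚ ℚ.≟ x))

  neg≡-1* : ∀ x → - x ≡ - 1ℚ * x
  neg≡-1* = solve-∀ ℚ-ring

  /1-homo-+ : ∀ i j → (i ℤ.+ j) ℚ./ 1 ≡ i ℚ./ 1 + j ℚ./ 1
  /1-homo-+ i j = ℚ.toℚᵘ-injective (ℚᵘ.≃-trans (/-toℚᵘ (i ℤ.+ j) 0) (ℚᵘ.≃-sym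
    (ℚᵘ.≃-trans (ℚ.toℚᵘ-homo-+ (i ℚ./ 1) (j ℚ./ 1))
    (ℚᵘ.≃-trans (ℚᵘ.+-cong (/-toℚᵘ i 0) (/-toℚᵘ j 0)) (ℚᵘ.*≡* (lemma i j))))))
    where
    lemma : ∀ i j → (i ℤ.* ℤ.+ 1 ℤ.+ j ℤ.* ℤ.+ 1) ℤ.* ℤ.+ 1 ≡ (i ℤ.+ j) ℤ.* ℤ.+ 1
    lemma = ℤ-Solver.solve-∀

  /1-homo-* : ∀ i j → (i ℤ.* j) ℚ./ 1 ≡ (i ℚ./ 1) * (j ℚ./ 1)
  /1-homo-* i j = ℚ.toℚᵘ-injective (ℚᵘ.≃-trans (/-toℚᵘ (i ℤ.* j) 0) (ℚᵘ.≃-sym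
    (ℚᵘ.≃-trans (ℚ.toℚᵘ-homo-* (i ℚ./ 1) (j ℚ./ 1))
    (ℚᵘ.≃-trans (ℚᵘ.*-cong (/-toℚᵘ i 0) (/-toℚᵘ j 0)) (ℚᵘ.*≡* refl)))))

  /1-homo-neg : ∀ i → (ℤ.- i) ℚ./ 1 ≡ - (i ℚ./ 1)
  /1-homo-neg i = ℚ.toℚᵘ-injective (ℚᵘ.≃-trans (/-toℚᵘ (ℤ.- i) 0) (ℚᵘ.≃-sym
    (ℚᵘ.≃-trans (ℚ.toℚᵘ-homo‿- (i ℚ./ 1)) (ℚᵘ.-‿cong (/-toℚᵘ i 0)))))

  /≡/1*recip : ∀ i n .{{_ : NonZero n}} → i ℚ./ n ≡ (i ℚ./ 1) * recip n
  /≡/1*recip i (suc n) = ℚ.toℚᵘ-injective (ℚᵘ.≃-trans (/-toℚᵘ i n) (ℚᵘ.≃-sym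
    (ℚᵘ.≃-trans (ℚ.toℚᵘ-homo-* (i ℚ./ 1) (recip (suc n)))
    (ℚᵘ.≃-trans (ℚᵘ.*-cong (/-toℚᵘ i 0) (/-toℚᵘ (ℤ.+ 1) n)) (ℚᵘ.*≡* lemma)))))
    where
    lemma : i ℤ.* ℤ.+ 1 ℤ.* ℤ.+ suc n ≡ i ℤ.* ℤ.+ suc (n ℕ.+ 0)
    lemma = cong₂ ℤ._*_ (ℤ.*-identityʳ i) (cong (ℤ.+_ ∘ suc) (sym (ℕ.+-identityʳ n)))

  ι-+ : ∀ m n → ι (m ℕ.+ n) ≡ ι m + ι n
  ι-+ m n = /1-homo-+ (ℤ.+ m) (ℤ.+ n)

  ι-* : ∀ m n → ι (m ℕ.* n) ≡ ι m * ι n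
  ι-* m n = trans (cong (ℚ._/ 1) (ℤ.pos-* m n)) (/1-homo-* (ℤ.+ m) (ℤ.+ n))

  ι-suc : ∀ n → ι (suc n) ≡ 1ℚ + ι n
  ι-suc = ι-+ 1

  0≤1 : 0ℚ ≤ 1ℚ
  0≤1 = ℚ.nonNegative⁻¹ 1ℚ

  0≤ι : ∀ n → 0ℚ ≤ ι n
  0≤ι n = ι-mono {0} {n} ℕ.z≤n

  1≤ι : ∀ n → 1ℚ ≤ ι (suc n)
  1≤ι n = ι-mono {1} {suc n} (ℕ.s≤s ℕ.z≤n)

  0≤recip : ∀ n .{{_ : NonZero n}} → 0ℚ ≤ recip n
  0≤recip n = ℚ.nonNegative⁻¹ (recip n) {{recip-nonNeg n}}

  recip≤1 : ∀ n .{{_ : NonZero n}} → recip n ≤ 1ℚ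
  recip≤1 n@(suc n-1) = begin
    recip n         ≡⟨ ℚ.*-identityˡ (recip n) ⟨
    1ℚ * recip n    ≤⟨ ℚ.*-monoʳ-≤-nonNeg (recip n) {{recip-nonNeg n}} (1≤ι n-1) ⟩
    ι n * recip n   ≡⟨ ι*recip n ⟩
    1ℚ              ∎

  0≤+ : ∀ {p q} → 0ℚ ≤ p → 0ℚ ≤ q → 0ℚ ≤ p + q
  0≤+ = ℚ.+-mono-≤ {0ℚ} {_} {0ℚ}

  0≤* : ∀ {p q} → 0ℚ ≤ p → 0ℚ ≤ q → 0ℚ ≤ p * q
  0≤* {p} {q} 0≤p 0≤q = subst (_≤ p * q) (ℚ.*-zeroʳ p) (ℚ.*-monoˡ-≤-nonNeg p {{ℚ.nonNegative 0≤p}} 0≤q)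

  0≤^ : ∀ {p} → 0ℚ ≤ p → ∀ n → 0ℚ ≤ p ^ n
  0≤^ 0≤p zero    = 0≤1
  0≤^ 0≤p (suc n) = 0≤* 0≤p (0≤^ 0≤p n)

  ^≤1 : ∀ {p} → 0ℚ ≤ p → p ≤ 1ℚ → ∀ n → p ^ n ≤ 1ℚ
  ^≤1 0≤p p≤1 zero    = ℚ.≤-refl
  ^≤1 0≤p p≤1 (suc n) = *-mono-nonNeg 0≤p p≤1 (0≤^ 0≤p n) (^≤1 0≤p p≤1 n)

  *-monoˡ : ∀ {p q r} → 0ℚ ≤ r → p ≤ q → r * p ≤ r * q
  *-monoˡ {r = r} 0≤r = ℚ.*-monoˡ-≤-nonNeg r {{ℚ.nonNegative 0≤r}}

  *-monoʳ : ∀ {p q r} → 0ℚ ≤ r → p ≤ q → p * r ≤ q * r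
  *-monoʳ {r = r} 0≤r = ℚ.*-monoʳ-≤-nonNeg r {{ℚ.nonNegative 0≤r}}

  p≤p+q : ∀ {p q} → 0ℚ ≤ q → p ≤ p + q
  p≤p+q {p} {q} 0≤q = subst (_≤ p + q) (ℚ.+-identityʳ p) (ℚ.+-monoʳ-≤ p 0≤q)

  p≤q+p : ∀ {p q} → 0ℚ ≤ q → p ≤ q + p
  p≤q+p {p} {q} 0≤q = subst (_≤ q + p) (ℚ.+-identityˡ p) (ℚ.+-monoˡ-≤ p 0≤q)

  ∣+∣≤ : ∀ {p q r s} → ∣ p ∣ ≤ r → ∣ q ∣ ≤ s → ∣ p + q ∣ ≤ r + s
  ∣+∣≤ {p} {q} p≤ q≤ = ℚ.≤-trans (ℚ.∣p+q∣≤∣p∣+∣q∣ p q) (ℚ.+-mono-≤ p≤ q≤)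

  ∣-∣≤ : ∀ {p q r s} → ∣ p ∣ ≤ r → ∣ q ∣ ≤ s → ∣ p - q ∣ ≤ r + s
  ∣-∣≤ {p} {q} p≤ q≤ = ℚ.≤-trans (ℚ.∣p-q∣≤∣p∣+∣q∣ p q) (ℚ.+-mono-≤ p≤ q≤)

  ∣*∣≤ : ∀ {p q r s} → ∣ p ∣ ≤ r → ∣ q ∣ ≤ s → ∣ p * q ∣ ≤ r * s
  ∣*∣≤ {p} {q} p≤ q≤ = ℚ.≤-trans (ℚ.≤-reflexive (ℚ.∣p*q∣≡∣p∣*∣q∣ p q))
    (*-mono-nonNeg (ℚ.0≤∣p∣ p) p≤ (ℚ.0≤∣p∣ q) q≤)

  ∣0≤∣≤ : ∀ {p q} → 0ℚ ≤ p → p ≤ q → ∣ p ∣ ≤ q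
  ∣0≤∣≤ 0≤p p≤q = subst (_≤ _) (sym (ℚ.0≤p⇒∣p∣≡p 0≤p)) p≤q

  recip*ι* : ∀ r .{{_ : NonZero r}} x → recip r * (ι r * x) ≡ x
  recip*ι* r x = trans (identity (recip r) (ι r) x) (trans (cong (_* x) (ι*recip r)) (ℚ.*-identityˡ x))
    where
    identity : ∀ p r x → p * (r * x) ≡ r * p * x
    identity = solve-∀ ℚ-ring

  p≤∣p∣ : ∀ p → p ≤ ∣ p ∣
  p≤∣p∣ p with ℚ.≤-total 0ℚ p
  ... | inj₁ 0≤p = ℚ.≤-reflexive (sym (ℚ.0≤p⇒∣p∣≡p 0≤p))
  ... | inj₂ p≤0 = ℚ.≤-trans p≤0 (ℚ.0≤∣p∣ p)

  -- Power series

  Series : Set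
  Series = ℕ → ℚ

  infix 4 _≗_
  _≗_ : Series → Series → Set
  f ≗ g = ∀ m → f m ≡ g m

  one : Series
  one zero    = 1ℚ
  one (suc _) = 0ℚ

  z· : Series → Series
  z· f zero    = 0ℚ
  z· f (suc m) = f m

  -- The Cauchy product, peeled along the first factor: the laws below are inductions on the degree
  -- in which `f ∘ suc` takes the place of `f`.
  conv : Series → Series → Series
  conv f g zero    = f 0 * g 0
  conv f g (suc m) = f 0 * g (suc m) + conv (f ∘ suc) g m

  conv-cong : ∀ {f f′ g g′} → f ≗ f′ → g ≗ g′ → conv f g ≗ conv f′ g′
  conv-cong p q zero    = cong₂ _*_ (p 0) (q 0)
  conv-cong p q (suc m) = cong₂ _+_ (cong₂ _*_ (p 0) (q (suc m))) (conv-cong (p ∘ suc) q m)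

  z·-cong : ∀ {f g} → f ≗ g → z· f ≗ z· g
  z·-cong p zero    = refl
  z·-cong p (suc m) = p m

  conv-z·ˡ : ∀ f g → conv (z· f) g ≗ z· (conv f g)
  conv-z·ˡ f g zero    = ℚ.*-zeroˡ (g 0)
  conv-z·ˡ f g (suc m) = trans (cong (_+ conv f g m) (ℚ.*-zeroˡ (g (suc m)))) (ℚ.+-identityˡ _)

  conv-z·ʳ : ∀ f g → conv f (z· g) ≗ z· (conv f g)
  conv-z·ʳ f g zero          = ℚ.*-zeroʳ (f 0)
  conv-z·ʳ f g (suc zero)    = trans (cong (f 0 * g 0 +_) (ℚ.*-zeroʳ (f 1))) (ℚ.+-identityʳ (f 0 * g 0))
  conv-z·ʳ f g (suc (suc m)) = cong (f 0 * g (suc m) +_) (conv-z·ʳ (f ∘ suc) g (suc m))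

  conv-+ˡ : ∀ f f′ g → conv (λ m → f m + f′ m) g ≗ λ m → conv f g m + conv f′ g m
  conv-+ˡ f f′ g zero    = ℚ.*-distribʳ-+ (g 0) (f 0) (f′ 0)
  conv-+ˡ f f′ g (suc m) = trans (cong ((f 0 + f′ 0) * g (suc m) +_) (conv-+ˡ (f ∘ suc) (f′ ∘ suc) g m))
    (identity (f 0) (f′ 0) (g (suc m)) (conv (f ∘ suc) g m) (conv (f′ ∘ suc) g m))
    where
    identity : ∀ a b c x y → (a + b) * c + (x + y) ≡ (a * c + x) + (b * c + y)
    identity = solve-∀ ℚ-ring

  conv-+ʳ : ∀ f g g′ → conv f (λ m → g m + g′ m) ≗ λ m → conv f g m + conv f g′ m
  conv-+ʳ f g g′ zero    = ℚ.*-distribˡ-+ (f 0) (g 0) (g′ 0)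
  conv-+ʳ f g g′ (suc m) = trans (cong (f 0 * (g (suc m) + g′ (suc m)) +_) (conv-+ʳ (f ∘ suc) g g′ m))
    (identity (f 0) (g (suc m)) (g′ (suc m)) (conv (f ∘ suc) g m) (conv (f ∘ suc) g′ m))
    where
    identity : ∀ a b c x y → a * (b + c) + (x + y) ≡ (a * b + x) + (a * c + y)
    identity = solve-∀ ℚ-ring

  conv-·ˡ : ∀ c f g → conv (λ m → c * f m) g ≗ λ m → c * conv f g m
  conv-·ˡ c f g zero    = ℚ.*-assoc c (f 0) (g 0)
  conv-·ˡ c f g (suc m) = trans (cong (c * f 0 * g (suc m) +_) (conv-·ˡ c (f ∘ suc) g m)) (identity c (f 0) (g (suc m)) (conv (f ∘ suc) g m))
    where
    identity : ∀ c a b x → c * a * b + c * x ≡ c * (a * b + x)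
    identity = solve-∀ ℚ-ring

  conv-·ʳ : ∀ c f g → conv f (λ m → c * g m) ≗ λ m → c * conv f g m
  conv-·ʳ c f g zero    = identity c (f 0) (g 0)
    where
    identity : ∀ c a b → a * (c * b) ≡ c * (a * b)
    identity = solve-∀ ℚ-ring
  conv-·ʳ c f g (suc m) = trans (cong (f 0 * (c * g (suc m)) +_) (conv-·ʳ c (f ∘ suc) g m)) (identity c (f 0) (g (suc m)) (conv (f ∘ suc) g m))
    where
    identity : ∀ c a b x → a * (c * b) + c * x ≡ c * (a * b + x)
    identity = solve-∀ ℚ-ring

  -- Majorisation in the sense of Cauchy; the majorant is automatically nonnegative, since it bounds
  -- an absolute value.
  infix 4 _≼_
  _≼_ : Series → Series → Set
  f ≼ F = ∀ m → ∣ f m ∣ ≤ F m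

  conv-mono : ∀ {f g F G} → f ≼ F → g ≼ G → conv f g ≼ conv F G
  conv-mono p q zero    = ∣*∣≤ (p 0) (q 0)
  conv-mono p q (suc m) = ∣+∣≤ (∣*∣≤ (p 0) (q (suc m))) (conv-mono (p ∘ suc) q m)

  conv-nonNeg : ∀ {f g} → (∀ m → 0ℚ ≤ f m) → (∀ m → 0ℚ ≤ g m) → ∀ m → 0ℚ ≤ conv f g m
  conv-nonNeg p q zero    = 0≤* (p 0) (q 0)
  conv-nonNeg p q (suc m) = 0≤+ (0≤* (p 0) (q (suc m))) (conv-nonNeg (p ∘ suc) q m)

  z·-mono : ∀ {f F} → f ≼ F → z· f ≼ z· F
  z·-mono p zero    = ℚ.≤-refl
  z·-mono p (suc m) = p m

  -- The weighting m ↦ c − m satisfies a Leibniz rule, being (up to sign and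
  -- shift) the Euler derivation z d/dz.
  weight : ℚ → Series → Series
  weight c f m = (c - ι m) * f m

  weight-suc : ∀ c f m → weight c f (suc m) ≡ weight (c - 1ℚ) (f ∘ suc) m
  weight-suc c f m = cong (_* f (suc m)) (trans (cong (λ i → c - i) (ι-suc m)) (identity c (ι m)))
    where
    identity : ∀ c i → c - (1ℚ + i) ≡ (c - 1ℚ) - i
    identity = solve-∀ ℚ-ring

  -- For i + j = m the weight splits as (a - i) + (b - j): the product rule for polynomials
  -- homogenised to degrees a and b. Passing to `f ∘ suc` lowers a by one, so a has to vary in the
  -- induction.
  weight-conv : ∀ a b f g m →
    weight (a + b) (conv f g) m ≡ conv (weight a f) g m + conv f (weight b g) m
  weight-conv a b f g zero = identity a b (f 0) (g 0)
    where
    identity : ∀ a b x y → (a + b - 0ℚ) * (x * y) ≡ (a - 0ℚ) * x * y + x * ((b - 0ℚ) * y)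
    identity = solve-∀ ℚ-ring
  weight-conv a b f g (suc m) = begin-equality
    (a + b - j) * (f 0 * g (suc m) + conv f′ g m)
      ≡⟨ identity₁ a b j (f 0) (g (suc m)) (conv f′ g m) ⟩
    P + (a + b - j) * conv f′ g m
      ≡⟨ cong (λ t → P + t * conv f′ g m) (trans (cong (λ i → a + b - i) (ι-suc m)) (identity₂ a b (ι m))) ⟩
    P + weight ((a - 1ℚ) + b) (conv f′ g) m
      ≡⟨ cong (P +_) (weight-conv (a - 1ℚ) b f′ g m) ⟩
    P + (conv (weight (a - 1ℚ) f′) g m + conv f′ (weight b g) m)
      ≡⟨ cong (λ t → P + (t + conv f′ (weight b g) m)) (conv-cong {g = g} (λ i → sym (weight-suc a f i)) (λ _ → refl) m) ⟩
    P + (conv (weight a f ∘ suc) g m + conv f′ (weight b g) m)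
      ≡⟨ identity₃ ((a - 0ℚ) * f 0 * g (suc m)) (f 0 * ((b - j) * g (suc m))) _ _ ⟩
    conv (weight a f) g (suc m) + conv f (weight b g) (suc m) ∎
    where
    f′ = f ∘ suc
    j = ι (suc m)
    P = (a - 0ℚ) * f 0 * g (suc m) + f 0 * ((b - j) * g (suc m))
    identity₁ : ∀ a b j x y w → (a + b - j) * (x * y + w) ≡ (a - 0ℚ) * x * y + x * ((b - j) * y) + (a + b - j) * w
    identity₁ = solve-∀ ℚ-ring
    identity₂ : ∀ a b i → a + b - (1ℚ + i) ≡ (a - 1ℚ) + b - i
    identity₂ = solve-∀ ℚ-ring
    identity₃ : ∀ x y u v → x + y + (u + v) ≡ (x + u) + (y + v)
    identity₃ = solve-∀ ℚ-ring

  -- Exponential series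

  ^-distrib-* : ∀ c x n → (c * x) ^ n ≡ c ^ n * x ^ n
  ^-distrib-* c x zero    = refl
  ^-distrib-* c x (suc n) = trans (cong (c * x *_) (^-distrib-* c x n)) (identity c x (c ^ n) (x ^ n))
    where
    identity : ∀ c x u v → c * x * (u * v) ≡ c * u * (x * v)
    identity = solve-∀ ℚ-ring

  term-scale : ∀ c a m → c ^ m * term a m ≡ term (c * a) m
  term-scale c a m = trans (sym (ℚ.*-assoc (c ^ m) (a ^ m) _)) (cong (_* _) (sym (^-distrib-* c a m)))

  -- The differential equation of exp(a z), read off coefficientwise.
  ι*term-suc : ∀ a m → ι (suc m) * term a (suc m) ≡ a * term a m
  ι*term-suc a m = begin-equality
    ι (suc m) * (a * a ^ m * recip (suc m !) {{suc m !≢0}})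
      ≡⟨ cong (λ t → ι (suc m) * (a * a ^ m * t)) (recip-* (suc m) (m !) {{_}} {{m !≢0}} {{suc m !≢0}}) ⟩
    ι (suc m) * (a * a ^ m * (recip (suc m) * recip (m !) {{m !≢0}}))
      ≡⟨ identity (ι (suc m)) (recip (suc m)) a (a ^ m) (recip (m !) {{m !≢0}}) ⟩
    ι (suc m) * recip (suc m) * (a * term a m)
      ≡⟨ cong (_* (a * term a m)) (ι*recip (suc m)) ⟩
    1ℚ * (a * term a m)
      ≡⟨ ℚ.*-identityˡ _ ⟩
    a * term a m ∎
    where
    identity : ∀ i j a p r → i * (a * p * (j * r)) ≡ i * j * (a * (p * r))
    identity = solve-∀ ℚ-ring

  ι-cancel : ∀ n {p q} → ι (suc n) * p ≡ ι (suc n) * q → p ≡ q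
  ι-cancel n {p} {q} eq = trans (sym (recip*ι* (suc n) p)) (trans (cong (recip (suc n) *_) eq) (recip*ι* (suc n) q))

  -- In place of the binomial theorem: `weight 0ℚ` is -z d/dz, so by the product rule both sides
  -- satisfy the differential equation of exp((a + b) z), which determines coefficient m + 1 from
  -- coefficient m.
  conv-term : ∀ a b → conv (term a) (term b) ≗ term (a + b)
  conv-term a b zero    = refl
  conv-term a b (suc m) = ι-cancel m (begin-equality
    ι (suc m) * W (suc m)
      ≡⟨ identity₁ (ι (suc m)) (W (suc m)) ⟩
    - weight (0ℚ + 0ℚ) W (suc m)
      ≡⟨ cong -_ (weight-conv 0ℚ 0ℚ (term a) (term b) (suc m)) ⟩
    - (conv (weight 0ℚ (term a)) (term b) (suc m) + conv (term a) (weight 0ℚ (term b)) (suc m))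
      ≡⟨ cong₂ (λ x y → - (x + y))
           (trans (conv-cong {g = term b} (euler a) (λ _ → refl) (suc m)) (conv-z·ˡ _ (term b) (suc m)))
           (trans (conv-cong {f = term a} (λ _ → refl) (euler b) (suc m)) (conv-z·ʳ (term a) _ (suc m))) ⟩
    - (conv (λ i → - a * term a i) (term b) m + conv (term a) (λ i → - b * term b i) m)
      ≡⟨ cong₂ (λ x y → - (x + y)) (conv-·ˡ (- a) (term a) (term b) m) (conv-·ʳ (- b) (term a) (term b) m) ⟩
    - (- a * W m + - b * W m)
      ≡⟨ identity₂ a b (W m) ⟩
    (a + b) * W m
      ≡⟨ cong ((a + b) *_) (conv-term a b m) ⟩
    (a + b) * term (a + b) m
      ≡⟨ ι*term-suc (a + b) m ⟨
    ι (suc m) * term (a + b) (suc m) ∎)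
    where
    W = conv (term a) (term b)
    identity₁ : ∀ i w → i * w ≡ - ((0ℚ + 0ℚ - i) * w)
    identity₁ = solve-∀ ℚ-ring
    identity₂ : ∀ a b w → - (- a * w + - b * w) ≡ (a + b) * w
    identity₂ = solve-∀ ℚ-ring
    identity₃ : ∀ a t → - (a * t) ≡ - a * t
    identity₃ = solve-∀ ℚ-ring
    identity₄ : ∀ i t → (0ℚ - i) * t ≡ - (i * t)
    identity₄ = solve-∀ ℚ-ring
    euler : ∀ c → weight 0ℚ (term c) ≗ z· (λ i → - c * term c i)
    euler c zero    = refl
    euler c (suc i) = trans (identity₄ (ι (suc i)) (term c (suc i)))
      (trans (cong -_ (ι*term-suc c i)) (identity₃ c (term c i)))

  0≤term : ∀ {a} → 0ℚ ≤ a → ∀ m → 0ℚ ≤ term a m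
  0≤term 0≤a m = 0≤* (0≤^ 0≤a m) (0≤recip (m !) {{m !≢0}})

  ^-mono : ∀ {a b} → 0ℚ ≤ a → a ≤ b → ∀ n → a ^ n ≤ b ^ n
  ^-mono 0≤a a≤b zero    = ℚ.≤-refl
  ^-mono 0≤a a≤b (suc n) = *-mono-nonNeg 0≤a a≤b (0≤^ 0≤a n) (^-mono 0≤a a≤b n)

  term-mono : ∀ {a b} → 0ℚ ≤ a → a ≤ b → ∀ m → term a m ≤ term b m
  term-mono 0≤a a≤b m = *-monoʳ (0≤recip (m !) {{m !≢0}}) (^-mono 0≤a a≤b m)

  ∣^∣ : ∀ a n → ∣ a ^ n ∣ ≡ ∣ a ∣ ^ n
  ∣^∣ a zero    = refl
  ∣^∣ a (suc n) = trans (ℚ.∣p*q∣≡∣p∣*∣q∣ a (a ^ n)) (cong (∣ a ∣ *_) (∣^∣ a n))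

  ∣term∣ : ∀ a m → ∣ term a m ∣ ≡ term ∣ a ∣ m
  ∣term∣ a m = trans (ℚ.∣p*q∣≡∣p∣*∣q∣ (a ^ m) _)
    (cong₂ _*_ (∣^∣ a m) (ℚ.0≤p⇒∣p∣≡p (0≤recip (m !) {{m !≢0}})))

  term≼ : ∀ {a A} → ∣ a ∣ ≤ A → term a ≼ term A
  term≼ {a} a≤A m = ℚ.≤-trans (ℚ.≤-reflexive (∣term∣ a m)) (term-mono (ℚ.0≤∣p∣ a) a≤A m)

  -- One summand of the Cauchy product of two exponential series.
  term-shift-≤ : ∀ {A c} → 0ℚ ≤ A → 0ℚ ≤ c → ∀ m → c * term A m ≤ term (c + A) (suc m)
  term-shift-≤ {A} {c} 0≤A 0≤c m = begin
    c * term A m                                    ≡⟨ cong (_* term A m) (identity c) ⟨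
    term c 1 * term A m                             ≤⟨ first (term c ∘ suc) (0≤term 0≤c ∘ suc) m ⟩
    conv (term c ∘ suc) (term A) m                  ≤⟨ p≤q+p (0≤* (0≤term 0≤c 0) (0≤term 0≤A (suc m))) ⟩
    conv (term c) (term A) (suc m)                  ≡⟨ conv-term c A (suc m) ⟩
    term (c + A) (suc m)                            ∎
    where
    identity : ∀ c → c * 1ℚ * 1ℚ ≡ c
    identity = solve-∀ ℚ-ring
    first : ∀ f → (∀ i → 0ℚ ≤ f i) → ∀ m → f 0 * term A m ≤ conv f (term A) m
    first f 0≤f zero    = ℚ.≤-refl
    first f 0≤f (suc m) = p≤p+q (conv-nonNeg (0≤f ∘ suc) (0≤term 0≤A) m)

  -- Majorisation by `scale` · exp(`rate` · z). The class is closed under sums, multiples, shifts,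
  -- tails and multiplication by m, so every error term below is summable by construction.
  record ExpBounded (f : Series) : Set where
    constructor expBounded
    field
      rate scale  : ℚ
      0≤rate      : 0ℚ ≤ rate
      0≤scale     : 0ℚ ≤ scale
      dominated   : f ≼ λ m → scale * term rate m

  open ExpBounded

  term-expBounded : ∀ a → ExpBounded (term a)
  term-expBounded a = expBounded ∣ a ∣ 1ℚ (ℚ.0≤∣p∣ a) 0≤1 λ m →
    ℚ.≤-reflexive (trans (∣term∣ a m) (sym (ℚ.*-identityˡ _)))

  +-expBounded : ∀ {f g} → ExpBounded f → ExpBounded g → ExpBounded (λ m → f m + g m)
  +-expBounded (expBounded A B 0≤A 0≤B f≼) (expBounded A′ B′ 0≤A′ 0≤B′ g≼) =
    expBounded (A + A′) (B + B′) (0≤+ 0≤A 0≤A′) (0≤+ 0≤B 0≤B′) λ m →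
    ℚ.≤-trans (∣+∣≤ (f≼ m) (g≼ m)) (ℚ.≤-trans
      (ℚ.+-mono-≤ (*-monoˡ 0≤B (term-mono 0≤A (p≤p+q 0≤A′) m)) (*-monoˡ 0≤B′ (term-mono 0≤A′ (p≤q+p 0≤A) m)))
      (ℚ.≤-reflexive (sym (ℚ.*-distribʳ-+ _ B B′))))

  ·-expBounded : ∀ c {f} → ExpBounded f → ExpBounded (λ m → c * f m)
  ·-expBounded c (expBounded A B 0≤A 0≤B f≼) =
    expBounded A (∣ c ∣ * B) 0≤A (0≤* (ℚ.0≤∣p∣ c) 0≤B) λ m →
    ℚ.≤-trans (∣*∣≤ {c} ℚ.≤-refl (f≼ m)) (ℚ.≤-reflexive (sym (ℚ.*-assoc ∣ c ∣ B _)))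

  -- The factor m lowers the factorial, m A^m / m! = A · A^(m-1) / (m - 1)!, and this is at most one
  -- summand of the expansion of (A + A)^m / m!.
  ι·-expBounded : ∀ {f} → ExpBounded f → ExpBounded (λ m → ι m * f m)
  ι·-expBounded {f} (expBounded A B 0≤A 0≤B f≼) =
    expBounded (A + A) B (0≤+ 0≤A 0≤A) 0≤B λ
    { zero    → ℚ.≤-trans (ℚ.≤-reflexive (cong ∣_∣ (ℚ.*-zeroˡ (f 0)))) (0≤* 0≤B (0≤term (0≤+ 0≤A 0≤A) 0))
    ; (suc m) → begin
        ∣ ι (suc m) * f (suc m) ∣            ≤⟨ ∣*∣≤ (∣0≤∣≤ (0≤ι (suc m)) ℚ.≤-refl) (f≼ (suc m)) ⟩
        ι (suc m) * (B * term A (suc m))     ≡⟨ identity (ι (suc m)) B _ ⟩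
        B * (ι (suc m) * term A (suc m))     ≡⟨ cong (B *_) (ι*term-suc A m) ⟩
        B * (A * term A m)                   ≤⟨ *-monoˡ 0≤B (term-shift-≤ 0≤A 0≤A m) ⟩
        B * term (A + A) (suc m)             ∎ }
    where
    identity : ∀ i b t → i * (b * t) ≡ b * (i * t)
    identity = solve-∀ ℚ-ring

  z·-expBounded : ∀ {f} → ExpBounded f → ExpBounded (z· f)
  z·-expBounded {f} (expBounded A B 0≤A 0≤B f≼) =
    expBounded (1ℚ + A) B (0≤+ 0≤1 0≤A) 0≤B λ
    { zero    → 0≤* 0≤B (0≤term (0≤+ 0≤1 0≤A) 0)
    ; (suc m) → ℚ.≤-trans (f≼ m) (*-monoˡ 0≤B
        (ℚ.≤-trans (ℚ.≤-reflexive (sym (ℚ.*-identityˡ _))) (term-shift-≤ 0≤A 0≤1 m))) }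

  tail-expBounded : ∀ {f} → ExpBounded f → ExpBounded (f ∘ suc)
  tail-expBounded {f} (expBounded A B 0≤A 0≤B f≼) =
    expBounded A (B * A) 0≤A (0≤* 0≤B 0≤A) λ m → begin
      ∣ f (suc m) ∣                        ≤⟨ f≼ (suc m) ⟩
      B * term A (suc m)                   ≡⟨ cong (B *_) (ℚ.*-identityˡ _) ⟨
      B * (1ℚ * term A (suc m))            ≤⟨ *-monoˡ 0≤B (*-monoʳ (0≤term 0≤A (suc m)) (1≤ι m)) ⟩
      B * (ι (suc m) * term A (suc m))     ≡⟨ cong (B *_) (ι*term-suc A m) ⟩
      B * (A * term A m)                   ≡⟨ ℚ.*-assoc B A _ ⟨
      B * A * term A m                     ∎

  -- Trades the scale B for a larger rate through B ≤ (1 + B)^m for m ≥ 1; coefficient 0 needs its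
  -- own bound. Without this, an r-th power would carry a factor B^r.
  absorb-scale : ∀ {f} (F : ExpBounded f) → ∣ f 0 ∣ ≤ 1ℚ → f ≼ term ((1ℚ + scale F) * rate F)
  absorb-scale (expBounded A B 0≤A 0≤B f≼) f0≤1 zero    = f0≤1
  absorb-scale {f} (expBounded A B 0≤A 0≤B f≼) f0≤1 (suc m) = begin
    ∣ f (suc m) ∣                           ≤⟨ f≼ (suc m) ⟩
    B * term A (suc m)                      ≤⟨ *-monoʳ (0≤term 0≤A (suc m)) (p≤q+p {B} 0≤1) ⟩
    (1ℚ + B) * term A (suc m)               ≤⟨ *-monoʳ (0≤term 0≤A (suc m)) (power m) ⟩
    (1ℚ + B) ^ suc m * term A (suc m)       ≡⟨ term-scale (1ℚ + B) A (suc m) ⟩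
    term ((1ℚ + B) * A) (suc m)             ∎
    where
    1≤^ : ∀ m → 1ℚ ≤ (1ℚ + B) ^ m
    1≤^ zero    = ℚ.≤-refl
    1≤^ (suc m) = *-mono-nonNeg 0≤1 (p≤p+q 0≤B) 0≤1 (1≤^ m)
    power : ∀ m → 1ℚ + B ≤ (1ℚ + B) ^ suc m
    power m = ℚ.≤-trans (ℚ.≤-reflexive (sym (ℚ.*-identityʳ _))) (*-monoˡ (0≤+ 0≤1 0≤B) (1≤^ m))

  expBounded-cong : ∀ {f g} → f ≗ g → ExpBounded f → ExpBounded g
  expBounded-cong f≗g (expBounded A B 0≤A 0≤B f≼) =
    expBounded A B 0≤A 0≤B λ m → subst (λ t → ∣ t ∣ ≤ _) (f≗g m) (f≼ m)

  -- Multiplication by powers of z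

  shift : ℕ → Series → Series
  shift zero    f = f
  shift (suc n) f = z· (shift n f)

  shift-cong : ∀ n {f g} → f ≗ g → shift n f ≗ shift n g
  shift-cong zero    p = p
  shift-cong (suc n) p = z·-cong (shift-cong n p)

  shift-+ : ∀ n f g → shift n (λ m → f m + g m) ≗ λ m → shift n f m + shift n g m
  shift-+ zero    f g m       = refl
  shift-+ (suc n) f g zero    = refl
  shift-+ (suc n) f g (suc m) = shift-+ n f g m

  shift-· : ∀ n c f → shift n (λ m → c * f m) ≗ λ m → c * shift n f m
  shift-· zero    c f m       = refl
  shift-· (suc n) c f zero    = sym (ℚ.*-zeroʳ c)
  shift-· (suc n) c f (suc m) = shift-· n c f m

  shift-mono : ∀ n {f F} → f ≼ F → shift n f ≼ shift n F
  shift-mono zero    p = p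
  shift-mono (suc n) p = z·-mono (shift-mono n p)

  shift-nonNeg : ∀ n {f} → (∀ m → 0ℚ ≤ f m) → ∀ m → 0ℚ ≤ shift n f m
  shift-nonNeg zero    p m       = p m
  shift-nonNeg (suc n) p zero    = ℚ.≤-refl
  shift-nonNeg (suc n) p (suc m) = shift-nonNeg n p m

  shift-expBounded : ∀ n {f} → ExpBounded f → ExpBounded (shift n f)
  shift-expBounded zero    F = F
  shift-expBounded (suc n) F = z·-expBounded (shift-expBounded n F)

  conv-shiftˡ : ∀ n f g → conv (shift n f) g ≗ shift n (conv f g)
  conv-shiftˡ zero    f g m = refl
  conv-shiftˡ (suc n) f g m = trans (conv-z·ˡ (shift n f) g m) (z·-cong (conv-shiftˡ n f g) m)

  conv-shiftʳ : ∀ n f g → conv f (shift n g) ≗ shift n (conv f g)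
  conv-shiftʳ zero    f g m = refl
  conv-shiftʳ (suc n) f g m = trans (conv-z·ʳ f (shift n g) m) (z·-cong (conv-shiftʳ n f g) m)

  -- The substitution z ↦ c z in z^n exp(x z).
  shift-scale : ∀ c x n m → c ^ m * shift n (term x) m ≡ c ^ n * shift n (term (c * x)) m
  shift-scale c x zero    m       = trans (term-scale c x m) (sym (ℚ.*-identityˡ _))
  shift-scale c x (suc n) zero    = trans (ℚ.*-zeroʳ (c ^ 0)) (sym (ℚ.*-zeroʳ (c ^ suc n)))
  shift-scale c x (suc n) (suc m) = trans (ℚ.*-assoc c (c ^ m) _)
    (trans (cong (c *_) (shift-scale c x n m)) (sym (ℚ.*-assoc c (c ^ n) _)))

  -- Powers and degrees of series

  pow : Series → ℕ → Series
  pow Q zero    = one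
  pow Q (suc r) = conv Q (pow Q r)

  VanishesBeyond : ℕ → Series → Set
  VanishesBeyond d f = ∀ m → d ℕ.< m → f m ≡ 0ℚ

  one-vanishes : VanishesBeyond 0 one
  one-vanishes (suc m) _ = refl

  conv-vanishes : ∀ p q {f g} → VanishesBeyond p f → VanishesBeyond q g → VanishesBeyond (p ℕ.+ q) (conv f g)
  conv-vanishes p q {f} {g} f-van g-van (suc m) (ℕ.s≤s p+q≤m) = trans
    (cong₂ _+_ (trans (cong (f 0 *_) (g-van (suc m) (ℕ.s≤s (ℕ.≤-trans (ℕ.m≤n+m q p) p+q≤m)))) (ℚ.*-zeroʳ (f 0)))
               (rest p f-van p+q≤m))
    (ℚ.+-identityˡ 0ℚ)
    where
    zero-conv : ∀ {f} → (∀ m → f m ≡ 0ℚ) → ∀ m → conv f g m ≡ 0ℚ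
    zero-conv f≡0 zero    = trans (cong (_* g 0) (f≡0 0)) (ℚ.*-zeroˡ (g 0))
    zero-conv f≡0 (suc m) = trans (cong₂ _+_ (trans (cong (_* g (suc m)) (f≡0 0)) (ℚ.*-zeroˡ (g (suc m))))
                                             (zero-conv (f≡0 ∘ suc) m)) (ℚ.+-identityˡ 0ℚ)
    rest : ∀ p → VanishesBeyond p f → p ℕ.+ q ℕ.≤ m → conv (f ∘ suc) g m ≡ 0ℚ
    rest zero    f-van _  = zero-conv (λ i → f-van (suc i) (ℕ.s≤s ℕ.z≤n)) m
    rest (suc p) f-van lt = conv-vanishes p q (λ i p<i → f-van (suc i) (ℕ.s≤s p<i)) g-van m lt

  pow-vanishes : ∀ {d Q} → VanishesBeyond d Q → ∀ r → VanishesBeyond (r ℕ.* d) (pow Q r)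
  pow-vanishes         Q-van zero    = one-vanishes
  pow-vanishes {d} {Q} Q-van (suc r) = conv-vanishes d (r ℕ.* d) Q-van (pow-vanishes Q-van r)

  -- Powers of a series with constant term 1, to second order

  module Powers (Q : Series) (Q0≡1 : Q 0 ≡ 1ℚ) (Q-bounded : ExpBounded Q) where

    a : ℚ
    a = Q 1

    S : Series
    S m = Q (2 ℕ.+ m) - term a (2 ℕ.+ m)

    σ : ℚ
    σ = S 0

    Q≗ : Q ≗ λ m → term a m + shift 2 S m
    Q≗ zero          = Q0≡1
    Q≗ (suc zero)    = identity a
      where
      identity : ∀ a → a ≡ a * 1ℚ * 1ℚ + 0ℚ
      identity = solve-∀ ℚ-ring
    Q≗ (suc (suc m)) = identity (Q (2 ℕ.+ m)) (term a (2 ℕ.+ m))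
      where
      identity : ∀ q t → q ≡ t + (q - t)
      identity = solve-∀ ℚ-ring

    -- The defect of one multiplication step: S Y_r - σ X_(r+1) = z U X_r + r z² V X_r. Here z U =
    -- (S - σ) - σ (exp(a z) - 1), the second bracket coming from the replacement of X_r by X_(r+1).
    U V : Series
    U m = S (suc m) + (- σ) * term a (suc m)
    V m = σ * S m

    S-bounded : ExpBounded S
    S-bounded = expBounded-cong (λ m → identity (Q (2 ℕ.+ m)) (term a (2 ℕ.+ m)))
      (tail-expBounded (tail-expBounded
        (+-expBounded Q-bounded (·-expBounded (- 1ℚ) (term-expBounded a)))))
      where
      identity : ∀ q t → q + - 1ℚ * t ≡ q - t
      identity = solve-∀ ℚ-ring

    U-bounded : ExpBounded U
    U-bounded = +-expBounded (tail-expBounded S-bounded)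
                             (·-expBounded (- σ) (tail-expBounded (term-expBounded a)))

    V-bounded : ExpBounded V
    V-bounded = ·-expBounded σ S-bounded

    -- `A₀` is the rate at which `Q` is majorised with scale 1. `A` adds the remaining rates so that
    -- one exponential serves `Q`, exp(a z), `U` and `V`.
    A₀ A B : ℚ
    A₀ = (1ℚ + scale Q-bounded) * rate Q-bounded
    A = ∣ a ∣ + A₀ + (rate U-bounded + rate V-bounded)
    B = scale U-bounded + scale V-bounded

    0≤A₀ : 0ℚ ≤ A₀
    0≤A₀ = 0≤* (0≤+ 0≤1 (0≤scale Q-bounded)) (0≤rate Q-bounded)

    0≤∣a∣+A₀ : 0ℚ ≤ ∣ a ∣ + A₀
    0≤∣a∣+A₀ = 0≤+ (ℚ.0≤∣p∣ a) 0≤A₀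

    0≤rates : 0ℚ ≤ rate U-bounded + rate V-bounded
    0≤rates = 0≤+ (0≤rate U-bounded) (0≤rate V-bounded)

    0≤A : 0ℚ ≤ A
    0≤A = 0≤+ 0≤∣a∣+A₀ 0≤rates

    0≤B : 0ℚ ≤ B
    0≤B = 0≤+ (0≤scale U-bounded) (0≤scale V-bounded)

    ∣a∣≤A : ∣ a ∣ ≤ A
    ∣a∣≤A = ℚ.≤-trans (p≤p+q 0≤A₀) (p≤p+q 0≤rates)

    Q≼ : Q ≼ term A
    Q≼ m = ℚ.≤-trans (absorb-scale Q-bounded (ℚ.≤-reflexive (cong ∣_∣ Q0≡1)) m)
      (term-mono 0≤A₀ (ℚ.≤-trans (p≤q+p (ℚ.0≤∣p∣ a)) (p≤p+q 0≤rates)) m)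

    U≼ : U ≼ λ m → B * term A m
    U≼ m = ℚ.≤-trans (dominated U-bounded m) (*-mono-nonNeg (0≤scale U-bounded) (p≤p+q (0≤scale V-bounded))
      (0≤term (0≤rate U-bounded) m)
      (term-mono (0≤rate U-bounded) (ℚ.≤-trans (p≤p+q (0≤rate V-bounded)) (p≤q+p 0≤∣a∣+A₀)) m))

    V≼ : V ≼ λ m → B * term A m
    V≼ m = ℚ.≤-trans (dominated V-bounded m) (*-mono-nonNeg (0≤scale V-bounded) (p≤q+p (0≤scale U-bounded))
      (0≤term (0≤rate V-bounded) m)
      (term-mono (0≤rate V-bounded) (ℚ.≤-trans (p≤q+p (0≤rate U-bounded)) (p≤q+p 0≤∣a∣+A₀)) m))

    -- Q = exp (a z) + σ z² + O(z³), so Q ^ r is approximated by exp (r a z) (1 + r σ z²).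
    X Y M err bound : ℕ → Series
    X r = term (ι r * a)
    Y r m = X r m + (ι r * σ) * shift 2 (X r) m
    M r = term (ι r * A)
    err r m = pow Q r m - Y r m
    bound r m = B * (ι r * shift 3 (M r) m + ι r * ι r * shift 4 (M r) m)

    next : ∀ r x → x + ι r * x ≡ ι (suc r) * x
    next r x = trans (identity (ι r) x) (cong (_* x) (sym (ι-suc r)))
      where
      identity : ∀ r x → x + r * x ≡ (1ℚ + r) * x
      identity = solve-∀ ℚ-ring

    conv-X : ∀ r → conv (term a) (X r) ≗ X (suc r)
    conv-X r m = trans (conv-term a (ι r * a) m) (cong (λ x → term x m) (next r a))

    conv-M : ∀ r → conv (term A) (M r) ≗ M (suc r)
    conv-M r m = trans (conv-term A (ι r * A) m) (cong (λ x → term x m) (next r A))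

    0≤ιA : ∀ r → 0ℚ ≤ ι r * A
    0≤ιA r = 0≤* (0≤ι r) 0≤A

    X≼M : ∀ r → X r ≼ M r
    X≼M r = term≼ (∣*∣≤ (∣0≤∣≤ (0≤ι r) ℚ.≤-refl) ∣a∣≤A)

    conv-f-Y : ∀ f r → conv f (Y r) ≗ λ m → conv f (X r) m + (ι r * σ) * shift 2 (conv f (X r)) m
    conv-f-Y f r m = trans (conv-+ʳ f (X r) (λ i → (ι r * σ) * shift 2 (X r) i) m)
      (cong (conv f (X r) m +_) (trans (conv-·ʳ (ι r * σ) f (shift 2 (X r)) m)
        (cong ((ι r * σ) *_) (conv-shiftʳ 2 f (X r) m))))

    X-suc : ∀ r → X (suc r) ≗ λ j → X r j + z· (conv (term a ∘ suc) (X r)) j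
    X-suc r zero    = refl
    X-suc r (suc j) = trans (sym (conv-X r (suc j)))
      (cong (_+ conv (term a ∘ suc) (X r) j) (ℚ.*-identityˡ (X r (suc j))))

    conv-S-X : ∀ r → conv S (X r) ≗ λ j → σ * X r j + z· (conv (S ∘ suc) (X r)) j
    conv-S-X r zero    = sym (ℚ.+-identityʳ _)
    conv-S-X r (suc j) = refl

    conv-S-Y : ∀ r → conv S (Y r) ≗ λ j →
      σ * X (suc r) j + (z· (conv U (X r)) j + ι r * shift 2 (conv V (X r)) j)
    conv-S-Y r j = begin-equality
      conv S (Y r) j
        ≡⟨ conv-f-Y S r j ⟩
      conv S (X r) j + (ι r * σ) * s
        ≡⟨ cong (_+ (ι r * σ) * s) (conv-S-X r j) ⟩
      σ * X r j + z· T j + (ι r * σ) * s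
        ≡⟨ identity σ (X r j) (z· T j) (ι r) s (z· G j) ⟩
      σ * (X r j + z· G j) + (z· T j + (- σ) * z· G j + ι r * (σ * s))
        ≡⟨ cong₂ (λ u v → σ * u + v) (sym (X-suc r j)) (cong₂ (λ u v → u + ι r * v) (sym zU) (sym z²V)) ⟩
      σ * X (suc r) j + (z· (conv U (X r)) j + ι r * shift 2 (conv V (X r)) j) ∎
      where
      T = conv (S ∘ suc) (X r)
      G = conv (term a ∘ suc) (X r)
      s = shift 2 (conv S (X r)) j
      identity : ∀ σ x t r s g → σ * x + t + (r * σ) * s ≡ σ * (x + g) + (t + (- σ) * g + r * (σ * s))
      identity = solve-∀ ℚ-ring
      zU : z· (conv U (X r)) j ≡ z· T j + (- σ) * z· G j
      zU = trans (z·-cong (λ i → trans (conv-+ˡ (S ∘ suc) _ (X r) i)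
                                       (cong (T i +_) (conv-·ˡ (- σ) (term a ∘ suc) (X r) i))) j)
           (trans (shift-+ 1 T (λ i → (- σ) * G i) j) (cong (z· T j +_) (shift-· 1 (- σ) G j)))
      z²V : shift 2 (conv V (X r)) j ≡ σ * s
      z²V = trans (shift-cong 2 (conv-·ˡ σ S (X r)) j) (shift-· 2 σ (conv S (X r)) j)

    -- Multiply Q^r = err + Y_r by Q = exp(a z) + z² S. The second-order terms r σ z² X_(r+1), from
    -- the first summand, and σ z² X_(r+1), from the second, make up that of Y_(r+1); only multiples
    -- of z³ are left over.
    err-suc : ∀ r m → err (suc r) m ≡
      conv Q (err r) m + (shift 3 (conv U (X r)) m + ι r * shift 4 (conv V (X r)) m)
    err-suc r m = begin-equality
      conv Q (pow Q r) m - Y (suc r) m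
        ≡⟨ cong (_- Y (suc r) m) (trans (conv-cong {f = Q} (λ _ → refl) (λ i → split (pow Q r i) (Y r i)) m)
                                        (conv-+ʳ Q (err r) (Y r) m)) ⟩
      conv Q (err r) m + conv Q (Y r) m - Y (suc r) m
        ≡⟨ cong (λ t → conv Q (err r) m + t - Y (suc r) m) QY ⟩
      conv Q (err r) m + (X (suc r) m + (ι r * σ) * x₂ + (σ * x₂ + (u + ι r * v)))
        - (X (suc r) m + (ι (suc r) * σ) * x₂)
        ≡⟨ cong (λ t → conv Q (err r) m + (X (suc r) m + (ι r * σ) * x₂ + (σ * x₂ + (u + ι r * v)))
                         - (X (suc r) m + (t * σ) * x₂)) (ι-suc r) ⟩
      conv Q (err r) m + (X (suc r) m + (ι r * σ) * x₂ + (σ * x₂ + (u + ι r * v)))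
        - (X (suc r) m + ((1ℚ + ι r) * σ) * x₂)
        ≡⟨ identity (conv Q (err r) m) (X (suc r) m) (ι r) σ x₂ u v ⟩
      conv Q (err r) m + (u + ι r * v) ∎
      where
      x₂ = shift 2 (X (suc r)) m
      u = shift 3 (conv U (X r)) m
      v = shift 4 (conv V (X r)) m
      split : ∀ p y → p ≡ (p - y) + y
      split = solve-∀ ℚ-ring
      identity : ∀ e x r σ y u v →
        e + (x + (r * σ) * y + (σ * y + (u + r * v))) - (x + ((1ℚ + r) * σ) * y) ≡ e + (u + r * v)
      identity = solve-∀ ℚ-ring
      QY : conv Q (Y r) m ≡ X (suc r) m + (ι r * σ) * x₂ + (σ * x₂ + (u + ι r * v))
      QY = begin-equality
        conv Q (Y r) m
          ≡⟨ trans (conv-cong {g = Y r} Q≗ (λ _ → refl) m) (conv-+ˡ (term a) (shift 2 S) (Y r) m) ⟩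
        conv (term a) (Y r) m + conv (shift 2 S) (Y r) m
          ≡⟨ cong₂ _+_
               (trans (conv-f-Y (term a) r m)
                      (cong₂ (λ s t → s + (ι r * σ) * t) (conv-X r m) (shift-cong 2 (conv-X r) m)))
               (trans (conv-shiftˡ 2 S (Y r) m) (trans (shift-cong 2 (conv-S-Y r) m)
               (trans (shift-+ 2 (λ j → σ * X (suc r) j) _ m)
               (cong₂ _+_ (shift-· 2 σ (X (suc r)) m)
               (trans (shift-+ 2 (z· (conv U (X r))) _ m)
                      (cong (u +_) (shift-· 2 (ι r) (shift 2 (conv V (X r))) m))))))) ⟩
        X (suc r) m + (ι r * σ) * x₂ + (σ * x₂ + (u + ι r * v)) ∎

    conv-f-bound : ∀ r → conv (term A) (bound r) ≗ λ m →
      B * (ι r * shift 3 (M (suc r)) m + ι r * ι r * shift 4 (M (suc r)) m)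
    conv-f-bound r m = trans (conv-·ʳ B (term A) _ m) (cong (B *_)
      (trans (conv-+ʳ (term A) (λ i → ι r * shift 3 (M r) i) _ m)
      (cong₂ _+_ (part (ι r) 3) (part (ι r * ι r) 4))))
      where
      part : ∀ c n → conv (term A) (λ i → c * shift n (M r) i) m ≡ c * shift n (M (suc r)) m
      part c n = trans (conv-·ʳ c (term A) (shift n (M r)) m)
        (cong (c *_) (trans (conv-shiftʳ n (term A) (M r) m) (shift-cong n (conv-M r) m)))

    -- By `err-suc`: multiplication by `Q` turns the majorant exp(r A z) into exp((r + 1) A z), and
    -- the new defect adds B z³ + r B z⁴ times that exponential.
    err≼ : ∀ r → err r ≼ bound r
    err≼ zero m = ℚ.≤-reflexive (trans (cong ∣_∣ (err₀ m)) (sym (identity B (shift 3 (M 0) m) (shift 4 (M 0) m))))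
      where
      identity : ∀ b x y → b * (0ℚ * x + 0ℚ * 0ℚ * y) ≡ 0ℚ
      identity = solve-∀ ℚ-ring
      err₀ : ∀ m → err 0 m ≡ 0ℚ
      err₀ zero    = trans (cong (λ t → 1ℚ - (1ℚ + t * 0ℚ)) (ℚ.*-zeroˡ σ)) refl
      err₀ (suc m) = trans (cong₂ (λ s t → 0ℚ - (s + t)) (vanish m) (trans (cong (_* shift 2 (X 0) (suc m)) (ℚ.*-zeroˡ σ)) (ℚ.*-zeroˡ (shift 2 (X 0) (suc m))))) refl
        where
        vanish : ∀ m → X 0 (suc m) ≡ 0ℚ
        vanish m = trans (cong (_* recip (suc m !) {{suc m !≢0}}) (trans (cong (_* (0ℚ * a) ^ m) (ℚ.*-zeroˡ a)) (ℚ.*-zeroˡ ((0ℚ * a) ^ m)))) (ℚ.*-zeroˡ (recip (suc m !) {{suc m !≢0}}))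
    err≼ (suc r) m = begin
      ∣ err (suc r) m ∣
        ≡⟨ cong ∣_∣ (err-suc r m) ⟩
      ∣ conv Q (err r) m + (shift 3 (conv U (X r)) m + ι r * shift 4 (conv V (X r)) m) ∣
        ≤⟨ ∣+∣≤ (ℚ.≤-trans (conv-mono Q≼ (err≼ r) m) (ℚ.≤-reflexive (conv-f-bound r m)))
                (∣+∣≤ (part U U≼ 3) (∣*∣≤ (∣0≤∣≤ (0≤ι r) ℚ.≤-refl) (part V V≼ 4))) ⟩
      B * (ι r * m₃ + ι r * ι r * m₄) + (B * m₃ + ι r * (B * m₄))
        -- The slack B (1 + r) z⁴ completes r² + r to (1 + r)².
        ≤⟨ p≤p+q (0≤* (0≤* 0≤B (0≤+ 0≤1 (0≤ι r))) (shift-nonNeg 4 (0≤term (0≤ιA (suc r))) m)) ⟩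
      B * (ι r * m₃ + ι r * ι r * m₄) + (B * m₃ + ι r * (B * m₄)) + B * (1ℚ + ι r) * m₄
        ≡⟨ identity B (ι r) m₃ m₄ ⟩
      B * ((1ℚ + ι r) * m₃ + (1ℚ + ι r) * (1ℚ + ι r) * m₄)
        ≡⟨ cong (λ t → B * (t * m₃ + t * t * m₄)) (ι-suc r) ⟨
      bound (suc r) m ∎
      where
      m₃ = shift 3 (M (suc r)) m
      m₄ = shift 4 (M (suc r)) m
      identity : ∀ b r x y → b * (r * x + r * r * y) + (b * x + r * (b * y)) + b * (1ℚ + r) * y
                           ≡ b * ((1ℚ + r) * x + (1ℚ + r) * (1ℚ + r) * y)
      identity = solve-∀ ℚ-ring
      part : ∀ W → (W ≼ λ i → B * term A i) → ∀ n → ∣ shift n (conv W (X r)) m ∣ ≤ B * shift n (M (suc r)) m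
      part W W≼ n = ℚ.≤-trans (shift-mono n (conv-mono W≼ (X≼M r)) m) (ℚ.≤-reflexive
        (trans (shift-cong n (λ i → trans (conv-·ˡ B (term A) (M r) i) (cong (B *_) (conv-M r i))) m)
               (shift-· n B (M (suc r)) m)))

    -- Under z ↦ z/r both r z³ and r² z⁴ acquire the factor 1/r², and exp(r A z) becomes exp(A z),
    -- which is free of r.
    scaled-err≼ : ∀ r .{{_ : NonZero r}} m →
      ∣ recip r ^ m * err r m ∣ ≤ recip r * recip r * (B * (shift 3 (term A) m + shift 4 (term A) m))
    scaled-err≼ r m = begin
      ∣ ρ ^ m * err r m ∣
        ≤⟨ ∣*∣≤ (∣0≤∣≤ (0≤^ (0≤recip r) m) ℚ.≤-refl) (err≼ r m) ⟩
      ρ ^ m * (B * (ι r * shift 3 (M r) m + ι r * ι r * shift 4 (M r) m))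
        ≡⟨ identity₁ (ρ ^ m) B (ι r) (shift 3 (M r) m) (shift 4 (M r) m) ⟩
      B * (ι r * (ρ ^ m * shift 3 (M r) m) + ι r * ι r * (ρ ^ m * shift 4 (M r) m))
        ≡⟨ cong₂ (λ s t → B * (ι r * s + ι r * ι r * t)) (rescale 3) (rescale 4) ⟩
      B * (ι r * (ρ ^ 3 * s₃) + ι r * ι r * (ρ ^ 4 * s₄))
        ≡⟨ identity₂ B (ι r) ρ s₃ s₄ ⟩
      B * ((ι r * ρ) * (ρ * ρ) * s₃ + (ι r * ρ) * (ι r * ρ) * (ρ * ρ) * s₄)
        ≡⟨ cong (λ t → B * (t * (ρ * ρ) * s₃ + t * t * (ρ * ρ) * s₄)) (ι*recip r) ⟩
      B * (1ℚ * (ρ * ρ) * s₃ + 1ℚ * 1ℚ * (ρ * ρ) * s₄)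
        ≡⟨ identity₃ B ρ s₃ s₄ ⟩
      ρ * ρ * (B * (s₃ + s₄)) ∎
      where
      ρ = recip r
      s₃ = shift 3 (term A) m
      s₄ = shift 4 (term A) m
      identity₁ : ∀ p b r x y → p * (b * (r * x + r * r * y)) ≡ b * (r * (p * x) + r * r * (p * y))
      identity₁ = solve-∀ ℚ-ring
      identity₂ : ∀ b r p x y → b * (r * ((p * (p * (p * 1ℚ))) * x) + r * r * ((p * (p * (p * (p * 1ℚ)))) * y))
        ≡ b * ((r * p) * (p * p) * x + (r * p) * (r * p) * (p * p) * y)
      identity₂ = solve-∀ ℚ-ring
      identity₃ : ∀ b p x y → b * (1ℚ * (p * p) * x + 1ℚ * 1ℚ * (p * p) * y) ≡ p * p * (b * (x + y))
      identity₃ = solve-∀ ℚ-ring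
      rescale : ∀ n → ρ ^ m * shift n (M r) m ≡ ρ ^ n * shift n (term A) m
      rescale n = trans (shift-scale ρ (ι r * A) n m) (cong (λ x → ρ ^ n * shift n (term x) m) (recip*ι* r A))

    scaled-Y : ∀ r .{{_ : NonZero r}} m →
      recip r ^ m * Y r m ≡ term a m + recip r * σ * shift 2 (term a) m
    scaled-Y r m = begin-equality
      ρ ^ m * (X r m + (ι r * σ) * shift 2 (X r) m)
        ≡⟨ identity₁ (ρ ^ m) (X r m) (ι r * σ) (shift 2 (X r) m) ⟩
      ρ ^ m * X r m + (ι r * σ) * (ρ ^ m * shift 2 (X r) m)
        ≡⟨ cong₂ (λ s t → s + (ι r * σ) * t)
             (trans (term-scale ρ (ι r * a) m) (cong (λ x → term x m) (recip*ι* r a)))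
             (trans (shift-scale ρ (ι r * a) 2 m) (cong (λ x → ρ ^ 2 * shift 2 (term x) m) (recip*ι* r a))) ⟩
      term a m + (ι r * σ) * (ρ ^ 2 * s)
        ≡⟨ cong (term a m +_) (identity₂ (ι r) σ ρ s) ⟩
      term a m + (ι r * ρ) * (ρ * σ * s)
        ≡⟨ cong (term a m +_) (trans (cong (_* (ρ * σ * s)) (ι*recip r)) (ℚ.*-identityˡ _)) ⟩
      term a m + ρ * σ * s ∎
      where
      ρ = recip r
      s = shift 2 (term a) m
      identity₁ : ∀ p x c y → p * (x + c * y) ≡ p * x + c * (p * y)
      identity₁ = solve-∀ ℚ-ring
      identity₂ : ∀ r σ p s → (r * σ) * ((p * (p * 1ℚ)) * s) ≡ (r * p) * (p * σ * s)
      identity₂ = solve-∀ ℚ-ring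

  -- Finite sums

  psum : Series → ℕ → ℚ
  psum f zero    = 0ℚ
  psum f (suc n) = psum f n + f n

  psum-cong : ∀ {f g} → f ≗ g → psum f ≗ psum g
  psum-cong p zero    = refl
  psum-cong p (suc n) = cong₂ _+_ (psum-cong p n) (p n)

  psum-+ : ∀ f g → psum (λ m → f m + g m) ≗ λ n → psum f n + psum g n
  psum-+ f g zero    = refl
  psum-+ f g (suc n) = trans (cong (_+ (f n + g n)) (psum-+ f g n)) (identity (psum f n) (psum g n) (f n) (g n))
    where
    identity : ∀ a b x y → a + b + (x + y) ≡ (a + x) + (b + y)
    identity = solve-∀ ℚ-ring

  psum-· : ∀ c f → psum (λ m → c * f m) ≗ λ n → c * psum f n
  psum-· c f zero    = sym (ℚ.*-zeroʳ c)
  psum-· c f (suc n) = trans (cong (_+ c * f n) (psum-· c f n)) (sym (ℚ.*-distribˡ-+ c (psum f n) (f n)))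

  psum-close : ∀ {f g F} → (∀ m → ∣ f m - g m ∣ ≤ F m) → ∀ n → ∣ psum f n - psum g n ∣ ≤ psum F n
  psum-close             p zero    = ℚ.≤-refl
  psum-close {f} {g} {F} p (suc n) = ℚ.≤-trans
    (ℚ.≤-reflexive (cong ∣_∣ (identity (psum f n) (f n) (psum g n) (g n))))
    (∣+∣≤ (psum-close p n) (p n))
    where
    identity : ∀ a x b y → a + x - (b + y) ≡ (a - b) + (x - y)
    identity = solve-∀ ℚ-ring

  psum-head : ∀ f n → psum f (suc n) ≡ f 0 + psum (f ∘ suc) n
  psum-head f zero    = ℚ.+-comm 0ℚ (f 0)
  psum-head f (suc n) = trans (cong (_+ f (suc n)) (psum-head f n)) (ℚ.+-assoc (f 0) (psum (f ∘ suc) n) (f (suc n)))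

  psum-z· : ∀ f n → psum (z· f) (suc n) ≡ psum f n
  psum-z· f n = trans (psum-head (z· f) n) (ℚ.+-identityˡ _)

  psum-nonNeg : ∀ {f} → (∀ m → 0ℚ ≤ f m) → ∀ n → 0ℚ ≤ psum f n
  psum-nonNeg p zero    = ℚ.≤-refl
  psum-nonNeg p (suc n) = 0≤+ (psum-nonNeg p n) (p n)

  psum-extend : ∀ {d f} → VanishesBeyond d f → ∀ {n} → d ℕ.< n → psum f n ≡ psum f (suc d)
  psum-extend {d} {f} f-van {suc n} (ℕ.s≤s d≤n) with d ℕ.≟ n
  ... | yes refl = refl
  ... | no  d≢n  = trans (cong₂ _+_ (psum-extend f-van d<n) (f-van n d<n)) (ℚ.+-identityʳ _)
    where d<n = ℕ.≤∧≢⇒< d≤n d≢n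

  conv≡psum : ∀ f g n → conv f g n ≡ psum (λ m → f m * g (n ℕ.∸ m)) (suc n)
  conv≡psum f g zero    = sym (ℚ.+-identityˡ _)
  conv≡psum f g (suc n) = trans (cong (f 0 * g (suc n) +_) (conv≡psum (f ∘ suc) g n))
    (sym (psum-head (λ m → f m * g (suc n ℕ.∸ m)) (suc n)))

  scaled-conv : ∀ f g n c → psum (λ m → f m * (g (n ℕ.∸ m) * c)) (suc n) ≡ conv f g n * c
  scaled-conv f g n c = begin-equality
    psum (λ m → f m * (g (n ℕ.∸ m) * c)) (suc n)      ≡⟨ psum-cong (λ m → identity (f m) (g (n ℕ.∸ m)) c) (suc n) ⟩
    psum (λ m → c * (f m * g (n ℕ.∸ m))) (suc n)      ≡⟨ psum-· c (λ m → f m * g (n ℕ.∸ m)) (suc n) ⟩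
    c * psum (λ m → f m * g (n ℕ.∸ m)) (suc n)        ≡⟨ cong (c *_) (conv≡psum f g n) ⟨
    c * conv f g n                                    ≡⟨ ℚ.*-comm c (conv f g n) ⟩
    conv f g n * c                                    ∎
    where
    identity : ∀ b f w → b * (f * w) ≡ w * (b * f)
    identity = solve-∀ ℚ-ring

  partialSum≡psum : ∀ q → partialSum q ≗ psum (term q)
  partialSum≡psum q zero    = refl
  partialSum≡psum q (suc n) = cong (_+ term q n) (partialSum≡psum q n)

  fact : Series
  fact n = ι (n !)

  -- Reciprocals of falling factorials

  tri : ℕ → ℚ
  tri zero    = 0ℚ
  tri (suc m) = tri m + ι m

  tri-double : ∀ m → tri m + tri m ≡ ι m * (ι m - 1ℚ)
  tri-double zero    = refl
  tri-double (suc m) = trans (identity₁ (tri m) (ι m)) (trans (cong (_+ (ι m + ι m)) (tri-double m))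
    (trans (identity₂ (ι m)) (cong (λ i → i * (i - 1ℚ)) (sym (ι-suc m)))))
    where
    identity₁ : ∀ t i → t + i + (t + i) ≡ (t + t) + (i + i)
    identity₁ = solve-∀ ℚ-ring
    identity₂ : ∀ i → i * (i - 1ℚ) + (i + i) ≡ (1ℚ + i) * (1ℚ + i - 1ℚ)
    identity₂ = solve-∀ ℚ-ring

  0≤tri : ∀ m → 0ℚ ≤ tri m
  0≤tri zero    = ℚ.≤-refl
  0≤tri (suc m) = 0≤+ (0≤tri m) (0≤ι m)

  tri≤ : ∀ m → tri m ≤ ι m * ι m
  tri≤ zero    = ℚ.≤-refl
  tri≤ (suc m) = begin
    tri m + ι m                            ≤⟨ ℚ.+-monoˡ-≤ (ι m) (tri≤ m) ⟩
    ι m * ι m + ι m                        ≤⟨ p≤p+q (0≤+ 0≤1 (0≤ι m)) ⟩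
    ι m * ι m + ι m + (1ℚ + ι m)           ≡⟨ identity (ι m) ⟩
    (1ℚ + ι m) * (1ℚ + ι m)                ≡⟨ cong (λ i → i * i) (ι-suc m) ⟨
    ι (suc m) * ι (suc m)                  ∎
    where
    identity : ∀ i → i * i + i + (1ℚ + i) ≡ (1ℚ + i) * (1ℚ + i)
    identity = solve-∀ ℚ-ring

  -- r ^ m (N − m)! / N! with N = (1 + d) r is approximated by
  -- k ^ (− m) (1 + m (m − 1) / (2 N)), where k = 1 + d.
  module FallingFactorial (d r : ℕ) .{{_ : NonZero r}} where

    N : ℕ
    N = suc d ℕ.* r

    N!⁻¹ κ ρ τ : ℚ
    N!⁻¹ = recip (N !) {{N !≢0}}
    κ = recip (suc d)
    ρ = recip r
    τ = κ * ρ

    0≤κ : 0ℚ ≤ κ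
    0≤κ = 0≤recip (suc d)

    κ≤1 : κ ≤ 1ℚ
    κ≤1 = recip≤1 (suc d)

    0≤ρ : 0ℚ ≤ ρ
    0≤ρ = 0≤recip r

    0≤τ : 0ℚ ≤ τ
    0≤τ = 0≤* 0≤κ 0≤ρ

    τ≤ρ : τ ≤ ρ
    τ≤ρ = ℚ.≤-trans (*-monoʳ 0≤ρ κ≤1) (ℚ.≤-reflexive (ℚ.*-identityˡ ρ))

    v y : ℕ → ℚ
    v m = ι r ^ m * (fact (N ℕ.∸ m) * N!⁻¹)
    y m = κ ^ m * (1ℚ + tri m * τ)

    ι-N : ι r ≡ κ * ι N
    ι-N = sym (trans (cong (κ *_) (ι-* (suc d) r)) (recip*ι* (suc d) (ι r)))

    τ*ι-N : τ * ι N ≡ 1ℚ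
    τ*ι-N = trans (identity κ ρ (ι N)) (trans (cong (ρ *_) (sym ι-N)) (trans (ℚ.*-comm ρ (ι r)) (ι*recip r)))
      where
      identity : ∀ k p n → k * p * n ≡ p * (k * n)
      identity = solve-∀ ℚ-ring

    -- Passing from m to m + 1 multiplies `v` by r/(N - m). Below d r one has N - m ≥ r, so this
    -- factor is at most 1 and earlier errors are not amplified.
    module Step (m : ℕ) (m<dr : m ℕ.< d ℕ.* r) where

      p : ℕ
      p = N ℕ.∸ suc m

      m<N : m ℕ.< N
      m<N = ℕ.≤-trans m<dr (ℕ.m≤n+m (d ℕ.* r) r)

      N∸m : N ℕ.∸ m ≡ suc p
      N∸m = ℕ.+-∸-assoc 1 m<N

      suc-p+m : suc p ℕ.+ m ≡ N
      suc-p+m = trans (cong (ℕ._+ m) (sym N∸m)) (ℕ.m∸n+n≡m (ℕ.<⇒≤ m<N))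

      ν : ℚ
      ν = recip (suc p)

      v-suc : v (suc m) ≡ ι r * ν * v m
      v-suc = sym (begin-equality
        ι r * ν * (ι r ^ m * (fact (N ℕ.∸ m) * N!⁻¹))
          ≡⟨ cong (λ t → ι r * ν * (ι r ^ m * (t * N!⁻¹))) (trans (cong fact N∸m) (ι-* (suc p) (p !))) ⟩
        ι r * ν * (ι r ^ m * (ι (suc p) * fact p * N!⁻¹))
          ≡⟨ identity (ι r) ν (ι r ^ m) (ι (suc p)) (fact p) N!⁻¹ ⟩
        (ι (suc p) * ν) * (ι r * ι r ^ m * (fact p * N!⁻¹))
          ≡⟨ trans (cong (_* v (suc m)) (ι*recip (suc p))) (ℚ.*-identityˡ _) ⟩
        v (suc m) ∎)
        where
        identity : ∀ r n e p f w → r * n * (e * (p * f * w)) ≡ (p * n) * (r * e * (f * w))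
        identity = solve-∀ ℚ-ring

      r≤suc-p : r ℕ.≤ suc p
      r≤suc-p = subst (r ℕ.≤_) N∸m (ℕ.≤-trans (ℕ.≤-reflexive (sym (ℕ.m+n∸n≡m r (d ℕ.* r))))
                                              (ℕ.∸-monoʳ-≤ N (ℕ.<⇒≤ m<dr)))

      0≤ν : 0ℚ ≤ ν
      0≤ν = 0≤recip (suc p)

      0≤λ : 0ℚ ≤ ι r * ν
      0≤λ = 0≤* (0≤ι r) 0≤ν

      λ≤1 : ι r * ν ≤ 1ℚ
      λ≤1 = ℚ.≤-trans (*-monoʳ 0≤ν (ι-mono r≤suc-p)) (ℚ.≤-reflexive (ι*recip (suc p)))

      ν≤ρ : ν ≤ ρ
      ν≤ρ = begin
        ν                ≡⟨ recip*ι* r ν ⟨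
        ρ * (ι r * ν)    ≤⟨ *-monoˡ 0≤ρ λ≤1 ⟩
        ρ * 1ℚ           ≡⟨ ℚ.*-identityʳ ρ ⟩
        ρ                ∎

      ν*gap : ν * (ι N - ι m) ≡ 1ℚ
      ν*gap = trans (cong (ν *_) (trans (cong (λ t → ι t - ι m) (sym suc-p+m))
                (trans (cong (_- ι m) (ι-+ (suc p) m)) (identity (ι (suc p)) (ι m)))))
              (trans (ℚ.*-comm ν (ι (suc p))) (ι*recip (suc p)))
        where
        identity : ∀ a b → (a + b) - b ≡ a
        identity = solve-∀ ℚ-ring

      -- The local error of the approximation. With r = κ N and a factor ν (N - m) = 1 put on
      -- `y (suc m)`, the first-order terms cancel because τ N = 1, and both ν and τ are at most
      -- 1/r.
      y-suc : ι r * ν * y m - y (suc m) ≡ κ ^ suc m * (ν * τ) * (ι m * (tri m + ι m))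
      y-suc = begin-equality
        ι r * ν * (P * (1ℚ + T * τ)) - κ * P * (1ℚ + (T + i) * τ)
          ≡⟨ cong₂ (λ s t → s * ν * (P * (1ℚ + T * τ)) - κ * P * t) ι-N
               (trans (sym (ℚ.*-identityˡ _)) (cong (_* (1ℚ + (T + i) * τ)) (sym ν*gap))) ⟩
        κ * n * ν * (P * (1ℚ + T * τ)) - κ * P * (ν * (n - i) * (1ℚ + (T + i) * τ))
          ≡⟨ identity₁ κ n ν P T τ i ⟩
        κ * P * ν * (i - i * (τ * n) + i * (T + i) * τ)
          ≡⟨ cong (λ t → κ * P * ν * (i - i * t + i * (T + i) * τ)) τ*ι-N ⟩
        κ * P * ν * (i - i * 1ℚ + i * (T + i) * τ)
          ≡⟨ identity₂ κ P ν i T τ ⟩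
        κ * P * (ν * τ) * (i * (T + i)) ∎
        where
        n = ι N
        P = κ ^ m
        T = tri m
        i = ι m
        identity₁ : ∀ k n v p t τ i → k * n * v * (p * (1ℚ + t * τ)) - k * p * (v * (n - i) * (1ℚ + (t + i) * τ))
                  ≡ k * p * v * (i - i * (τ * n) + i * (t + i) * τ)
        identity₁ = solve-∀ ℚ-ring
        identity₂ : ∀ k p v i t τ → k * p * v * (i - i * 1ℚ + i * (t + i) * τ) ≡ k * p * (v * τ) * (i * (t + i))
        identity₂ = solve-∀ ℚ-ring

    -- A crude bound for the sum of the local errors i (tri i + i). Any fixed power of m is
    -- harmless, since `ι·-expBounded` absorbs it.
    fourth : ℕ → ℚ
    fourth m = ι m * (ι m * (ι m * ι m))

    fourth-suc : ∀ m → fourth m + ι m * (tri m + ι m) ≤ fourth (suc m)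
    fourth-suc m = begin
      fourth m + i * (tri m + i)            ≤⟨ ℚ.+-monoʳ-≤ (fourth m) (*-monoˡ (0≤ι m) (ℚ.+-monoˡ-≤ i (tri≤ m))) ⟩
      -- The amount added is (i + 1)⁴ - i⁴ - i³ - i² = 1 + 4i + 5i² + 3i³.
      fourth m + i * (i * i + i)            ≤⟨ p≤p+q (0≤+ (0≤+ 0≤1 (0≤* (0≤+ (0≤+ 0≤1 0≤1) (0≤+ 0≤1 0≤1)) (0≤ι m)))
                                                          (0≤+ (0≤* (0≤+ (0≤+ 0≤1 0≤1) (0≤+ 0≤1 (0≤+ 0≤1 0≤1))) (0≤* (0≤ι m) (0≤ι m)))
                                                               (0≤* (0≤+ (0≤+ 0≤1 0≤1) 0≤1) (0≤* (0≤ι m) (0≤* (0≤ι m) (0≤ι m)))))) ⟩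
      fourth m + i * (i * i + i) + (1ℚ + 4ℚ * i + (5ℚ * (i * i) + 3ℚ * (i * (i * i))))
                                            ≡⟨ identity i ⟩
      (1ℚ + i) * ((1ℚ + i) * ((1ℚ + i) * (1ℚ + i)))
                                            ≡⟨ cong (λ t → t * (t * (t * t))) (ι-suc m) ⟨
      fourth (suc m)                        ∎
      where
      i = ι m
      3ℚ = 1ℚ + 1ℚ + 1ℚ
      4ℚ = 1ℚ + 1ℚ + (1ℚ + 1ℚ)
      5ℚ = 1ℚ + 1ℚ + (1ℚ + (1ℚ + 1ℚ))
      identity : ∀ i → i * (i * (i * i)) + i * (i * i + i) +
          (1ℚ + (1ℚ + 1ℚ + (1ℚ + 1ℚ)) * i + ((1ℚ + 1ℚ + (1ℚ + (1ℚ + 1ℚ))) * (i * i) + (1ℚ + 1ℚ + 1ℚ) * (i * (i * i))))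
        ≡ (1ℚ + i) * ((1ℚ + i) * ((1ℚ + i) * (1ℚ + i)))
      identity = solve-∀ ℚ-ring

    v₀≡1 : v 0 ≡ 1ℚ
    v₀≡1 = trans (ℚ.*-identityˡ _) (ι*recip (N !) {{N !≢0}})

    0≤v : ∀ m → 0ℚ ≤ v m
    0≤v m = 0≤* (0≤^ (0≤ι r) m) (0≤* (0≤ι ((N ℕ.∸ m) !)) (0≤recip (N !) {{N !≢0}}))

    v≤1 : ∀ m → m ℕ.≤ d ℕ.* r → v m ≤ 1ℚ
    v≤1 zero    _    = ℚ.≤-reflexive v₀≡1
    v≤1 (suc m) m<dr = ℚ.≤-trans (ℚ.≤-reflexive v-suc)
      (*-mono-nonNeg 0≤λ λ≤1 (0≤v m) (v≤1 m (ℕ.<⇒≤ m<dr)))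
      where open Step m m<dr

    -- The error at m + 1 is the error at m times a factor in [0, 1], plus the local error of
    -- `y-suc`.
    v-y≤ : ∀ m → m ℕ.≤ d ℕ.* r → ∣ v m - y m ∣ ≤ ρ * ρ * fourth m
    v-y≤ zero    _    = ℚ.≤-reflexive (trans (cong (λ t → ∣ t - 1ℚ * (1ℚ + 0ℚ * τ) ∣) v₀≡1)
      (trans (cong ∣_∣ (identity τ)) (sym (ℚ.*-zeroʳ (ρ * ρ)))))
      where
      identity : ∀ t → 1ℚ - 1ℚ * (1ℚ + 0ℚ * t) ≡ 0ℚ
      identity = solve-∀ ℚ-ring
    v-y≤ (suc m) m<dr = begin
      ∣ v (suc m) - y (suc m) ∣
        ≡⟨ cong ∣_∣ (trans (cong (_- y (suc m)) v-suc) (identity₁ (ι r * ν) (v m) (y m) (y (suc m)))) ⟩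
      ∣ ι r * ν * (v m - y m) + (ι r * ν * y m - y (suc m)) ∣
        ≤⟨ ∣+∣≤ (∣*∣≤ (∣0≤∣≤ 0≤λ λ≤1) (v-y≤ m (ℕ.<⇒≤ m<dr)))
                (ℚ.≤-trans (ℚ.≤-reflexive (cong ∣_∣ y-suc))
                  (∣0≤∣≤ (0≤* (0≤* (0≤^ 0≤κ (suc m)) (0≤* 0≤ν 0≤τ)) 0≤step)
                    (*-monoʳ 0≤step (*-mono-nonNeg (0≤^ 0≤κ (suc m)) (^≤1 0≤κ κ≤1 (suc m)) (0≤* 0≤ν 0≤τ)
                                       (*-mono-nonNeg 0≤ν ν≤ρ 0≤τ τ≤ρ))))) ⟩
      1ℚ * (ρ * ρ * fourth m) + 1ℚ * (ρ * ρ) * (ι m * (tri m + ι m))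
        ≡⟨ identity₂ (ρ * ρ) (fourth m) (ι m * (tri m + ι m)) ⟩
      ρ * ρ * (fourth m + ι m * (tri m + ι m))
        ≤⟨ *-monoˡ (0≤* 0≤ρ 0≤ρ) (fourth-suc m) ⟩
      ρ * ρ * fourth (suc m) ∎
      where
      open Step m m<dr
      0≤step : 0ℚ ≤ ι m * (tri m + ι m)
      0≤step = 0≤* (0≤ι m) (0≤+ (0≤tri m) (0≤ι m))
      identity₁ : ∀ l v y w → l * v - w ≡ l * (v - y) + (l * y - w)
      identity₁ = solve-∀ ℚ-ring
      identity₂ : ∀ c f s → 1ℚ * (c * f) + 1ℚ * c * s ≡ c * (f + s)
      identity₂ = solve-∀ ℚ-ring

  -- The factor m (m - 1) acts as z² d²/dz², which multiplies exp(q z) by q² z². So the falling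
  -- factorial correction has the same shape as the one coming from σ.
  tri*term : ∀ q m → (1ℚ + 1ℚ) * (tri m * term q m) ≡ q * q * shift 2 (term q) m
  tri*term q m = trans (identity₀ (tri m) (term q m)) (trans (cong (_* term q m) (tri-double m)) (lemma m))
    where
    identity₀ : ∀ t x → (1ℚ + 1ℚ) * (t * x) ≡ (t + t) * x
    identity₀ = solve-∀ ℚ-ring
    identity₁ : ∀ i t → (1ℚ + i) * (1ℚ + i - 1ℚ) * t ≡ i * ((1ℚ + i) * t)
    identity₁ = solve-∀ ℚ-ring
    identity₂ : ∀ i q t → i * (q * t) ≡ q * (i * t)
    identity₂ = solve-∀ ℚ-ring
    lemma : ∀ m → ι m * (ι m - 1ℚ) * term q m ≡ q * q * shift 2 (term q) m
    lemma zero          = trans (ℚ.*-zeroˡ 1ℚ) (sym (ℚ.*-zeroʳ (q * q)))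
    lemma (suc zero)    = trans (ℚ.*-zeroˡ (term q 1)) (sym (ℚ.*-zeroʳ (q * q)))
    lemma (suc (suc j)) = begin-equality
      ι (2 ℕ.+ j) * (ι (2 ℕ.+ j) - 1ℚ) * term q (2 ℕ.+ j)
        ≡⟨ cong (λ i → i * (i - 1ℚ) * term q (2 ℕ.+ j)) (ι-suc (suc j)) ⟩
      (1ℚ + ι (suc j)) * (1ℚ + ι (suc j) - 1ℚ) * term q (2 ℕ.+ j)
        ≡⟨ identity₁ (ι (suc j)) (term q (2 ℕ.+ j)) ⟩
      ι (suc j) * ((1ℚ + ι (suc j)) * term q (2 ℕ.+ j))
        ≡⟨ cong (λ i → ι (suc j) * (i * term q (2 ℕ.+ j))) (ι-suc (suc j)) ⟨
      ι (suc j) * (ι (2 ℕ.+ j) * term q (2 ℕ.+ j))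
        ≡⟨ cong (ι (suc j) *_) (ι*term-suc q (suc j)) ⟩
      ι (suc j) * (q * term q (suc j))
        ≡⟨ identity₂ (ι (suc j)) q (term q (suc j)) ⟩
      q * (ι (suc j) * term q (suc j))
        ≡⟨ cong (q *_) (ι*term-suc q j) ⟩
      q * (q * term q j)
        ≡⟨ ℚ.*-assoc q q (term q j) ⟨
      q * q * term q j ∎

  -- Termwise comparison with the two-term exponential series

  module Estimate (d : ℕ) (Q : Series) (Q0≡1 : Q 0 ≡ 1ℚ) (Q-bounded : ExpBounded Q)
                  (Q-van : VanishesBeyond d Q) (small : ∣ recip (suc d) * Q 1 ∣ ≤ ι d) where

    open Powers Q Q0≡1 Q-bounded

    -- In `β` the summand ½ κ q² stems from the falling factorial and σ κ² from the r-th power of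
    -- `Q`.
    κ q β : ℚ
    κ = recip (suc d)
    q = κ * a
    β = ½ * κ * (q * q) + σ * (κ * κ)

    -- Error majorants free of r: `D₁` for the falling factorial, `D₂` for the r-th power, `D₃` for
    -- the product of the two first-order corrections, `D₄` for the comparison series beyond degree
    -- d r.
    sa D₁ D₂ D₃ D₄ D : Series
    sa = shift 2 (term ∣ a ∣)
    D₁ m = ι m * (ι m * (ι m * (ι m * (term ∣ a ∣ m + ∣ σ ∣ * sa m))))
    D₂ m = B * (shift 3 (term A) m + shift 4 (term A) m)
    D₃ m = ∣ σ ∣ * (ι m * (ι m * sa m))
    D₄ m = ι m * (ι m * z· (term ∣ a ∣) m)
    D m = (D₁ m + D₂ m) + (D₃ m + D₄ m)

    D-bounded : ExpBounded D
    D-bounded = +-expBounded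
      (+-expBounded (ι·-expBounded (ι·-expBounded (ι·-expBounded (ι·-expBounded (+-expBounded ta (·-expBounded ∣ σ ∣ sta))))))
                    (·-expBounded B (+-expBounded (shift-expBounded 3 (term-expBounded A)) (shift-expBounded 4 (term-expBounded A)))))
      (+-expBounded (·-expBounded ∣ σ ∣ (ι·-expBounded (ι·-expBounded sta)))
                    (ι·-expBounded (ι·-expBounded (z·-expBounded ta))))
      where
      ta = term-expBounded ∣ a ∣
      sta = shift-expBounded 2 ta

    0≤ta : ∀ m → 0ℚ ≤ term ∣ a ∣ m
    0≤ta = 0≤term (ℚ.0≤∣p∣ a)
    0≤sa : ∀ m → 0ℚ ≤ sa m
    0≤sa = shift-nonNeg 2 0≤ta
    0≤F : ∀ m → 0ℚ ≤ term ∣ a ∣ m + ∣ σ ∣ * sa m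
    0≤F m = 0≤+ (0≤ta m) (0≤* (ℚ.0≤∣p∣ σ) (0≤sa m))
    0≤D₁ : ∀ m → 0ℚ ≤ D₁ m
    0≤D₁ m = 0≤* (0≤ι m) (0≤* (0≤ι m) (0≤* (0≤ι m) (0≤* (0≤ι m) (0≤F m))))
    0≤D₃ : ∀ m → 0ℚ ≤ D₃ m
    0≤D₃ m = 0≤* (ℚ.0≤∣p∣ σ) (0≤* (0≤ι m) (0≤* (0≤ι m) (0≤sa m)))
    0≤D₄ : ∀ m → 0ℚ ≤ D₄ m
    0≤D₄ m = 0≤* (0≤ι m) (0≤* (0≤ι m) (shift-nonNeg 1 0≤ta m))

    module _ (r : ℕ) .{{_ : NonZero r}} where
      open FallingFactorial d r hiding (κ)

      b target φ η : Series
      b = pow Q r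
      target m = term q m + ρ * β * shift 2 (term q) m
      φ m = term a m + ρ * σ * shift 2 (term a) m
      η m = ρ ^ m * err r m

      ρ^m*b : ∀ m → ρ ^ m * b m ≡ φ m + η m
      ρ^m*b m = trans (cong (ρ ^ m *_) (split (b m) (Y r m)))
        (trans (ℚ.*-distribˡ-+ (ρ ^ m) (Y r m) (err r m)) (cong (_+ η m) (scaled-Y r m)))
        where
        split : ∀ p y → p ≡ y + (p - y)
        split = solve-∀ ℚ-ring

      target≡ : ∀ m → target m ≡ κ ^ m * (term a m * (1ℚ + tri m * τ) + ρ * σ * shift 2 (term a) m)
      target≡ m = sym (begin-equality
        P * (term a m * (1ℚ + tri m * τ) + ρ * σ * s)
          ≡⟨ identity₁ P (term a m) (tri m) κ ρ σ s ⟩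
        P * term a m + κ * ρ * (tri m * (P * term a m)) + ρ * σ * (P * s)
          ≡⟨ cong₂ (λ x w → x + κ * ρ * (tri m * x) + ρ * σ * w) (term-scale κ a m) (shift-scale κ a 2 m) ⟩
        x + κ * ρ * (tri m * x) + ρ * σ * (κ * (κ * 1ℚ) * w)
          ≡⟨ cong (λ t → x + κ * ρ * t + ρ * σ * (κ * (κ * 1ℚ) * w)) half ⟩
        x + κ * ρ * (½ * (q * q * w)) + ρ * σ * (κ * (κ * 1ℚ) * w)
          ≡⟨ identity₂ x κ ρ ½ q w σ ⟩
        x + ρ * β * w ∎)
        where
        P = κ ^ m
        s = shift 2 (term a) m
        x = term q m
        w = shift 2 (term q) m
        identity₁ : ∀ p x t k r σ s → p * (x * (1ℚ + t * (k * r)) + r * σ * s) ≡ p * x + k * r * (t * (p * x)) + r * σ * (p * s)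
        identity₁ = solve-∀ ℚ-ring
        identity₂ : ∀ x k r h q w σ → x + k * r * (h * (q * q * w)) + r * σ * (k * (k * 1ℚ) * w)
                  ≡ x + r * (h * k * (q * q) + σ * (k * k)) * w
        identity₂ = solve-∀ ℚ-ring
        half : tri m * x ≡ ½ * (q * q * w)
        half = trans (sym (ℚ.*-identityˡ _)) (trans (ℚ.*-assoc ½ (1ℚ + 1ℚ) (tri m * x)) (cong (½ *_) (tri*term q m)))

      η≤ : ∀ m → ∣ η m ∣ ≤ ρ * ρ * D₂ m
      η≤ = scaled-err≼ r

      0≤ρ² : 0ℚ ≤ ρ * ρ
      0≤ρ² = 0≤* 0≤ρ 0≤ρ

      φ≤ : ∀ m → ∣ φ m ∣ ≤ term ∣ a ∣ m + ∣ σ ∣ * sa m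
      φ≤ m = ∣+∣≤ (term≼ {a} ℚ.≤-refl m) (∣*∣≤ ρσ≤ (shift-mono 2 (term≼ {a} ℚ.≤-refl) m))
        where
        ρσ≤ : ∣ ρ * σ ∣ ≤ ∣ σ ∣
        ρσ≤ = ℚ.≤-trans (∣*∣≤ (∣0≤∣≤ 0≤ρ (recip≤1 r)) ℚ.≤-refl) (ℚ.≤-reflexive (ℚ.*-identityˡ ∣ σ ∣))

      tri*τ≤ : ∀ m → ∣ tri m * τ ∣ ≤ ι m * ι m * ρ
      tri*τ≤ m = ∣*∣≤ (∣0≤∣≤ (0≤tri m) (tri≤ m)) (∣0≤∣≤ 0≤τ τ≤ρ)

      ∣κ^∣≤1 : ∀ m → ∣ κ ^ m ∣ ≤ 1ℚ
      ∣κ^∣≤1 m = ∣0≤∣≤ (0≤^ 0≤κ m) (^≤1 0≤κ κ≤1 m)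

      u : Series
      u m = fact (N ℕ.∸ m) * N!⁻¹

      b*u≡ : ∀ m → b m * u m ≡ (φ m + η m) * v m
      b*u≡ m = sym (begin-equality
        (φ m + η m) * v m                      ≡⟨ cong (_* v m) (ρ^m*b m) ⟨
        ρ ^ m * b m * (ι r ^ m * u m)          ≡⟨ identity (ρ ^ m) (b m) (ι r ^ m) (u m) ⟩
        ρ ^ m * ι r ^ m * (b m * u m)          ≡⟨ cong (_* (b m * u m)) unit ⟩
        1ℚ * (b m * u m)                       ≡⟨ ℚ.*-identityˡ _ ⟩
        b m * u m                              ∎)
        where
        identity : ∀ p b r u → p * b * (r * u) ≡ p * r * (b * u)
        identity = solve-∀ ℚ-ring
        1^ : ∀ n → 1ℚ ^ n ≡ 1ℚ
        1^ zero    = refl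
        1^ (suc n) = trans (ℚ.*-identityˡ (1ℚ ^ n)) (1^ n)
        unit : ρ ^ m * ι r ^ m ≡ 1ℚ
        unit = trans (sym (^-distrib-* ρ (ι r) m))
               (trans (cong (_^ m) (trans (ℚ.*-comm ρ (ι r)) (ι*recip r))) (1^ m))

      -- Since b u = (φ + η) v, and φ y exceeds the target only by the product of the two
      -- first-order corrections, three terms of second order remain.
      low : ∀ m → m ℕ.≤ d ℕ.* r → ∣ b m * u m - target m ∣ ≤ ρ * ρ * D m
      low m m≤dr = begin
        ∣ b m * u m - target m ∣
          ≡⟨ cong ∣_∣ split ⟩
        ∣ φ m * (v m - y m) + η m * v m + (ρ * σ) * s * (κ ^ m * (tri m * τ)) ∣
          ≤⟨ ∣+∣≤ (∣+∣≤ bound₁ bound₂) bound₃ ⟩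
        F * (ρ * ρ * fourth m) + ρ * ρ * D₂ m * 1ℚ + (ρ * ∣ σ ∣) * sa m * (1ℚ * (ι m * ι m * ρ))
          ≡⟨ collect ⟩
        ρ * ρ * (D₁ m + D₂ m + D₃ m)
          ≤⟨ *-monoˡ 0≤ρ² drop ⟩
        ρ * ρ * D m ∎
        where
        s = shift 2 (term a) m
        F = term ∣ a ∣ m + ∣ σ ∣ * sa m
        split : b m * u m - target m ≡ φ m * (v m - y m) + η m * v m + (ρ * σ) * s * (κ ^ m * (tri m * τ))
        split = trans (cong₂ _-_ (b*u≡ m) (target≡ m)) (identity (term a m) (ρ * σ) s (η m) (v m) (κ ^ m) (tri m) τ)
          where
          identity : ∀ x c s e v k t τ → (x + c * s + e) * v - k * (x * (1ℚ + t * τ) + c * s)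
                   ≡ (x + c * s) * (v - k * (1ℚ + t * τ)) + e * v + c * s * (k * (t * τ))
          identity = solve-∀ ℚ-ring
        bound₁ : ∣ φ m * (v m - y m) ∣ ≤ F * (ρ * ρ * fourth m)
        bound₁ = ∣*∣≤ (φ≤ m) (v-y≤ m m≤dr)
        bound₂ : ∣ η m * v m ∣ ≤ ρ * ρ * D₂ m * 1ℚ
        bound₂ = ∣*∣≤ (η≤ m) (∣0≤∣≤ (0≤v m) (v≤1 m m≤dr))
        bound₃ : ∣ (ρ * σ) * s * (κ ^ m * (tri m * τ)) ∣ ≤ (ρ * ∣ σ ∣) * sa m * (1ℚ * (ι m * ι m * ρ))
        bound₃ = ∣*∣≤ (∣*∣≤ (∣*∣≤ (∣0≤∣≤ 0≤ρ ℚ.≤-refl) ℚ.≤-refl) (shift-mono 2 (term≼ {a} ℚ.≤-refl) m))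
                      (∣*∣≤ (∣κ^∣≤1 m) (tri*τ≤ m))
        collect : F * (ρ * ρ * fourth m) + ρ * ρ * D₂ m * 1ℚ + (ρ * ∣ σ ∣) * sa m * (1ℚ * (ι m * ι m * ρ))
                ≡ ρ * ρ * (D₁ m + D₂ m + D₃ m)
        collect = identity F ρ (ι m) (D₂ m) ∣ σ ∣ (sa m)
          where
          identity : ∀ f p i e o s → f * (p * p * (i * (i * (i * i)))) + p * p * e * 1ℚ + (p * o) * s * (1ℚ * (i * i * p))
                   ≡ p * p * (i * (i * (i * (i * f))) + e + o * (i * (i * s)))
          identity = solve-∀ ℚ-ring
        drop : D₁ m + D₂ m + D₃ m ≤ D m
        drop = ℚ.≤-trans (p≤p+q (0≤D₄ m)) (ℚ.≤-reflexive (ℚ.+-assoc (D₁ m + D₂ m) (D₃ m) (D₄ m)))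

      -- Beyond degree d r the coefficient is 0, so the error term cancels the main term φ.
      high : ∀ m → d ℕ.* r ℕ.< m → ∣ b m * u m - target m ∣ ≤ ρ * ρ * D m
      high m@(suc j) dr<m = begin
        ∣ b m * u m - target m ∣
          ≡⟨ cong ∣_∣ split ⟩
        ∣ κ ^ m * η m - tri m * τ * term q m ∣
          ≤⟨ ∣-∣≤ first second ⟩
        ρ * ρ * D₂ m + ρ * ρ * D₄ m
          ≡⟨ ℚ.*-distribˡ-+ (ρ * ρ) (D₂ m) (D₄ m) ⟨
        ρ * ρ * (D₂ m + D₄ m)
          ≤⟨ *-monoˡ 0≤ρ² (ℚ.+-mono-≤ (p≤q+p (0≤D₁ m)) (p≤q+p (0≤D₃ m))) ⟩
        ρ * ρ * D m ∎
        where
        b≡0 : b m ≡ 0ℚ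
        b≡0 = pow-vanishes Q-van r m (subst (ℕ._< m) (ℕ.*-comm d r) dr<m)
        φ≡-η : φ m ≡ - η m
        φ≡-η = trans (identity₄ (φ m) (η m)) (trans (cong (_- η m) (trans (sym (ρ^m*b m))
          (trans (cong (ρ ^ m *_) b≡0) (ℚ.*-zeroʳ (ρ ^ m))))) (ℚ.+-identityˡ (- η m)))
          where
          identity₄ : ∀ x y → x ≡ (x + y) - y
          identity₄ = solve-∀ ℚ-ring
        split : b m * u m - target m ≡ κ ^ m * η m - tri m * τ * term q m
        split = begin-equality
          b m * u m - target m
            ≡⟨ cong₂ (λ s t → s * u m - t) b≡0 (target≡ m) ⟩
          0ℚ * u m - κ ^ m * (term a m * (1ℚ + tri m * τ) + ρ * σ * s)
            ≡⟨ identity₁ (u m) (κ ^ m) (term a m) (tri m) τ (ρ * σ * s) ⟩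
          - (κ ^ m * φ m) - tri m * τ * (κ ^ m * term a m)
            ≡⟨ cong₂ (λ s t → - (κ ^ m * s) - tri m * τ * t) φ≡-η (term-scale κ a m) ⟩
          - (κ ^ m * - η m) - tri m * τ * term q m
            ≡⟨ cong (_- tri m * τ * term q m) (identity₂ (κ ^ m) (η m)) ⟩
          κ ^ m * η m - tri m * τ * term q m ∎
          where
          s = shift 2 (term a) m
          identity₁ : ∀ u k x t τ w → 0ℚ * u - k * (x * (1ℚ + t * τ) + w) ≡ - (k * (x + w)) - t * τ * (k * x)
          identity₁ = solve-∀ ℚ-ring
          identity₂ : ∀ k e → - (k * - e) ≡ k * e
          identity₂ = solve-∀ ℚ-ring
        first : ∣ κ ^ m * η m ∣ ≤ ρ * ρ * D₂ m
        first = ℚ.≤-trans (∣*∣≤ (∣κ^∣≤1 m) (η≤ m)) (ℚ.≤-reflexive (ℚ.*-identityˡ _))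
        -- Source of the second factor 1/r, the first being τ: m > d r and |q| ≤ d give |q| ≤ m/r,
        -- and one |q| is split off by m |q|^m / m! = |q| · |q|^(m-1) / (m - 1)!.
        q≤ : ∣ q ∣ ≤ ρ * ι m
        q≤ = ℚ.≤-trans small (ℚ.≤-trans (ℚ.≤-reflexive (sym (recip*ι* r (ι d))))
          (*-monoˡ 0≤ρ (ℚ.≤-trans (ℚ.≤-reflexive (trans (ℚ.*-comm (ι r) (ι d)) (sym (ι-* d r)))) (ι-mono (ℕ.<⇒≤ dr<m)))))
        ∣q∣≤∣a∣ : ∣ q ∣ ≤ ∣ a ∣
        ∣q∣≤∣a∣ = ℚ.≤-trans (∣*∣≤ (∣0≤∣≤ 0≤κ κ≤1) ℚ.≤-refl) (ℚ.≤-reflexive (ℚ.*-identityˡ ∣ a ∣))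
        second : ∣ tri m * τ * term q m ∣ ≤ ρ * ρ * D₄ m
        second = begin
          ∣ tri m * τ * term q m ∣                 ≤⟨ ∣*∣≤ (tri*τ≤ m) ℚ.≤-refl ⟩
          ι m * ι m * ρ * ∣ term q m ∣             ≡⟨ cong (ι m * ι m * ρ *_) (∣term∣ q m) ⟩
          ι m * ι m * ρ * term ∣ q ∣ m             ≡⟨ identity₅ (ι m) ρ (term ∣ q ∣ m) ⟩
          ρ * ι m * (ι m * term ∣ q ∣ m)           ≡⟨ cong (ρ * ι m *_) (ι*term-suc ∣ q ∣ j) ⟩
          ρ * ι m * (∣ q ∣ * term ∣ q ∣ j)         ≤⟨ *-monoˡ (0≤* 0≤ρ (0≤ι m)) (*-mono-nonNeg (ℚ.0≤∣p∣ q) q≤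
                                                        (0≤term (ℚ.0≤∣p∣ q) j) (term-mono (ℚ.0≤∣p∣ q) ∣q∣≤∣a∣ j)) ⟩
          ρ * ι m * (ρ * ι m * term ∣ a ∣ j)       ≡⟨ identity₆ (ι m) ρ (term ∣ a ∣ j) ⟩
          ρ * ρ * D₄ m                             ∎
          where
          identity₅ : ∀ i p x → i * i * p * x ≡ p * i * (i * x)
          identity₅ = solve-∀ ℚ-ring
          identity₆ : ∀ i p x → p * i * (p * i * x) ≡ p * p * (i * (i * x))
          identity₆ = solve-∀ ℚ-ring

      termwise : ∀ m → ∣ b m * u m - target m ∣ ≤ ρ * ρ * D m
      termwise m = [ low m , high m ]′ (ℕ.≤-<-connex m (d ℕ.* r))

      -- The degree d r of `b` is at most N. The sum may thus run to any n > N, as needed for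
      -- comparison with partial sums of the exponential, although N ∸ m is truncated there.
      b*u-vanishes : VanishesBeyond N (λ m → b m * u m)
      b*u-vanishes m N<m = trans (cong (_* u m) (pow-vanishes Q-van r m
        (ℕ.≤-<-trans (ℕ.≤-trans (ℕ.≤-reflexive (ℕ.*-comm r d)) (ℕ.m≤n+m (d ℕ.* r) r)) N<m))) (ℚ.*-zeroˡ (u m))

      psum-b*u : ∀ {n} → N ℕ.< n → psum (λ m → b m * u m) n ≡ conv b fact N * N!⁻¹
      psum-b*u N<n = trans (psum-extend b*u-vanishes N<n) (scaled-conv b fact N N!⁻¹)

      -- The factor z² delays the correction by two terms; the discrepancy between the two partial
      -- sums is dealt with by the Cauchy property in `error-bound`.
      psum-target : ∀ n → psum target (2 ℕ.+ n) ≡ partialSum q (2 ℕ.+ n) + ρ * β * partialSum q n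
      psum-target n = trans (psum-+ (term q) (λ m → ρ * β * shift 2 (term q) m) (2 ℕ.+ n))
        (cong₂ _+_ (sym (partialSum≡psum q (2 ℕ.+ n)))
          (trans (psum-· (ρ * β) (shift 2 (term q)) (2 ℕ.+ n)) (cong (ρ * β *_) shifted)))
        where
        shifted : psum (shift 2 (term q)) (2 ℕ.+ n) ≡ partialSum q n
        shifted = trans (psum-z· (shift 1 (term q)) (suc n)) (trans (psum-z· (term q) n) (sym (partialSum≡psum q n)))

      rateD scaleD : ℚ
      rateD = rate D-bounded
      scaleD = scale D-bounded

      termwise′ : ∀ m → ∣ b m * u m - target m ∣ ≤ ρ * ρ * scaleD * term rateD m
      termwise′ m = ℚ.≤-trans (termwise m) (ℚ.≤-trans
        (*-monoˡ 0≤ρ² (ℚ.≤-trans (p≤∣p∣ (D m)) (dominated D-bounded m)))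
        (ℚ.≤-reflexive (sym (ℚ.*-assoc (ρ * ρ) scaleD (term rateD m)))))

      total : ∀ n → N ℕ.< n → ∣ conv b fact N * N!⁻¹ - psum target n ∣ ≤ ρ * ρ * scaleD * partialSum rateD n
      total n N<n = subst₂ (λ s t → ∣ s - psum target n ∣ ≤ t) (psum-b*u N<n) summed (psum-close termwise′ n)
        where
        summed : psum (λ m → ρ * ρ * scaleD * term rateD m) n ≡ ρ * ρ * scaleD * partialSum rateD n
        summed = trans (psum-· (ρ * ρ * scaleD) (term rateD) n) (cong (ρ * ρ * scaleD *_) (sym (partialSum≡psum rateD n)))

    UniformBound : ℚ → ℕ → Set
    UniformBound K n₀ = ∀ r .{{_ : NonZero r}} n → suc d ℕ.* r ℕ.< n → n₀ ℕ.≤ n →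
      ∣ conv (pow Q r) fact (suc d ℕ.* r) * recip ((suc d ℕ.* r) !) {{(suc d ℕ.* r) !≢0}}
        - psum (target r) n ∣ ≤ recip r * recip r * K

    -- `D` does not depend on r, so one bound on the partial sums of its exponential majorant serves
    -- every r.
    estimate : ∃[ K ] 0ℚ ≤ K × ∃[ n₀ ] UniformBound K n₀
    estimate = conclude (eventually-bounded {partialSum (rate D-bounded)} (partialSum-cauchy (rate D-bounded)))
      where
      conclude : EventuallyBounded (partialSum (rate D-bounded)) → ∃[ K ] 0ℚ ≤ K × ∃[ n₀ ] UniformBound K n₀
      conclude (P , 0<P , n₀ , bounded) = scale D-bounded * P , 0≤* (0≤scale D-bounded) (ℚ.<⇒≤ 0<P) , n₀ , λ r n N<n n₀≤n →
        ℚ.≤-trans (total r n N<n) (ℚ.≤-trans (ℚ.≤-reflexive (ℚ.*-assoc (recip r * recip r) (scale D-bounded) (partialSum (rate D-bounded) n)))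
          (*-monoˡ (0≤* (0≤recip r) (0≤recip r)) (*-monoˡ (0≤scale D-bounded)
            (ℚ.≤-trans (p≤∣p∣ (partialSum (rate D-bounded) n)) (bounded n n₀≤n)))))

  -- The functional equation of the exponential function

  psum-grow : ∀ {F} → (∀ m → 0ℚ ≤ F m) → ∀ n c → psum F n ≤ psum F (n ℕ.+ c)
  psum-grow {F} 0≤F n zero    = ℚ.≤-reflexive (cong (psum F) (sym (ℕ.+-identityʳ n)))
  psum-grow {F} 0≤F n (suc c) = ℚ.≤-trans (psum-grow 0≤F n c)
    (ℚ.≤-trans (p≤p+q (0≤F (n ℕ.+ c))) (ℚ.≤-reflexive (cong (psum F) (sym (ℕ.+-suc n c)))))

  psum-gap : ∀ {g G} → g ≼ G → ∀ n c → ∣ psum g (n ℕ.+ c) - psum g n ∣ ≤ psum G (n ℕ.+ c) - psum G n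
  psum-gap {g} {G} g≼G n zero    = ℚ.≤-reflexive (trans (cong ∣_∣ (gap₀ g)) (sym (gap₀ G)))
    where
    gap₀ : ∀ f → psum f (n ℕ.+ 0) - psum f n ≡ 0ℚ
    gap₀ f = trans (cong (λ t → psum f t - psum f n) (ℕ.+-identityʳ n)) (ℚ.+-inverseʳ (psum f n))
  psum-gap {g} {G} g≼G n (suc c) = begin
    ∣ psum g (n ℕ.+ suc c) - psum g n ∣                          ≡⟨ cong ∣_∣ (step g) ⟩
    ∣ (psum g (n ℕ.+ c) - psum g n) + g (n ℕ.+ c) ∣              ≤⟨ ∣+∣≤ (psum-gap g≼G n c) (g≼G (n ℕ.+ c)) ⟩
    psum G (n ℕ.+ c) - psum G n + G (n ℕ.+ c)                    ≡⟨ step G ⟨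
    psum G (n ℕ.+ suc c) - psum G n                              ∎
    where
    identity : ∀ a b c → a + b - c ≡ a - c + b
    identity = solve-∀ ℚ-ring
    step : ∀ f → psum f (n ℕ.+ suc c) - psum f n ≡ (psum f (n ℕ.+ c) - psum f n) + f (n ℕ.+ c)
    step f = trans (cong (λ t → psum f t - psum f n) (ℕ.+-suc n c))
                   (identity (psum f (n ℕ.+ c)) (f (n ℕ.+ c)) (psum f n))

  psum-conv-suc : ∀ f g n → psum (conv f g) (suc n) ≡ f 0 * psum g (suc n) + psum (conv (f ∘ suc) g) n
  psum-conv-suc f g zero    = identity (f 0) (g 0)
    where
    identity : ∀ a b → 0ℚ + a * b ≡ a * (0ℚ + b) + 0ℚ
    identity = solve-∀ ℚ-ring
  psum-conv-suc f g (suc n) = trans (cong (_+ conv f g (suc n)) (psum-conv-suc f g n))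
    (identity (f 0) (psum g (suc n)) (psum (conv (f ∘ suc) g) n) (g (suc n)) (conv (f ∘ suc) g n))
    where
    identity : ∀ a s t b w → a * s + t + (a * b + w) ≡ a * (s + b) + (t + w)
    identity = solve-∀ ℚ-ring

  -- The part of the rectangle {i < n, j < n + c} not covered by the triangle {i + j < n}.
  excess : Series → Series → ℕ → ℕ → ℚ
  excess f g n c = psum f n * psum g (n ℕ.+ c) - psum (conv f g) n

  excess-suc : ∀ f g n c → excess f g (suc n) c ≡
    f 0 * (psum g (suc n ℕ.+ c) - psum g (suc n)) + excess (f ∘ suc) g n (suc c)
  excess-suc f g n c = begin-equality
    psum f (suc n) * G - psum (conv f g) (suc n)
      ≡⟨ cong₂ (λ s t → s * G - t) (psum-head f n) (psum-conv-suc f g n) ⟩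
    (f 0 + psum (f ∘ suc) n) * G - (f 0 * psum g (suc n) + psum (conv (f ∘ suc) g) n)
      ≡⟨ identity (f 0) (psum (f ∘ suc) n) G (psum g (suc n)) (psum (conv (f ∘ suc) g) n) ⟩
    f 0 * (G - psum g (suc n)) + (psum (f ∘ suc) n * G - psum (conv (f ∘ suc) g) n)
      ≡⟨ cong (λ t → f 0 * (G - psum g (suc n)) + (psum (f ∘ suc) n * psum g t - psum (conv (f ∘ suc) g) n)) (sym (ℕ.+-suc n c)) ⟩
    f 0 * (G - psum g (suc n)) + excess (f ∘ suc) g n (suc c) ∎
    where
    G = psum g (suc n ℕ.+ c)
    identity : ∀ a p g h t → (a + p) * g - (a * h + t) ≡ a * (g - h) + (p * g - t)
    identity = solve-∀ ℚ-ring

  -- The excess is a sum of products f i · g j over the uncovered lattice points. Row 0 is a gap of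
  -- partial sums of g; the other rows form an excess of `f ∘ suc` with n smaller and c larger by
  -- one.
  excess-mono : ∀ {f g F G} → f ≼ F → g ≼ G → ∀ n c → ∣ excess f g n c ∣ ≤ excess F G n c
  excess-mono {f} {g} {F} {G} f≼F g≼G zero c =
    ℚ.≤-reflexive (trans (cong ∣_∣ (excess₀ f g)) (sym (excess₀ F G)))
    where
    identity : ∀ x → 0ℚ * x - 0ℚ ≡ 0ℚ
    identity = solve-∀ ℚ-ring
    excess₀ : ∀ f g → excess f g 0 c ≡ 0ℚ
    excess₀ f g = identity (psum g c)
  excess-mono {f} {g} {F} {G} f≼F g≼G (suc n) c = begin
    ∣ excess f g (suc n) c ∣
      ≡⟨ cong ∣_∣ (excess-suc f g n c) ⟩
    ∣ f 0 * (psum g (suc n ℕ.+ c) - psum g (suc n)) + excess (f ∘ suc) g n (suc c) ∣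
      ≤⟨ ∣+∣≤ (∣*∣≤ (f≼F 0) (psum-gap g≼G (suc n) c)) (excess-mono (f≼F ∘ suc) g≼G n (suc c)) ⟩
    F 0 * (psum G (suc n ℕ.+ c) - psum G (suc n)) + excess (F ∘ suc) G n (suc c)
      ≡⟨ excess-suc F G n c ⟨
    excess F G (suc n) c ∎

  -- The points with i < p and j < n satisfy i + j < p + n, and all summands are nonnegative.
  rectangle≤triangle : ∀ {F G} → (∀ m → 0ℚ ≤ F m) → (∀ m → 0ℚ ≤ G m) →
                       ∀ p n → psum F p * psum G n ≤ psum (conv F G) (p ℕ.+ n)
  rectangle≤triangle {F} {G} 0≤F 0≤G zero    n =
    ℚ.≤-trans (ℚ.≤-reflexive (ℚ.*-zeroˡ (psum G n))) (psum-nonNeg (conv-nonNeg 0≤F 0≤G) n)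
  rectangle≤triangle {F} {G} 0≤F 0≤G (suc p) n = begin
    psum F (suc p) * psum G n
      ≡⟨ trans (cong (_* psum G n) (psum-head F p)) (ℚ.*-distribʳ-+ (psum G n) (F 0) (psum (F ∘ suc) p)) ⟩
    F 0 * psum G n + psum (F ∘ suc) p * psum G n
      ≤⟨ ℚ.+-mono-≤ (*-monoˡ (0≤F 0) (ℚ.≤-trans (psum-grow 0≤G n (suc p)) (ℚ.≤-reflexive (cong (psum G) (ℕ.+-comm n (suc p))))))
                    (rectangle≤triangle (0≤F ∘ suc) 0≤G p n) ⟩
    F 0 * psum G (suc (p ℕ.+ n)) + psum (conv (F ∘ suc) G) (p ℕ.+ n)
      ≡⟨ psum-conv-suc F G (p ℕ.+ n) ⟨
    psum (conv F G) (suc p ℕ.+ n) ∎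

  partialSum-0 : ∀ n → partialSum 0ℚ (suc n) ≡ 1ℚ
  partialSum-0 zero    = refl
  partialSum-0 (suc n) = trans (cong₂ _+_ (partialSum-0 n) vanish) (ℚ.+-identityʳ 1ℚ)
    where
    vanish : term 0ℚ (suc n) ≡ 0ℚ
    vanish = trans (cong (_* recip (suc n !) {{suc n !≢0}}) (ℚ.*-zeroˡ (0ℚ ^ n))) (ℚ.*-zeroˡ (recip (suc n !) {{suc n !≢0}}))

  -- The triangular part of the product is a partial sum of exp(0), that is 1. The excess is
  -- majorised by that of exp(|x| z) with itself, which lies between the triangles of sizes n and
  -- 2n: a difference of partial sums of exp(2|x|), small by the Cauchy property.
  exp-inverse : ∀ x ε → 0ℚ < ε → ∃[ L ] (∀ n → L ℕ.≤ n → ∣ partialSum x n * partialSum (- x) n - 1ℚ ∣ ≤ ε)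
  exp-inverse x ε 0<ε with partialSum-cauchy (∣ x ∣ + ∣ x ∣) ε 0<ε
  -- `suc L` excludes n = 0, where the empty sum is 0 and not 1.
  ... | L , close = suc L , λ { n@(suc n-1) (ℕ.s≤s L≤n-1) → bound n (sum≡1 n-1) (ℕ.m≤n⇒m≤1+n L≤n-1) }
    where
    sum≡1 : ∀ n → psum (conv (term x) (term (- x))) (suc n) ≡ 1ℚ
    sum≡1 n = trans (psum-cong (λ m → trans (conv-term x (- x) m) (cong (λ t → term t m) (ℚ.+-inverseʳ x))) (suc n))
      (trans (sym (partialSum≡psum 0ℚ (suc n))) (partialSum-0 n))
    X : Series
    X = term ∣ x ∣
    0≤X : ∀ m → 0ℚ ≤ X m
    0≤X = 0≤term (ℚ.0≤∣p∣ x)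
    bound : ∀ n → psum (conv (term x) (term (- x))) n ≡ 1ℚ → L ℕ.≤ n → ∣ partialSum x n * partialSum (- x) n - 1ℚ ∣ ≤ ε
    bound n sum≡1 L≤n = begin
      ∣ partialSum x n * partialSum (- x) n - 1ℚ ∣
        ≡⟨ cong ∣_∣ (cong₂ _-_ (cong₂ _*_ (partialSum≡psum x n)
             (trans (partialSum≡psum (- x) n) (cong (psum (term (- x))) (sym (ℕ.+-identityʳ n))))) (sym sum≡1)) ⟩
      ∣ excess (term x) (term (- x)) n 0 ∣
        ≤⟨ excess-mono (term≼ {x} ℚ.≤-refl) (term≼ {(- x)} (ℚ.≤-reflexive (ℚ.∣-p∣≡∣p∣ x))) n 0 ⟩
      psum X n * psum X (n ℕ.+ 0) - psum (conv X X) n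
        ≤⟨ ℚ.+-monoˡ-≤ (- psum (conv X X) n) (ℚ.≤-trans (ℚ.≤-reflexive (cong (λ t → psum X n * psum X t) (ℕ.+-identityʳ n)))
             (rectangle≤triangle 0≤X 0≤X n n)) ⟩
      psum (conv X X) (n ℕ.+ n) - psum (conv X X) n
        ≡⟨ cong₂ _-_ (conv-X (n ℕ.+ n)) (conv-X n) ⟩
      partialSum (∣ x ∣ + ∣ x ∣) (n ℕ.+ n) - partialSum (∣ x ∣ + ∣ x ∣) n
        ≤⟨ ℚ.≤-trans (p≤∣p∣ _) (close (n ℕ.+ n) n (ℕ.≤-trans L≤n (ℕ.m≤m+n n n)) L≤n) ⟩
      ε ∎
      where
      conv-X : ∀ n → psum (conv X X) n ≡ partialSum (∣ x ∣ + ∣ x ∣) n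
      conv-X n = trans (psum-cong (conv-term ∣ x ∣ ∣ x ∣) n) (sym (partialSum≡psum (∣ x ∣ + ∣ x ∣) n))

open Analysis

-- Counting list elements

count : ∀ {A : Set} {P : A → Set} → U.Decidable P → List A → ℕ
count P? xs = length (filter P? xs)

indicator : ∀ {P : Set} → Dec P → ℕ
indicator P? = if does P? then 1 else 0

indicator-yes : ∀ {P : Set} (P? : Dec P) → P → indicator P? ≡ 1
indicator-yes (yes _) _ = refl
indicator-yes (no ¬p) p = contradiction p ¬p

indicator-no : ∀ {P : Set} (P? : Dec P) → ¬ P → indicator P? ≡ 0
indicator-no (yes p) ¬p = contradiction p ¬p
indicator-no (no _)  _  = refl

size : ∀ {r} → (Fin r → ℕ) → ℕ
size {zero}  κ = 0
size {suc r} κ = κ zero ℕ.+ size (κ ∘ suc)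

size-cong : ∀ {r} {κ κ′ : Fin r → ℕ} → (∀ i → κ i ≡ κ′ i) → size κ ≡ size κ′
size-cong {zero}  p = refl
size-cong {suc r} p = cong₂ ℕ._+_ (p zero) (size-cong (p ∘ suc))

size-+ : ∀ {r} (κ κ′ : Fin r → ℕ) → size (λ i → κ i ℕ.+ κ′ i) ≡ size κ ℕ.+ size κ′
size-+ {zero}  κ κ′ = refl
size-+ {suc r} κ κ′ = begin
  κ zero ℕ.+ κ′ zero ℕ.+ size (λ i → κ (suc i) ℕ.+ κ′ (suc i))
    ≡⟨ cong (κ zero ℕ.+ κ′ zero ℕ.+_) (size-+ (κ ∘ suc) (κ′ ∘ suc)) ⟩
  κ zero ℕ.+ κ′ zero ℕ.+ (size (κ ∘ suc) ℕ.+ size (κ′ ∘ suc))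
    ≡⟨ interchange (κ zero) (κ′ zero) (size (κ ∘ suc)) (size (κ′ ∘ suc)) ⟩
  κ zero ℕ.+ size (κ ∘ suc) ℕ.+ (κ′ zero ℕ.+ size (κ′ ∘ suc)) ∎
  where
  open ≡-Reasoning
  interchange : ∀ a b c d → a ℕ.+ b ℕ.+ (c ℕ.+ d) ≡ a ℕ.+ c ℕ.+ (b ℕ.+ d)
  interchange a b c d = trans (ℕ.+-assoc a b (c ℕ.+ d)) (trans (cong (a ℕ.+_)
    (trans (sym (ℕ.+-assoc b c d)) (trans (cong (ℕ._+ d) (ℕ.+-comm b c)) (ℕ.+-assoc c b d)))) (sym (ℕ.+-assoc a c (b ℕ.+ d))))

size-0 : ∀ {r} {κ : Fin r → ℕ} → (∀ i → κ i ≡ 0) → size κ ≡ 0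
size-0 {zero}  p = refl
size-0 {suc r} p = cong₂ ℕ._+_ (p zero) (size-0 (p ∘ suc))

size≡0 : ∀ {r} (κ : Fin r → ℕ) → size κ ≡ 0 → ∀ i → κ i ≡ 0
size≡0 κ eq zero    = ℕ.m+n≡0⇒m≡0 (κ zero) eq
size≡0 κ eq (suc i) = size≡0 (κ ∘ suc) (ℕ.m+n≡0⇒n≡0 (κ zero) eq) i

size-unit : ∀ {r} (κ : Fin r → ℕ) i → κ i ≡ 1 → (∀ j → j ≢ i → κ j ≡ 0) → size κ ≡ 1
size-unit κ zero    p q = cong₂ ℕ._+_ p (size-0 (λ j → q (suc j) λ ()))
size-unit κ (suc i) p q = cong₂ ℕ._+_ (q zero λ ()) (size-unit (κ ∘ suc) i p (λ j j≢i → q (suc j) (λ { refl → j≢i refl })))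

module _ {A : Set} where

  count-∷ : ∀ {P : A → Set} (P? : U.Decidable P) x xs → count P? (x ∷ xs) ≡ indicator (P? x) ℕ.+ count P? xs
  count-∷ P? x xs with does (P? x)
  ... | true  = refl
  ... | false = refl

  count-cong : ∀ {P Q : A → Set} (P? : U.Decidable P) (Q? : U.Decidable Q) →
    (∀ {x} → P x → Q x) → (∀ {x} → Q x → P x) → ∀ xs → count P? xs ≡ count Q? xs
  count-cong P? Q? to from xs = cong length (filter-≐ P? Q? (to , from) xs)

  count-partition : ∀ {r} {P : A → Set} (P? : U.Decidable P) {Q : Fin r → A → Set} (Q? : ∀ i → U.Decidable (Q i)) →
    (∀ {x} → P x → ∃[ i ] Q i x × (∀ j → Q j x → j ≡ i)) →
    ∀ xs → count P? xs ≡ size (λ i → count (λ x → P? x ×-dec Q? i x) xs)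
  count-partition P? Q? unique []       = sym (size-0 {κ = λ i → count (λ x → P? x ×-dec Q? i x) []} (λ _ → refl))
  count-partition {P = P} P? Q? unique (x ∷ xs) = begin
    count P? (x ∷ xs)
      ≡⟨ count-∷ P? x xs ⟩
    indicator (P? x) ℕ.+ count P? xs
      ≡⟨ cong₂ ℕ._+_ (head (P? x)) (count-partition P? Q? unique xs) ⟩
    size (λ i → indicator (PQ? i x)) ℕ.+ size (λ i → count (PQ? i) xs)
      ≡⟨ size-+ (λ i → indicator (PQ? i x)) (λ i → count (PQ? i) xs) ⟨
    size (λ i → indicator (PQ? i x) ℕ.+ count (PQ? i) xs)
      ≡⟨ size-cong (λ i → sym (count-∷ (PQ? i) x xs)) ⟩
    size (λ i → count (PQ? i) (x ∷ xs)) ∎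
    where
    open ≡-Reasoning
    PQ? = λ i x → P? x ×-dec Q? i x
    head : (p? : Dec (P x)) → indicator p? ≡ size (λ i → indicator (PQ? i x))
    head (no ¬p) = sym (size-0 (λ i → indicator-no (PQ? i x) (¬p ∘ proj₁)))
    head (yes p) with unique p
    ... | i , Qi , only = sym (size-unit _ i (indicator-yes (PQ? i x) (p , Qi))
                                 (λ j j≢i → indicator-no (PQ? j x) (j≢i ∘ only j ∘ proj₂)))

  count-split : ∀ {P Q : A → Set} (P? : U.Decidable P) (Q? : U.Decidable Q) xs →
    count P? xs ≡ count (λ x → P? x ×-dec ¬? (Q? x)) xs ℕ.+ count (λ x → P? x ×-dec Q? x) xs
  count-split P? Q? []       = refl
  count-split P? Q? (x ∷ xs) with does (P? x) | does (Q? x)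
  ... | false | _     = count-split P? Q? xs
  ... | true  | false = cong suc (count-split P? Q? xs)
  ... | true  | true  = trans (cong suc (count-split P? Q? xs)) (sym (ℕ.+-suc _ _))

unique-⊆-length : ∀ {A : Set} {xs ys : List A} → Unique xs → (∀ {x} → x ∈ xs → x ∈ ys) → length xs ℕ.≤ length ys
unique-⊆-length {xs = []}     _             _     = ℕ.z≤n
unique-⊆-length {xs = x ∷ xs} (x∉xs ∷ uniq) xs⊆ys with ∈-∃++ (xs⊆ys (here refl))
... | as , bs , refl = ℕ.≤-trans (ℕ.s≤s (unique-⊆-length uniq drop)) (ℕ.≤-reflexive (sym
    (trans (length-++ as) (trans (ℕ.+-suc (length as) (length bs)) (cong suc (sym (length-++ as)))))))
  where
  drop : ∀ {y} → y ∈ xs → y ∈ as ++ bs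
  drop y∈xs with ∈-++⁻ as (xs⊆ys (there y∈xs))
  ... | inj₁ y∈as         = ∈-++⁺ˡ y∈as
  ... | inj₂ (here refl)  = contradiction refl (All.lookup x∉xs y∈xs)
  ... | inj₂ (there y∈bs) = ∈-++⁺ʳ as y∈bs

-- Applied once in each direction it replaces a bijection: the two injections need not be shown
-- inverse to each other.
count-≤ : ∀ {A B : Set} {P : A → Set} {Q : B → Set} (P? : U.Decidable P) (Q? : U.Decidable Q) (f : A → B) →
  (∀ {x} → P x → Q (f x)) → (∀ {x y} → P x → P y → f x ≡ f y → x ≡ y) →
  ∀ {xs ys} → Unique xs → (∀ y → y ∈ ys) → count P? xs ℕ.≤ count Q? ys
count-≤ {P = P} {Q} P? Q? f P⇒Q inj {xs} {ys} uniq complete =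
  ℕ.≤-trans (ℕ.≤-reflexive (sym (length-map f (filter P? xs))))
    (unique-⊆-length (AllPairs.map⁺ (distinct (All.all-filter P? xs) (Unique.filter⁺ P? uniq))) included)
  where
  distinct : ∀ {zs} → All P zs → Unique zs → AllPairs (λ x y → f x ≢ f y) zs
  distinct []         []           = []
  distinct (Px ∷ Pzs) (x∉zs ∷ uniq) =
    All.zipWith (λ (Py , x≢y) fx≡fy → x≢y (inj Px Py fx≡fy)) (Pzs , x∉zs) ∷ distinct Pzs uniq
  included : ∀ {y} → y ∈ map f (filter P? xs) → y ∈ filter Q? ys
  included y∈ with ∈-map⁻ f y∈
  ... | x , x∈ , refl = ∈-filter⁺ Q? (complete (f x)) (P⇒Q (proj₂ (∈-filter⁻ P? {xs = xs} x∈)))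

-- Digraphs given by their arc relation

module _ {n : ℕ} where

  arc⇒true : (D : Digraph n) → ∀ {i j} → Arc D i j → lookup (lookup D i) j ≡ true
  arc⇒true D = []=⇒lookup

  true⇒arc : (D : Digraph n) → ∀ {i j} → lookup (lookup D i) j ≡ true → Arc D i j
  true⇒arc D {i} {j} = lookup⇒[]= j (lookup D i)

  digraph : {R : Rel (Fin n) 0ℓ} → Decidable R → Digraph n
  digraph R? = tabulate λ i → tabulate λ j → does (R? i j)

  lookup-digraph : {R : Rel (Fin n) 0ℓ} (R? : Decidable R) → ∀ i j → lookup (lookup (digraph R?) i) j ≡ does (R? i j)
  lookup-digraph R? i j = trans (cong (λ row → lookup row j) (lookup∘tabulate (λ i → tabulate λ j → does (R? i j)) i))
                                (lookup∘tabulate (λ j → does (R? i j)) j)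

  digraph⁺ : {R : Rel (Fin n) 0ℓ} (R? : Decidable R) → ∀ {i j} → R i j → Arc (digraph R?) i j
  digraph⁺ R? {i} {j} Rij = true⇒arc (digraph R?) (trans (lookup-digraph R? i j) (holds (R? i j)))
    where
    holds : (d : Dec _) → does d ≡ true
    holds (yes _) = refl
    holds (no ¬R) = contradiction Rij ¬R

  digraph⁻ : {R : Rel (Fin n) 0ℓ} (R? : Decidable R) → ∀ {i j} → Arc (digraph R?) i j → R i j
  digraph⁻ {R} R? {i} {j} arc = holds (R? i j) (trans (sym (lookup-digraph R? i j)) (arc⇒true (digraph R?) arc))
    where
    holds : (d : Dec (R i j)) → does d ≡ true → R i j
    holds (yes Rij) _ = Rij

  digraph-ext : {D D′ : Digraph n} → (∀ {i j} → Arc D i j → Arc D′ i j) → (∀ {i j} → Arc D′ i j → Arc D i j) → D ≡ D′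
  digraph-ext {D} {D′} to from = vec-ext λ i → vec-ext λ j →
    bool-ext (arc⇒true D′ ∘ to ∘ true⇒arc D) (arc⇒true D ∘ from ∘ true⇒arc D′)
    where
    vec-ext : ∀ {A : Set} {m} {xs ys : Vec A m} → (∀ i → lookup xs i ≡ lookup ys i) → xs ≡ ys
    vec-ext {xs = xs} {ys} p = trans (sym (tabulate∘lookup xs)) (trans (tabulate-cong p) (tabulate∘lookup ys))
    bool-ext : ∀ {b c : Bool} → (b ≡ true → c ≡ true) → (c ≡ true → b ≡ true) → b ≡ c
    bool-ext {true}          f g = sym (f refl)
    bool-ext {false} {true}  f g = g refl
    bool-ext {false} {false} f g = refl

  isAcyclicOrientation-resp : (G H : Graph n) →
    (∀ {i j} → Graph.Adj G i j → Graph.Adj H i j) → (∀ {i j} → Graph.Adj H i j → Graph.Adj G i j) →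
    ∀ D → IsAcyclicOrientation G D → IsAcyclicOrientation H D
  isAcyclicOrientation-resp G H to from D ((sound , total) , acyclic) =
    ((λ i j arc → to (sound i j arc)) , λ i j adj → total i j (from adj)) , acyclic

  Source : Digraph n → Fin n → Set
  Source D v = ∀ u → ¬ Arc D u v

  source? : ∀ D → U.Decidable (Source D)
  source? D v = all? λ u → ¬? (arc? D u v)

-- Acyclic orientations of complete multipartite graphs on a varying vertex set

module Multipartite {n r : ℕ} (part : Fin n → Fin r) where

  -- The surviving vertices, listed by part. Deleted vertices remain in `Fin n` as isolated points,
  -- so all graphs share one vertex type.
  Family : Set
  Family = Fin r → List (Fin n)

  open import Data.List.Membership.DecPropositional (_≟ᶠ_ {n}) using () renaming (_∈?_ to _∈ˡ?_)

  infix 4 _∈ᶠ_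
  _∈ᶠ_ : Fin n → Family → Set
  x ∈ᶠ V = x ∈ V (part x)

  graph : Family → Graph n
  graph V = record
    { Adj    = λ x y → (x ∈ᶠ V × y ∈ᶠ V) × part x ≢ part y
    ; adj?   = λ x y → ((x ∈ˡ? V (part x)) ×-dec (y ∈ˡ? V (part y))) ×-dec ¬? (part x ≟ᶠ part y)
    ; symm   = λ ((x∈ , y∈) , x≁y) → (y∈ , x∈) , x≁y ∘ sym
    ; irrefl = λ { refl (_ , x≁x) → x≁x refl }
    }

  -- T lists vertices that are required not to be sources.
  Admissible : Family → List (Fin n) → Digraph n → Set
  Admissible V T D = IsAcyclicOrientation (graph V) D × All (¬_ ∘ Source D) T

  admissible? : ∀ V T → U.Decidable (Admissible V T)
  admissible? V T D = isAcyclicOrientation? (graph V) D ×-dec All.all? (λ v → ¬? (source? D v)) T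

  opaque
    # : Family → List (Fin n) → ℕ
    # V T = count (admissible? V T) (digraphs n)

  opaque
    unfolding #

    #-def : ∀ V T → # V T ≡ count (admissible? V T) (digraphs n)
    #-def V T = refl

  admissible-resp : ∀ V V′ T D → (∀ {x} → x ∈ᶠ V → x ∈ᶠ V′) → (∀ {x} → x ∈ᶠ V′ → x ∈ᶠ V) →
    Admissible V T D → Admissible V′ T D
  admissible-resp V V′ T D to from (orient , T-ok) = isAcyclicOrientation-resp (graph V) (graph V′)
    (λ ((x∈ , y∈) , x≁y) → (to x∈ , to y∈) , x≁y) (λ ((x∈ , y∈) , x≁y) → (from x∈ , from y∈) , x≁y) D orient , T-ok

  opaque
    unfolding #

    #-cong : ∀ V V′ → (∀ {x} → x ∈ᶠ V → x ∈ᶠ V′) → (∀ {x} → x ∈ᶠ V′ → x ∈ᶠ V) → ∀ T → # V T ≡ # V′ T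
    #-cong V V′ to from T = count-cong (admissible? V T) (admissible? V′ T)
      (λ {D} → admissible-resp V V′ T D to from) (λ {D} → admissible-resp V′ V T D from to) (digraphs n)

  -- At a source v all arcs are forced outwards, so orientations with source v correspond to
  -- orientations of the rest. As `T` lies in the part of v, no arc out of v enters `T`, and the
  -- condition that its vertices are not sources is the same before and after.
  module Deletion (V V′ : Family) (v : Fin n) (v∈V : v ∈ᶠ V) (T : List (Fin n)) (T~v : All (λ x → part x ≡ part v) T)
    (V⇒V′ : ∀ {x} → x ∈ᶠ V → x ≢ v → x ∈ᶠ V′) (V′⇒V : ∀ {x} → x ∈ᶠ V′ → x ∈ᶠ V × x ≢ v) where

    open Graph (graph V) using (Adj; adj?)

    remove-arc? : (D : Digraph n) → Decidable (λ i j → Arc D i j × i ≢ v)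
    remove-arc? D i j = arc? D i j ×-dec ¬? (i ≟ᶠ v)

    attach-arc? : (D : Digraph n) → Decidable (λ i j → Arc D i j ⊎ (i ≡ v × Adj v j))
    attach-arc? D i j = arc? D i j ⊎-dec ((i ≟ᶠ v) ×-dec adj? v j)

    remove attach : Digraph n → Digraph n
    remove D = digraph (remove-arc? D)
    attach D = digraph (attach-arc? D)

    closure-map : ∀ {R S : Rel (Fin n) 0ℓ} → (∀ {i j} → R i j → S i j) → ∀ {i j} → TransClosure R i j → TransClosure S i j
    closure-map R⇒S [ Rij ]       = [ R⇒S Rij ]
    closure-map R⇒S (Rij ∷ R⁺jk)  = R⇒S Rij ∷ closure-map R⇒S R⁺jk

    last-arc : ∀ {R : Rel (Fin n) 0ℓ} {i j} → TransClosure R i j → ∃[ u ] R u j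
    last-arc [ Rij ]      = _ , Rij
    last-arc (_ ∷ R⁺jk)   = last-arc R⁺jk

    remove-admissible : ∀ D → Admissible V T D × Source D v → Admissible V′ T (remove D)
    remove-admissible D ((((sound , total) , acyclic) , T-ok) , v-source) =
      ((sound′ , total′) , λ i cycle → acyclic i (closure-map (proj₁ ∘ digraph⁻ (remove-arc? D)) cycle)) ,
      All.zipWith not-source (T-ok , T~v)
      where
      sound′ : ∀ i j → Arc (remove D) i j → Graph.Adj (graph V′) i j
      sound′ i j arc with digraph⁻ (remove-arc? D) arc
      ... | ij , i≢v with sound i j ij
      ... | (i∈V , j∈V) , i≁j = (V⇒V′ i∈V i≢v , V⇒V′ j∈V (λ { refl → v-source i ij })) , i≁j
      total′ : ∀ i j → Graph.Adj (graph V′) i j →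
        (Arc (remove D) i j ⊎ Arc (remove D) j i) × ¬ (Arc (remove D) i j × Arc (remove D) j i)
      total′ i j ((i∈V′ , j∈V′) , i≁j) with V′⇒V i∈V′ | V′⇒V j∈V′
      ... | i∈V , i≢v | j∈V , j≢v with total i j ((i∈V , j∈V) , i≁j)
      ... | one , not-both =
        [ (λ ij → inj₁ (digraph⁺ (remove-arc? D) (ij , i≢v))) , (λ ji → inj₂ (digraph⁺ (remove-arc? D) (ji , j≢v))) ]′ one ,
        λ (ij , ji) → not-both (proj₁ (digraph⁻ (remove-arc? D) ij) , proj₁ (digraph⁻ (remove-arc? D) ji))
      not-source : ∀ {x} → ¬ Source D x × part x ≡ part v → ¬ Source (remove D) x
      not-source {x} (¬source , x~v) source = ¬source λ u ux →
        source u (digraph⁺ (remove-arc? D) (ux , λ { refl → proj₂ (sound v x ux) (sym x~v) }))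

    v∉V′ : ¬ v ∈ᶠ V′
    v∉V′ v∈V′ = proj₂ (V′⇒V v∈V′) refl

    attach-source : ∀ D → Admissible V′ T D → Source (attach D) v
    attach-source D (((sound , _) , _) , _) u arc with digraph⁻ (attach-arc? D) arc
    ... | inj₁ uv            = v∉V′ (proj₂ (proj₁ (sound u v uv)))
    ... | inj₂ (_ , _ , v≁v) = v≁v refl

    attach-admissible : ∀ D → Admissible V′ T D → Admissible V T (attach D) × Source (attach D) v
    attach-admissible D ok@(((sound , total) , acyclic) , T-ok) =
      (((sound′ , total′) , acyclic′) ,
       All.map (λ ¬source source → ¬source λ u ux → source u (digraph⁺ (attach-arc? D) (inj₁ ux))) T-ok) , v-source
      where
      v-source = attach-source D ok
      old : ∀ {i j} → i ≢ v → Arc (attach D) i j → Arc D i j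
      old i≢v arc with digraph⁻ (attach-arc? D) arc
      ... | inj₁ ij        = ij
      ... | inj₂ (i≡v , _) = contradiction i≡v i≢v
      sound′ : ∀ i j → Arc (attach D) i j → Adj i j
      sound′ i j arc with digraph⁻ (attach-arc? D) arc
      ... | inj₂ (refl , adj) = adj
      ... | inj₁ ij with sound i j ij
      ... | (i∈V′ , j∈V′) , i≁j = (proj₁ (V′⇒V i∈V′) , proj₁ (V′⇒V j∈V′)) , i≁j
      total′ : ∀ i j → Adj i j → (Arc (attach D) i j ⊎ Arc (attach D) j i) × ¬ (Arc (attach D) i j × Arc (attach D) j i)
      total′ i j adj@((i∈V , j∈V) , i≁j) with i ≟ᶠ v | j ≟ᶠ v
      ... | yes refl | _        = inj₁ (digraph⁺ (attach-arc? D) (inj₂ (refl , adj))) , λ (_ , jv) → v-source j jv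
      ... | no _     | yes refl = inj₂ (digraph⁺ (attach-arc? D) (inj₂ (refl , (j∈V , i∈V) , i≁j ∘ sym))) , λ (iv , _) → v-source i iv
      ... | no i≢v   | no j≢v with total i j ((V⇒V′ i∈V i≢v , V⇒V′ j∈V j≢v) , i≁j)
      ... | one , not-both =
        [ inj₁ ∘ digraph⁺ (attach-arc? D) ∘ inj₁ , inj₂ ∘ digraph⁺ (attach-arc? D) ∘ inj₁ ]′ one ,
        λ (ij , ji) → not-both (old i≢v ij , old j≢v ji)
      -- A walk that starts away from v never visits v, which has no incoming arc, and so uses old
      -- arcs only.
      walk : ∀ {i j} → i ≢ v → TransClosure (Arc (attach D)) i j → TransClosure (Arc D) i j
      walk i≢v [ ij ]      = [ old i≢v ij ]
      walk i≢v (ij ∷ j⁺k)  = old i≢v ij ∷ walk (λ { refl → v-source _ ij }) j⁺k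
      acyclic′ : Acyclic (attach D)
      acyclic′ i cycle with i ≟ᶠ v
      ... | yes refl = let u , uv = last-arc cycle in v-source u uv
      ... | no  i≢v  = acyclic i (walk i≢v cycle)

    remove-injective : ∀ D D′ → Admissible V T D × Source D v → Admissible V T D′ × Source D′ v → remove D ≡ remove D′ → D ≡ D′
    remove-injective D D′ ok ok′ eq = digraph-ext (half D D′ ok ok′ eq) (half D′ D ok′ ok (sym eq))
      where
      half : ∀ D D′ → Admissible V T D × Source D v → Admissible V T D′ × Source D′ v → remove D ≡ remove D′ →
             ∀ {i j} → Arc D i j → Arc D′ i j
      half D D′ ((((sound , _) , _) , _) , _) ((((_ , total) , _) , _) , v-source) eq {i} {j} ij with i ≟ᶠ v
      ... | no  i≢v  = proj₁ (digraph⁻ (remove-arc? D′) (subst (λ E → Arc E i j) eq (digraph⁺ (remove-arc? D) (ij , i≢v))))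
      -- Arcs at v are not recorded by `remove`, but adjacency and the source condition in `D′`
      -- force their direction.
      ... | yes refl = [ id , (λ jv → contradiction jv (v-source j)) ]′ (proj₁ (total v j (sound v j ij)))

    attach-injective : ∀ D D′ → Admissible V′ T D → Admissible V′ T D′ → attach D ≡ attach D′ → D ≡ D′
    attach-injective D D′ ok ok′ eq = digraph-ext (half D D′ ok eq) (half D′ D ok′ (sym eq))
      where
      half : ∀ D D′ → Admissible V′ T D → attach D ≡ attach D′ → ∀ {i j} → Arc D i j → Arc D′ i j
      half D D′ (((sound , _) , _) , _) eq {i} {j} ij
        with digraph⁻ (attach-arc? D′) (subst (λ E → Arc E i j) eq (digraph⁺ (attach-arc? D) (inj₁ ij)))
      ... | inj₁ ij′        = ij′
      ... | inj₂ (refl , _) = contradiction (proj₁ (proj₁ (sound v j ij))) v∉V′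

    opaque
      unfolding #

      #-deletion : # V T ≡ # V (v ∷ T) ℕ.+ # V′ T
      #-deletion = trans (count-split (admissible? V T) (λ D → source? D v) (digraphs n)) (cong₂ ℕ._+_
        (count-cong _ (admissible? V (v ∷ T)) (λ ((orient , T-ok) , ¬source) → orient , ¬source ∷ T-ok)
                                              (λ { (orient , ¬source ∷ T-ok) → (orient , T-ok) , ¬source }) (digraphs n))
        (ℕ.≤-antisym
          (count-≤ source-at-v? (admissible? V′ T) remove (λ {D} → remove-admissible D) (λ {D} {D′} → remove-injective D D′) (digraphs-unique n) digraphs-complete)
          (count-≤ (admissible? V′ T) source-at-v? attach (λ {D} → attach-admissible D) (λ {D} {D′} → attach-injective D D′) (digraphs-unique n) digraphs-complete)))
        where
        source-at-v? : U.Decidable (λ D → Admissible V T D × Source D v)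
        source-at-v? D = admissible? V T D ×-dec source? D v

  -- The empty graph and the location of sources

  opaque
    unfolding #

    #-empty : ∀ {V} → (∀ x → ¬ x ∈ᶠ V) → # V [] ≡ 1
    #-empty {V} empty = ℕ.≤-antisym
      (unique-⊆-length {ys = E ∷ []} (Unique.filter⁺ (admissible? V []) (digraphs-unique n))
        (λ {D} D∈ → here (only D (proj₂ (∈-filter⁻ (admissible? V []) {xs = digraphs n} D∈)))))
      (unique-⊆-length {xs = E ∷ []} ([] ∷ []) λ { (here refl) → ∈-filter⁺ (admissible? V []) (digraphs-complete E) E-ok })
      where
      none? : Decidable {A = Fin n} {B = Fin n} (λ _ _ → ⊥)
      none? _ _ = no id
      E : Digraph n
      E = digraph none?
      E-ok : Admissible V [] E
      E-ok = (((λ i j arc → ⊥-elim (digraph⁻ none? arc)) , λ i j adj → contradiction (proj₁ (proj₁ adj)) (empty i)) ,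
              λ i cycle → no-walk cycle) , []
        where
        no-walk : ∀ {i j} → ¬ TransClosure (Arc E) i j
        no-walk [ arc ]   = digraph⁻ none? arc
        no-walk (arc ∷ _) = digraph⁻ none? arc
      only : ∀ D → Admissible V [] D → D ≡ E
      only D (((sound , _) , _) , _) = digraph-ext
        (λ {i} {j} arc → contradiction (proj₁ (proj₁ (sound i j arc))) (empty i)) (⊥-elim ∘ digraph⁻ none?)

  -- Acyclicity makes reachability a strict order on a finite set, hence well-founded. Going back
  -- along arcs therefore ends, and it stays inside `V` because arcs join vertices of `V`.
  find-source : ∀ V D → IsAcyclicOrientation (graph V) D → ∀ {x} → x ∈ᶠ V → ∃[ y ] y ∈ᶠ V × Source D y
  find-source V D ((sound , _) , acyclic) {x} x∈V = go (spo-wellFounded spo x) x∈V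
    where
    spo : IsStrictPartialOrder _≡_ (TransClosure (Arc D))
    spo = record
      { isEquivalence = isEquivalence
      ; irrefl        = λ { refl → acyclic _ }
      ; trans         = _++⁺_
      ; <-resp-≈      = (λ { refl → id }) , (λ { refl → id })
      }
    go : ∀ {x} → Acc (TransClosure (Arc D)) x → x ∈ᶠ V → ∃[ y ] y ∈ᶠ V × Source D y
    go {x} (acc rec) x∈V with any? (λ u → arc? D u x)
    ... | no  none     = x , x∈V , λ u ux → none (u , ux)
    ... | yes (u , ux) = go (rec [ ux ]) (proj₁ (proj₁ (sound u x ux)))

  -- All sources of an acyclic orientation lie in a single part.
  opaque
    unfolding #

    #-sources : ∀ {V} → (∀ {i x} → x ∈ V i → part x ≡ i) → ∀ {x} → x ∈ᶠ V →
      ∃[ κ ] (∀ i → # V [] ≡ # V (V i) ℕ.+ κ i) × # V [] ≡ size κ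
    #-sources {V} parts x∈V = κ , split , count-partition (admissible? V []) source-in? (λ {D} → exactly-one D) (digraphs n)
      where
      source-in? : ∀ i → U.Decidable (λ D → Any (Source D) (V i))
      source-in? i D = Any.any? (source? D) (V i)
      -- The orientations with a source in part i, the complement of those with all of `V i`
      -- forbidden as sources.
      κ : Fin r → ℕ
      κ i = count (λ D → admissible? V [] D ×-dec source-in? i D) (digraphs n)
      split : ∀ i → # V [] ≡ # V (V i) ℕ.+ κ i
      split i = trans (count-split (admissible? V []) (source-in? i) (digraphs n)) (cong (ℕ._+ κ i)
        (count-cong _ (admissible? V (V i)) (λ ((orient , _) , ¬any) → orient , All.¬Any⇒All¬ (V i) ¬any)
                                            (λ (orient , all) → (orient , []) , All.All¬⇒¬Any all) (digraphs n)))
      exactly-one : ∀ D → Admissible V [] D → ∃[ i ] Any (Source D) (V i) × (∀ j → Any (Source D) (V j) → j ≡ i)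
      exactly-one D (orient@((_ , total) , _) , _) with find-source V D orient x∈V
      ... | y , y∈V , y-source = part y , Any.map (λ { refl → y-source }) y∈V , same
        where
        same : ∀ j → Any (Source D) (V j) → j ≡ part y
        same j any with find any
        ... | w , w∈ , w-source with parts w∈
        ... | refl with part w ≟ᶠ part y
        ... | yes eq = eq
        -- Sources in different parts would be adjacent, and the arc between them would enter one of
        -- them.
        ... | no  w≁y = [ (λ wy → contradiction wy (y-source w)) , (λ yw → contradiction yw (w-source y)) ]′
                          (proj₁ (total w y ((w∈ , y∈V) , w≁y)))

module Enumeration where
  open import Data.Rational using (_+_; _*_; _-_; -_; ∣_∣; _≤_; _<_)
  open ℚ.≤-Reasoning

  -- The signed Stirling series  q n = Σ_i (−1)^i S(n, n − i) z^i

  -- Series are read as polynomials homogenised to degree n: the coefficient of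
  -- z^i stands for that of t^(n − i), so that ∂ n is d/dt.
  ∂ θ : ℕ → Series → Series
  ∂ n f = z· (weight (ι n) f)
  θ n f m = f m - ∂ n f m

  ∂-cong : ∀ n {f g} → f ≗ g → ∂ n f ≗ ∂ n g
  ∂-cong n p = z·-cong (λ m → cong ((ι n - ι m) *_) (p m))

  θ-cong : ∀ n {f g} → f ≗ g → θ n f ≗ θ n g
  θ-cong n p m = cong₂ _-_ (p m) (∂-cong n p m)

  -- With P_n(t) = t^n q_n(1/t) the Stirling recurrence reads P_(n+1) = t (P_n - P_n′). The factor t
  -- raises the degree and leaves the coefficient series unchanged, so only `θ` is visible.
  q : ℕ → Series
  q zero    = one
  q (suc n) = θ n (q n)

  -- The analogue of Aitken's array of differences of Bell numbers.
  triangle : ℕ → ℕ → Series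
  triangle j zero    = q j
  triangle j (suc t) = θ (suc (j ℕ.+ t)) (triangle j t)

  θ-suc : ∀ n f → θ (suc n) f ≗ λ m → θ n f m - z· f m
  θ-suc n f zero    = identity (f 0)
    where
    identity : ∀ x → x - 0ℚ ≡ x - 0ℚ - 0ℚ
    identity = solve-∀ ℚ-ring
  θ-suc n f (suc m) = trans (cong (λ i → f (suc m) - (i - ι m) * f m) (ι-suc n)) (identity (f (suc m)) (ι n) (ι m) (f m))
    where
    identity : ∀ x n i y → x - (1ℚ + n - i) * y ≡ x - (n - i) * y - y
    identity = solve-∀ ℚ-ring

  θ-z· : ∀ n f → θ (suc n) (z· f) ≗ z· (θ n f)
  θ-z· n f zero          = refl
  θ-z· n f (suc zero)    = cong (λ t → f 0 - t) (ℚ.*-zeroʳ (ι (suc n) - ι 0))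
  θ-z· n f (suc (suc m)) = trans (cong₂ (λ i j → f (suc m) - (i - j) * f m) (ι-suc n) (ι-suc m))
                                 (identity (f (suc m)) (ι n) (ι m) (f m))
    where
    identity : ∀ x n i y → x - (1ℚ + n - (1ℚ + i)) * y ≡ x - (n - i) * y
    identity = solve-∀ ℚ-ring

  θ-sub : ∀ n f g → θ n (λ m → f m - g m) ≗ λ m → θ n f m - θ n g m
  θ-sub n f g zero    = identity (f 0) (g 0)
    where
    identity : ∀ a b → a - b - 0ℚ ≡ a - 0ℚ - (b - 0ℚ)
    identity = solve-∀ ℚ-ring
  θ-sub n f g (suc m) = identity (f (suc m)) (g (suc m)) (ι n - ι m) (f m) (g m)
    where
    identity : ∀ a b c x y → a - b - c * (x - y) ≡ a - c * x - (b - c * y)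
    identity = solve-∀ ℚ-ring

  -- The polynomial of `triangle j t` is ((1 - D) t)^t P_j, the exponent being the index and the
  -- base containing the variable. The claim is (1 - D) t = t (1 - D) - 1 applied to P_j, followed
  -- by further factors; `z·` aligns the degrees.
  triangle-step : ∀ j t → triangle j (suc t) ≗ λ m → triangle (suc j) t m - z· (triangle j t) m
  triangle-step j zero    m = trans (cong (λ n → θ (suc n) (q j) m) (ℕ.+-identityʳ j)) (θ-suc j (q j) m)
  triangle-step j (suc t) m = begin-equality
    θ (suc (j ℕ.+ suc t)) (triangle j (suc t)) m
      ≡⟨ θ-cong (suc (j ℕ.+ suc t)) (triangle-step j t) m ⟩
    θ (suc (j ℕ.+ suc t)) (λ m → triangle (suc j) t m - z· (triangle j t) m) m
      ≡⟨ θ-sub (suc (j ℕ.+ suc t)) (triangle (suc j) t) (z· (triangle j t)) m ⟩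
    θ (suc (j ℕ.+ suc t)) (triangle (suc j) t) m - θ (suc (j ℕ.+ suc t)) (z· (triangle j t)) m
      ≡⟨ cong₂ _-_ (cong (λ n → θ (suc n) (triangle (suc j) t) m) (ℕ.+-suc j t))
                   (trans (θ-z· (j ℕ.+ suc t) (triangle j t) m)
                          (cong (λ n → z· (θ n (triangle j t)) m) (ℕ.+-suc j t))) ⟩
    triangle (suc j) (suc t) m - z· (triangle j (suc t)) m ∎

  -- Regrouping of factors: t ((1 - D) t)^n = (t (1 - D))^n t, and t = t (1 - D) 1. Hence a part of
  -- size n without sources contributes q_(n+1), which closes the recursion.
  triangle-row₀ : ∀ t → triangle 0 t ≗ q (suc t)
  triangle-row₀ zero    zero          = refl
  triangle-row₀ zero    (suc zero)    = refl
  triangle-row₀ zero    (suc (suc m)) = sym (cong (λ x → 0ℚ - x) (ℚ.*-zeroʳ (ι 0 - ι (suc m))))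
  triangle-row₀ (suc t) m             = θ-cong (suc t) (triangle-row₀ t) m

  q-∂ : ∀ n → (λ m → q n m - q (suc n) m) ≗ ∂ n (q n)
  q-∂ n m = identity (q n m) (∂ n (q n) m)
    where
    identity : ∀ a b → a - (a - b) ≡ b
    identity = solve-∀ ℚ-ring

  q₀≡1 : ∀ n → q n 0 ≡ 1ℚ
  q₀≡1 zero    = refl
  q₀≡1 (suc n) = trans (ℚ.+-identityʳ (q n 0)) (q₀≡1 n)

  θ-vanishes : ∀ n {f} → VanishesBeyond n f → VanishesBeyond (suc n) (θ (suc n) f)
  θ-vanishes n {f} f-van (suc j) (ℕ.s≤s n<j) with suc n ℕ.≟ j
  ... | yes refl = trans (cong₂ (λ x y → x - y * f (suc n))
                     (f-van (suc (suc n)) (ℕ.m≤n⇒m≤1+n ℕ.≤-refl)) (ℚ.+-inverseʳ (ι (suc n))))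
                   (cong (λ x → 0ℚ - x) (ℚ.*-zeroˡ (f (suc n))))
  ... | no  n≢j  = trans (cong₂ (λ x y → x - (ι (suc n) - ι j) * y)
                     (f-van (suc j) (ℕ.m≤n⇒m≤1+n n<j)) (f-van j n<j))
                   (cong (λ x → 0ℚ - x) (ℚ.*-zeroʳ (ι (suc n) - ι j)))

  -- S(n, 0) = 0 for n ≥ 1, that is P_n(0) = 0. This removes the boundary term of the integration by
  -- parts, and it bounds the degree of q_k^r by (k - 1) r.
  q-vanishes : ∀ n → VanishesBeyond (n ℕ.∸ 1) (q n)
  q-vanishes zero          = one-vanishes
  q-vanishes (suc zero)    = λ m 0<m → trans (sym (triangle-row₀ 0 m)) (one-vanishes m 0<m)
  q-vanishes (suc (suc n)) = θ-vanishes n (q-vanishes (suc n))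

  q-expBounded : ∀ n → ExpBounded (q n)
  q-expBounded zero    = expBounded 0ℚ 1ℚ ℚ.≤-refl 0≤1 λ
    { zero    → ℚ.≤-refl
    ; (suc m) → 0≤* 0≤1 (0≤term ℚ.≤-refl (suc m)) }
  q-expBounded (suc n) = expBounded-cong (λ m → identity₁ (q n m) (∂ n (q n) m))
    (+-expBounded (q-expBounded n) (·-expBounded (- 1ℚ) (z·-expBounded
      (expBounded-cong (λ m → identity₂ (ι n) (q n m) (ι m))
        (+-expBounded (·-expBounded (ι n) (q-expBounded n)) (·-expBounded (- 1ℚ) (ι·-expBounded (q-expBounded n))))))))
    where
    identity₁ : ∀ x y → x + - 1ℚ * y ≡ x - y
    identity₁ = solve-∀ ℚ-ring
    identity₂ : ∀ n x i → n * x + - 1ℚ * (i * x) ≡ (n - i) * x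
    identity₂ = solve-∀ ℚ-ring

  -- The functional t^n ↦ n! on polynomials of degree n

  opaque
    L : ℕ → Series → ℚ
    L n f = conv f fact n

    L-def : ∀ n f → L n f ≡ conv f fact n
    L-def n f = refl

    L-cong : ∀ n {f g} → f ≗ g → L n f ≡ L n g
    L-cong n p = conv-cong p (λ _ → refl) n

    L-sub : ∀ n f g → L n (λ m → f m - g m) ≡ L n f - L n g
    L-sub n f g = trans (L-cong n (λ m → cong (f m +_) (neg≡-1* (g m))))
      (trans (conv-+ˡ f (λ m → - 1ℚ * g m) fact n) (trans (cong (L n f +_) (conv-·ˡ (- 1ℚ) g fact n)) (cong (L n f +_) (sym (neg≡-1* (L n g))))))

    -- Raising the homogenising degree does not change the polynomial in t.
    L-z· : ∀ n f → L (suc n) (z· f) ≡ L n f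
    L-z· n f = conv-z·ˡ f fact (suc n)

  opaque
    unfolding L

    -- ∫ f e^(−t) = ∫ f′ e^(−t) + f(0), by parts.
    L-∂ : ∀ n f → L n f ≡ L n (∂ n f) + f n
    L-∂ zero    f = identity (f 0)
      where
      identity : ∀ x → x * 1ℚ ≡ 0ℚ * 1ℚ + x
      identity = solve-∀ ℚ-ring
    L-∂ (suc n) f = trans (lemma n f) (cong (_+ f (suc n)) (sym (L-z· n (weight (ι (suc n)) f))))
      where
      lemma : ∀ n f → conv f fact (suc n) ≡ conv (weight (ι (suc n)) f) fact n + f (suc n)
      lemma zero    f = identity (f 0) (f 1)
        where
        identity : ∀ x y → x * 1ℚ + y * 1ℚ ≡ (1ℚ - 0ℚ) * x * 1ℚ + y
        identity = solve-∀ ℚ-ring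
      lemma (suc n) f = begin-equality
        f 0 * fact (2 ℕ.+ n) + conv (f ∘ suc) fact (suc n)
          ≡⟨ cong₂ (λ s t → f 0 * s + t) (ι-* (2 ℕ.+ n) (suc n !)) (lemma n (f ∘ suc)) ⟩
        f 0 * (k * fact (suc n)) + (conv (weight (ι (suc n)) (f ∘ suc)) fact n + f (2 ℕ.+ n))
          ≡⟨ cong (λ t → f 0 * (k * fact (suc n)) + (t + f (2 ℕ.+ n))) (conv-cong {g = fact} shifted (λ _ → refl) n) ⟩
        f 0 * (k * fact (suc n)) + (conv (weight k f ∘ suc) fact n + f (2 ℕ.+ n))
          ≡⟨ identity (f 0) k (fact (suc n)) (conv (weight k f ∘ suc) fact n) (f (2 ℕ.+ n)) ⟩
        (k - 0ℚ) * f 0 * fact (suc n) + conv (weight k f ∘ suc) fact n + f (2 ℕ.+ n) ∎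
        where
        k : ℚ
        k = ι (2 ℕ.+ n)
        identity : ∀ x k u w y → x * (k * u) + (w + y) ≡ (k - 0ℚ) * x * u + w + y
        identity = solve-∀ ℚ-ring
        identity₂ : ∀ n → n ≡ 1ℚ + n - 1ℚ
        identity₂ = solve-∀ ℚ-ring
        shifted : weight (ι (suc n)) (f ∘ suc) ≗ weight k f ∘ suc
        shifted i = trans (cong (λ t → (t - ι i) * f (suc i)) (trans (identity₂ (ι (suc n))) (cong (_- 1ℚ) (sym (ι-suc (suc n))))))
                          (sym (weight-suc k f i))

  -- Products indexed by Fin r

  infix 10 _[_]≔_
  _[_]≔_ : ∀ {A : Set} {r} → (Fin r → A) → Fin r → A → Fin r → A
  F [ i ]≔ x = updateAt F i (λ _ → x)

  ∑ : ∀ {r} → (Fin r → ℚ) → ℚ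
  ∑ {zero}  F = 0ℚ
  ∑ {suc r} F = F zero + ∑ (F ∘ suc)

  ∑-cong : ∀ {r} {F G : Fin r → ℚ} → (∀ i → F i ≡ G i) → ∑ F ≡ ∑ G
  ∑-cong {zero}  p = refl
  ∑-cong {suc r} p = cong₂ _+_ (p zero) (∑-cong (p ∘ suc))

  ∏ : ∀ {r} → (Fin r → Series) → Series
  ∏ {zero}  F = one
  ∏ {suc r} F = conv (F zero) (∏ (F ∘ suc))

  ∏-cong : ∀ {r} {F G : Fin r → Series} → (∀ i → F i ≗ G i) → ∏ F ≗ ∏ G
  ∏-cong {zero}  p m = refl
  ∏-cong {suc r} p   = conv-cong (p zero) (∏-cong (p ∘ suc))

  ∏-slot-cong : ∀ {r} (F : Fin r → Series) i {f g} → f ≗ g → ∏ (F [ i ]≔ f) ≗ ∏ (F [ i ]≔ g)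
  ∏-slot-cong F zero    p = conv-cong p (λ _ → refl)
  ∏-slot-cong F (suc i) p = conv-cong {f = F zero} (λ _ → refl) (∏-slot-cong (F ∘ suc) i p)

  ∏-slot-sub : ∀ {r} (F : Fin r → Series) i f g →
    ∏ (F [ i ]≔ (λ m → f m - g m)) ≗ λ m → ∏ (F [ i ]≔ f) m - ∏ (F [ i ]≔ g) m
  ∏-slot-sub F zero    f g m = trans (conv-cong {g = P} (λ m → cong (f m +_) (neg≡-1* (g m))) (λ _ → refl) m)
    (trans (conv-+ˡ f (λ m → - 1ℚ * g m) P m)
    (cong (conv f P m +_) (trans (conv-·ˡ (- 1ℚ) g P m) (sym (neg≡-1* (conv g P m))))))
    where
    P = ∏ (F ∘ suc)
  ∏-slot-sub F (suc i) f g m = trans (conv-cong {f = F zero} (λ _ → refl)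
      (λ m → trans (∏-slot-sub (F ∘ suc) i f g m) (cong (P m +_) (neg≡-1* (R m)))) m)
    (trans (conv-+ʳ (F zero) P (λ m → - 1ℚ * R m) m)
    (cong (conv (F zero) P m +_) (trans (conv-·ʳ (- 1ℚ) (F zero) R m) (sym (neg≡-1* (conv (F zero) R m))))))
    where
    P = ∏ ((F ∘ suc) [ i ]≔ f)
    R = ∏ ((F ∘ suc) [ i ]≔ g)

  ∏-slot-z· : ∀ {r} (F : Fin r → Series) i f → ∏ (F [ i ]≔ z· f) ≗ z· (∏ (F [ i ]≔ f))
  ∏-slot-z· F zero    f m = conv-z·ˡ f (∏ (F ∘ suc)) m
  ∏-slot-z· F (suc i) f m = trans (conv-cong {f = F zero} (λ _ → refl) (∏-slot-z· (F ∘ suc) i f) m)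
                                  (conv-z·ʳ (F zero) (∏ ((F ∘ suc) [ i ]≔ f)) m)

  conv-∑ : ∀ {r} f (G : Fin r → Series) → conv f (λ m → ∑ (λ i → G i m)) ≗ λ m → ∑ (λ i → conv f (G i) m)
  conv-∑ {zero}  f G m = trans (conv-cong {f = f} (λ _ → refl) (λ _ → sym (ℚ.*-zeroˡ 1ℚ)) m)
    (trans (conv-·ʳ 0ℚ f (λ _ → 1ℚ) m) (ℚ.*-zeroˡ (conv f (λ _ → 1ℚ) m)))
  conv-∑ {suc r} f G m = trans (conv-+ʳ f (G zero) (λ m → ∑ (λ i → G (suc i) m)) m)
    (cong (conv f (G zero) m +_) (conv-∑ f (G ∘ suc) m))

  ∑-conv : ∀ {r} (G : Fin r → Series) g → conv (λ m → ∑ (λ i → G i m)) g ≗ λ m → ∑ (λ i → conv (G i) g m)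
  ∑-conv {zero}  G g m = trans (conv-cong {g = g} (λ _ → sym (ℚ.*-zeroˡ 1ℚ)) (λ _ → refl) m)
    (trans (conv-·ˡ 0ℚ (λ _ → 1ℚ) g m) (ℚ.*-zeroˡ (conv (λ _ → 1ℚ) g m)))
  ∑-conv {suc r} G g m = trans (conv-+ˡ (G zero) (λ m → ∑ (λ i → G (suc i) m)) g m)
    (cong (conv (G zero) g m +_) (∑-conv (G ∘ suc) g m))

  -- The product rule for d/dt; the homogenising degrees add up to `size κ`, as `weight-conv`
  -- requires.
  ∂-∏ : ∀ {r} (κ : Fin r → ℕ) (F : Fin r → Series) →
    ∂ (size κ) (∏ F) ≗ λ m → ∑ (λ i → ∏ (F [ i ]≔ ∂ (κ i) (F i)) m)
  ∂-∏ {zero}  κ F zero          = refl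
  ∂-∏ {zero}  κ F (suc zero)    = refl
  ∂-∏ {zero}  κ F (suc (suc m)) = ℚ.*-zeroʳ (ι 0 - ι (suc m))
  ∂-∏ {suc r} κ F m = begin-equality
    z· (weight (ι (κ zero ℕ.+ K)) (conv f P)) m
      ≡⟨ z·-cong (λ j → trans (cong (λ c → weight c (conv f P) j) (ι-+ (κ zero) K)) (weight-conv (ι (κ zero)) (ι K) f P j)) m ⟩
    z· (λ j → conv (weight (ι (κ zero)) f) P j + conv f (weight (ι K) P) j) m
      ≡⟨ shift-+ 1 (conv (weight (ι (κ zero)) f) P) (conv f (weight (ι K) P)) m ⟩
    z· (conv (weight (ι (κ zero)) f) P) m + z· (conv f (weight (ι K) P)) m
      ≡⟨ cong₂ _+_ (sym (conv-z·ˡ (weight (ι (κ zero)) f) P m))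
           (trans (sym (conv-z·ʳ f (weight (ι K) P) m))
           (trans (conv-cong {f = f} (λ _ → refl) (∂-∏ (κ ∘ suc) (F ∘ suc)) m)
                  (conv-∑ f (λ i → ∏ ((F ∘ suc) [ i ]≔ ∂ (κ (suc i)) (F (suc i)))) m))) ⟩
    ∑ (λ i → ∏ (F [ i ]≔ ∂ (κ i) (F i)) m) ∎
    where
    K = size (κ ∘ suc)
    f = F zero
    P = ∏ (F ∘ suc)

  ∏-vanishes : ∀ {r} (δ : Fin r → ℕ) (F : Fin r → Series) →
    (∀ i → VanishesBeyond (δ i) (F i)) → VanishesBeyond (size δ) (∏ F)
  ∏-vanishes {zero}  δ F van = one-vanishes
  ∏-vanishes {suc r} δ F van = conv-vanishes (δ zero) (size (δ ∘ suc)) (van zero) (∏-vanishes (δ ∘ suc) (F ∘ suc) (van ∘ suc))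

  ∏₀≡1 : ∀ {r} (F : Fin r → Series) → (∀ i → F i 0 ≡ 1ℚ) → ∏ F 0 ≡ 1ℚ
  ∏₀≡1 {zero}  F p = refl
  ∏₀≡1 {suc r} F p = trans (cong₂ _*_ (p zero) (∏₀≡1 (F ∘ suc) (p ∘ suc))) (ℚ.*-identityˡ 1ℚ)

  size-∸ : ∀ {r} (κ : Fin r → ℕ) → size (λ i → κ i ℕ.∸ 1) ℕ.≤ size κ
  size-∸ {zero}  κ = ℕ.z≤n
  size-∸ {suc r} κ = ℕ.+-mono-≤ (ℕ.m∸n≤m (κ zero) 1) (size-∸ (κ ∘ suc))

  size-∸-< : ∀ {r} (κ : Fin r → ℕ) → 0 ℕ.< size κ → size (λ i → κ i ℕ.∸ 1) ℕ.< size κ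
  size-∸-< {suc r} κ 0<size with κ zero
  ... | zero  = size-∸-< (κ ∘ suc) 0<size
  ... | suc n = ℕ.s≤s (ℕ.+-monoʳ-≤ n (size-∸ (κ ∘ suc)))

  opaque
    unfolding L

    -- Integration by parts and the product rule, with P_n′ written as q_n - q_(n+1). The boundary
    -- value is 0, since a nonempty part puts a factor t into the product.
    L-∏-q : ∀ {r} (κ : Fin r → ℕ) → 0 ℕ.< size κ →
      L (size κ) (∏ (q ∘ κ)) ≡ ∑ (λ i → L (size κ) (∏ ((q ∘ κ) [ i ]≔ q (κ i))) - L (size κ) (∏ ((q ∘ κ) [ i ]≔ q (suc (κ i)))))
    L-∏-q κ 0<size = begin-equality
      L n P
        ≡⟨ L-∂ n P ⟩
      L n (∂ n P) + P n
        ≡⟨ cong₂ _+_ (trans (L-cong n (∂-∏ κ (q ∘ κ))) (∑-conv (λ i → ∏ ((q ∘ κ) [ i ]≔ ∂ (κ i) (q (κ i)))) fact n))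
             (∏-vanishes (λ i → κ i ℕ.∸ 1) (q ∘ κ) (q-vanishes ∘ κ) n (size-∸-< κ 0<size)) ⟩
      ∑ (λ i → L n (∏ ((q ∘ κ) [ i ]≔ ∂ (κ i) (q (κ i))))) + 0ℚ
        ≡⟨ ℚ.+-identityʳ _ ⟩
      ∑ (λ i → L n (∏ ((q ∘ κ) [ i ]≔ ∂ (κ i) (q (κ i)))))
        ≡⟨ ∑-cong (λ i → trans (L-cong n (λ m → trans (sym (∏-slot-cong (q ∘ κ) i (q-∂ (κ i)) m))
                                                      (∏-slot-sub (q ∘ κ) i (q (κ i)) (q (suc (κ i))) m)))
                               (L-sub n (∏ ((q ∘ κ) [ i ]≔ q (κ i))) (∏ ((q ∘ κ) [ i ]≔ q (suc (κ i)))))) ⟩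
      ∑ (λ i → L n (∏ ((q ∘ κ) [ i ]≔ q (κ i))) - L n (∏ ((q ∘ κ) [ i ]≔ q (suc (κ i))))) ∎
      where
      n : ℕ
      n = size κ
      P : Series
      P = ∏ (q ∘ κ)

  -- The number of acyclic orientations as a functional of Stirling series

  size-set-∷ : ∀ {A : Set} {r} (U : Fin r → List A) i v ys →
    size (length ∘ U [ i ]≔ (v ∷ ys)) ≡ suc (size (length ∘ U [ i ]≔ ys))
  size-set-∷ U zero    v ys = refl
  size-set-∷ U (suc i) v ys = trans (cong (length (U zero) ℕ.+_) (size-set-∷ (U ∘ suc) i v ys)) (ℕ.+-suc (length (U zero)) _)

  ∑-ι : ∀ {r} (κ : Fin r → ℕ) → ι (size κ) ≡ ∑ (ι ∘ κ)
  ∑-ι {zero}  κ = refl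
  ∑-ι {suc r} κ = trans (ι-+ (κ zero) (size (κ ∘ suc))) (cong (ι (κ zero) +_) (∑-ι (κ ∘ suc)))

  unique-insert : ∀ {A : Set} {v : A} T {X} → Unique (v ∷ T ++ X) → Unique (T ++ v ∷ X)
  unique-insert []      uniq = uniq
  unique-insert {v = v} (t ∷ T) {X} ((v≢t ∷ v∉) ∷ (t∉ ∷ uniq)) =
    All.++⁺ (All.++⁻ˡ T t∉) ((λ { refl → v≢t refl }) ∷ All.++⁻ʳ T t∉) ∷ unique-insert T (v∉ ∷ uniq)

  insert-⊆ : ∀ {A : Set} {v : A} T {X x} → x ∈ T ++ v ∷ X → x ∈ v ∷ T ++ X
  insert-⊆ T x∈ with ∈-++⁻ T x∈
  ... | inj₁ x∈T         = there (∈-++⁺ˡ x∈T)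
  ... | inj₂ (here refl) = here refl
  ... | inj₂ (there x∈X) = there (∈-++⁺ʳ T x∈X)

  insert-⊇ : ∀ {A : Set} {v : A} T {X x} → x ∈ v ∷ T ++ X → x ∈ T ++ v ∷ X
  insert-⊇ T (here refl) = ∈-++⁺ʳ T (here refl)
  insert-⊇ T (there x∈) with ∈-++⁻ T x∈
  ... | inj₁ x∈T = ∈-++⁺ˡ x∈T
  ... | inj₂ x∈X = ∈-++⁺ʳ T (there x∈X)

  -- Induction on the number of vertices

  module Counting {n r : ℕ} (part : Fin n → Fin r) where

    open Multipartite part

    Valid : Family → Set
    Valid V = ∀ i → Unique (V i) × (∀ {x} → x ∈ V i → part x ≡ i)

    total : Family → ℕ
    total V = size (length ∘ V)

    series : Family → Fin r → Series
    series V i = q (length (V i))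

    set-same : ∀ {A : Set} (U : Fin r → A) i y → (U [ i ]≔ y) i ≡ y
    set-same U i y = updateAt-updates i U

    set-other : ∀ {A : Set} (U : Fin r → A) i y {j} → j ≢ i → (U [ i ]≔ y) j ≡ U j
    set-other U i y {j} j≢i = updateAt-minimal j i U j≢i

    valid-set : ∀ U i {ys zs} → Valid (U [ i ]≔ ys) → Unique zs → (∀ {x} → x ∈ zs → x ∈ ys) → Valid (U [ i ]≔ zs)
    valid-set U i {ys} {zs} valid uniq zs⊆ys j with j ≟ᶠ i
    ... | yes refl = subst (λ ws → Unique ws × (∀ {x} → x ∈ ws → part x ≡ i)) (sym (set-same U i zs))
                       (uniq , λ {x} x∈ → proj₂ (valid i) (subst (x ∈_) (sym (set-same U i ys)) (zs⊆ys x∈)))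
    ... | no  j≢i  = subst (λ ws → Unique ws × (∀ {x} → x ∈ ws → part x ≡ j))
                       (trans (set-other U i ys j≢i) (sym (set-other U i zs j≢i))) (valid j)

    valid⇒unique : ∀ U i {ys} → Valid (U [ i ]≔ ys) → Unique ys
    valid⇒unique U i {ys} valid = subst Unique (set-same U i ys) (proj₁ (valid i))

    valid⇒part : ∀ U i {ys} → Valid (U [ i ]≔ ys) → ∀ {x} → x ∈ ys → part x ≡ i
    valid⇒part U i {ys} valid {x} x∈ = proj₂ (valid i) (subst (x ∈_) (sym (set-same U i ys)) x∈)

    ∈-set : ∀ U i {ys zs} → (∀ {x} → x ∈ ys → x ∈ zs) → ∀ {x} → x ∈ᶠ U [ i ]≔ ys → x ∈ᶠ U [ i ]≔ zs
    ∈-set U i {ys} {zs} ys⊆zs {x} x∈ with part x ≟ᶠ i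
    ... | yes refl = subst (x ∈_) (sym (set-same U i zs)) (ys⊆zs (subst (x ∈_) (set-same U i ys) x∈))
    ... | no  x≁i  = subst (x ∈_) (trans (set-other U i ys x≁i) (sym (set-other U i zs x≁i))) x∈

    ∏-series-set : ∀ U i ys → ∏ (series (U [ i ]≔ ys)) ≗ ∏ (series U [ i ]≔ q (length ys))
    ∏-series-set U i ys = ∏-cong same
      where
      same : ∀ j → series (U [ i ]≔ ys) j ≗ (series U [ i ]≔ q (length ys)) j
      same j m with j ≟ᶠ i
      ... | yes refl = trans (cong (λ ws → q (length ws) m) (set-same U i ys))
                             (cong (λ f → f m) (sym (set-same (series U) i (q (length ys)))))
      ... | no  j≢i  = trans (cong (λ ws → q (length ws) m) (set-other U i ys j≢i))
                             (cong (λ f → f m) (sym (set-other (series U) i (q (length ys)) j≢i)))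

    TotalClaim : ℕ → Set
    TotalClaim s = ∀ V → Valid V → total V ≡ s → ι (# V []) ≡ L s (∏ (series V))

    -- Part i is listed as `T ++ X`, with `T` forbidden as sources and `X` unrestricted; the two
    -- lengths are the indices of the `triangle` entry in slot i.
    SourceClaim : ℕ → Set
    SourceClaim s = ∀ U i T X → Valid (U [ i ]≔ (T ++ X)) → total (U [ i ]≔ (T ++ X)) ≡ s →
      ι (# (U [ i ]≔ (T ++ X)) T) ≡ L s (∏ (series U [ i ]≔ triangle (length X) (length T)))

    -- The difference only involves smaller vertex sets, one deletion at a time.
    DifferenceClaim : ℕ → Set
    DifferenceClaim s = ∀ U i T X → Valid (U [ i ]≔ (T ++ X)) → total (U [ i ]≔ (T ++ X)) ≡ s →
      ι (# (U [ i ]≔ (T ++ X)) []) - ι (# (U [ i ]≔ (T ++ X)) T) ≡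
      L s (∏ (series U [ i ]≔ q (length T ℕ.+ length X))) - L s (∏ (series U [ i ]≔ triangle (length X) (length T)))

    -- `V` and `V₁` have the same vertices; v is listed before the forbidden block in one and at the
    -- head of the free block in the other. `V′` lacks v.
    module Delete (U : Family) (i : Fin r) (v : Fin n) (T X : List (Fin n))
                  (valid : Valid (U [ i ]≔ (v ∷ T ++ X))) where

      V V₁ V′ : Family
      V  = U [ i ]≔ (v ∷ T ++ X)
      V₁ = U [ i ]≔ (T ++ v ∷ X)
      V′ = U [ i ]≔ (T ++ X)

      unique : Unique (v ∷ T ++ X)
      unique = valid⇒unique U i valid

      part-v : part v ≡ i
      part-v = valid⇒part U i valid (here refl)

      valid₁ : Valid V₁
      valid₁ = valid-set U i valid (unique-insert T unique) (insert-⊆ T)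

      valid′ : Valid V′
      valid′ = valid-set U i valid (AllPairs.tail unique) there

      total₁ : total V₁ ≡ total V
      total₁ = size-cong same
        where
        same : ∀ j → length (V₁ j) ≡ length (V j)
        same j with j ≟ᶠ i
        ... | yes refl = trans (cong length (set-same U i (T ++ v ∷ X))) (trans
                           (trans (length-++ T) (trans (ℕ.+-suc (length T) (length X)) (cong suc (sym (length-++ T)))))
                           (cong length (sym (set-same U i (v ∷ T ++ X)))))
        ... | no  j≢i  = cong length (trans (set-other U i (T ++ v ∷ X) j≢i) (sym (set-other U i (v ∷ T ++ X) j≢i)))

      #-V₁ : ∀ T′ → # V₁ T′ ≡ # V T′
      #-V₁ = #-cong V₁ V (∈-set U i (insert-⊆ T)) (∈-set U i (insert-⊇ T))

      V⇒V′ : ∀ {x} → x ∈ᶠ V → x ≢ v → x ∈ᶠ V′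
      V⇒V′ {x} x∈ x≢v with part x ≟ᶠ i
      ... | no  x≁i  = subst (x ∈_) (trans (set-other U i (v ∷ T ++ X) x≁i) (sym (set-other U i (T ++ X) x≁i))) x∈
      ... | yes refl with subst (x ∈_) (set-same U i (v ∷ T ++ X)) x∈
      ... | here refl = contradiction refl x≢v
      ... | there x∈  = subst (x ∈_) (sym (set-same U i (T ++ X))) x∈

      v∈ : ∀ {ys} → v ∈ᶠ U [ i ]≔ ys → v ∈ ys
      v∈ {ys} v∈V = subst (v ∈_) (trans (cong (U [ i ]≔ ys) part-v) (set-same U i ys)) v∈V

      V′⇒V : ∀ {x} → x ∈ᶠ V′ → x ∈ᶠ V × x ≢ v
      V′⇒V x∈ = ∈-set U i there x∈ , λ { refl → All.lookup (AllPairs.head unique) (v∈ {T ++ X} x∈) refl }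

      deletion : # V T ≡ # V (v ∷ T) ℕ.+ # V′ T
      deletion = Deletion.#-deletion V V′ v
        (subst (v ∈_) (sym (trans (cong V part-v) (set-same U i (v ∷ T ++ X)))) (here refl)) T
        (All.tabulate λ x∈T → trans (valid⇒part U i valid (there (∈-++⁺ˡ x∈T))) (sym part-v)) V⇒V′ V′⇒V

    -- Induction on `T`: `deletion` for the counts and `triangle-step` for the series have the same
    -- shape. The vertex v moves to the free block at unchanged size, and only `V′`, with s
    -- vertices, calls on the hypothesis.
    difference : ∀ s → SourceClaim s → DifferenceClaim (suc s)
    difference s known U i []      X valid total≡ = trans (ℚ.+-inverseʳ (ι (# (U [ i ]≔ X) [])))
      (sym (ℚ.+-inverseʳ (L (suc s) (∏ (series U [ i ]≔ q (length X))))))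
    difference s known U i (v ∷ T) X valid total≡ = begin-equality
      ι (# V []) - ι (# V (v ∷ T))
        ≡⟨ identity₁ (ι (# V [])) (ι (# V (v ∷ T))) (ι (# V′ T)) ⟩
      (ι (# V []) - (ι (# V (v ∷ T)) + ι (# V′ T))) + ι (# V′ T)
        ≡⟨ cong (λ t → (ι (# V []) - t) + ι (# V′ T)) (trans (sym (ι-+ (# V (v ∷ T)) (# V′ T))) (cong ι (sym deletion))) ⟩
      (ι (# V []) - ι (# V T)) + ι (# V′ T)
        ≡⟨ cong₂ (λ a b → (ι a - ι b) + ι (# V′ T)) (sym (#-V₁ [])) (sym (#-V₁ T)) ⟩
      (ι (# V₁ []) - ι (# V₁ T)) + ι (# V′ T)
        ≡⟨ cong₂ _+_ (difference s known U i T (v ∷ X) valid₁ (trans total₁ total≡))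
             (trans (known U i T X valid′ (ℕ.suc-injective (trans (sym (size-set-∷ U i v (T ++ X))) total≡)))
               (trans (sym (L-z· s (∏ (series U [ i ]≔ t₀)))) (L-cong (suc s) (λ m → sym (∏-slot-z· (series U) i t₀ m))))) ⟩
      (Λ (q (length T ℕ.+ suc (length X))) - Λ t₁) + Λ (z· t₀)
        ≡⟨ identity₂ (Λ (q (length T ℕ.+ suc (length X)))) (Λ t₁) (Λ (z· t₀)) ⟩
      Λ (q (length T ℕ.+ suc (length X))) - (Λ t₁ - Λ (z· t₀))
        ≡⟨ cong₂ _-_ (cong (Λ ∘ q) (ℕ.+-suc (length T) (length X))) step ⟩
      Λ (q (suc (length T) ℕ.+ length X)) - Λ (triangle (length X) (suc (length T))) ∎
      where
      open Delete U i v T X valid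
      Λ : Series → ℚ
      Λ f = L (suc s) (∏ (series U [ i ]≔ f))
      t₀ t₁ : Series
      t₀ = triangle (length X) (length T)
      t₁ = triangle (suc (length X)) (length T)
      identity₁ : ∀ a b c → a - b ≡ (a - (b + c)) + c
      identity₁ = solve-∀ ℚ-ring
      identity₂ : ∀ a b c → (a - b) + c ≡ a - (b - c)
      identity₂ = solve-∀ ℚ-ring
      step : Λ t₁ - Λ (z· t₀) ≡ Λ (triangle (length X) (suc (length T)))
      step = trans (sym (L-sub (suc s) (∏ (series U [ i ]≔ t₁)) (∏ (series U [ i ]≔ z· t₀))))
        (L-cong (suc s) (λ m → trans (sym (∏-slot-sub (series U) i t₁ (z· t₀) m))
          (∏-slot-cong (series U) i (λ m → sym (triangle-step (length X) (length T) m)) m)))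

    total⇒source : ∀ s → TotalClaim s → DifferenceClaim s → SourceClaim s
    total⇒source s total-claim difference-claim U i T X valid total≡ = begin-equality
      ι (# V T)
        ≡⟨ identity (ι (# V [])) (ι (# V T)) ⟩
      ι (# V []) - (ι (# V []) - ι (# V T))
        ≡⟨ cong₂ _-_ (trans (total-claim V valid total≡) (L-cong s (λ m → trans (∏-series-set U i (T ++ X) m)
                              (cong (λ l → ∏ (series U [ i ]≔ q l) m) (length-++ T)))))
                     (difference-claim U i T X valid total≡) ⟩
      Λ (q (length T ℕ.+ length X)) - (Λ (q (length T ℕ.+ length X)) - Λ t)
        ≡⟨ identity (Λ (q (length T ℕ.+ length X))) (Λ t) ⟨
      Λ t ∎
      where
      V = U [ i ]≔ (T ++ X)
      t = triangle (length X) (length T)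
      Λ : Series → ℚ
      Λ f = L s (∏ (series U [ i ]≔ f))
      identity : ∀ a b → b ≡ a - (a - b)
      identity = solve-∀ ℚ-ring

    empty-family : ∀ V → total V ≡ 0 → ∀ i {x} → ¬ x ∈ V i
    empty-family V total≡0 i x∈ = absurd (V i) (size≡0 (length ∘ V) total≡0 i) x∈
      where
      absurd : ∀ xs → length xs ≡ 0 → ∀ {x} → ¬ x ∈ xs
      absurd (_ ∷ _) () _

    total-0 : TotalClaim 0
    total-0 V valid total≡0 = begin-equality
      ι (# V [])               ≡⟨ cong ι (#-empty {V} (λ x → empty-family V total≡0 (part x))) ⟩
      1ℚ                       ≡⟨ trans (L-def 0 (∏ (series V))) (trans (cong (_* 1ℚ) (∏₀≡1 (series V) (λ i → q₀≡1 (length (V i))))) (ℚ.*-identityʳ 1ℚ)) ⟨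
      L 0 (∏ (series V))       ∎

    difference-0 : DifferenceClaim 0
    difference-0 U i [] X valid total≡ = trans (ℚ.+-inverseʳ (ι (# (U [ i ]≔ X) [])))
      (sym (ℚ.+-inverseʳ (L 0 (∏ (series U [ i ]≔ q (length X))))))
    difference-0 U i (v ∷ T) X valid total≡0 =
      contradiction (subst (v ∈_) (sym (set-same U i (v ∷ T ++ X))) (here refl)) (empty-family (U [ i ]≔ (v ∷ T ++ X)) total≡0 i)

    nonempty : ∀ {m} (U : Fin m → List (Fin n)) → 0 ℕ.< size (length ∘ U) → ∃[ i ] ∃[ x ] x ∈ U i
    nonempty {suc m} U 0<size with U zero in eq
    ... | x ∷ _ = zero , x , subst (x ∈_) (sym eq) (here refl)
    ... | []    with nonempty (U ∘ suc) 0<size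
    ... | i , x , x∈ = suc i , x , x∈

    -- The case in which `T` is the whole part and `X` is empty; `triangle-row₀` gives its entry the
    -- form found in `L-∏-q`.
    part-difference : ∀ s → SourceClaim s → ∀ V → Valid V → total V ≡ suc s → ∀ i →
      ι (# V []) - ι (# V (V i)) ≡
      L (suc s) (∏ (series V [ i ]≔ q (length (V i)))) - L (suc s) (∏ (series V [ i ]≔ q (suc (length (V i)))))
    part-difference s known V valid total≡ i = begin-equality
      ι (# V []) - ι (# V (V i))
        ≡⟨ cong₂ (λ a b → ι a - ι b) (same []) (same (V i)) ⟩
      ι (# W []) - ι (# W (V i))
        ≡⟨ difference s known V i (V i) [] W-valid (trans (size-cong (λ j → cong length (W≗V j))) total≡) ⟩
      L (suc s) (∏ (series V [ i ]≔ q (length (V i) ℕ.+ 0))) - L (suc s) (∏ (series V [ i ]≔ triangle 0 (length (V i))))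
        ≡⟨ cong₂ _-_ (cong (λ l → L (suc s) (∏ (series V [ i ]≔ q l))) (ℕ.+-identityʳ (length (V i))))
             (L-cong (suc s) (∏-slot-cong (series V) i (triangle-row₀ (length (V i))))) ⟩
      L (suc s) (∏ (series V [ i ]≔ q (length (V i)))) - L (suc s) (∏ (series V [ i ]≔ q (suc (length (V i))))) ∎
      where
      W : Family
      W = V [ i ]≔ (V i ++ [])
      W≗V : ∀ j → W j ≡ V j
      W≗V = updateAt-id-local i V (++-identityʳ (V i))
      W-valid : Valid W
      W-valid j = subst (λ ws → Unique ws × (∀ {x} → x ∈ ws → part x ≡ j)) (sym (W≗V j)) (valid j)
      same : ∀ T → # V T ≡ # W T
      same = #-cong V W (λ {x} → subst (x ∈_) (sym (W≗V (part x)))) (λ {x} → subst (x ∈_) (W≗V (part x)))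

    -- The orientations are split by the part holding the sources, the integral by the factor that
    -- is differentiated; `part-difference` matches the summands.
    total-suc : ∀ s → SourceClaim s → TotalClaim (suc s)
    total-suc s known V valid total≡ = conclude (#-sources {V} (λ {i} → proj₂ (valid i)) x∈V)
      where
      0<total : 0 ℕ.< total V
      0<total = subst (0 ℕ.<_) (sym total≡) (ℕ.s≤s ℕ.z≤n)
      witness : ∃[ i ] ∃[ x ] x ∈ V i
      witness = nonempty V 0<total
      x∈V : proj₁ (proj₂ witness) ∈ᶠ V
      x∈V = subst (λ j → proj₁ (proj₂ witness) ∈ V j) (sym (proj₂ (valid (proj₁ witness)) (proj₂ (proj₂ witness)))) (proj₂ (proj₂ witness))
      conclude : ∃[ κ ] (∀ i → # V [] ≡ # V (V i) ℕ.+ κ i) × # V [] ≡ size κ → ι (# V []) ≡ L (suc s) (∏ (series V))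
      conclude (κ , splits , sum) = begin-equality
        ι (# V [])
          ≡⟨ trans (cong ι sum) (∑-ι κ) ⟩
        ∑ (ι ∘ κ)
          ≡⟨ ∑-cong (λ i → trans (identity (ι (# V (V i))) (ι (κ i))) (trans
               (cong (_- ι (# V (V i))) (trans (sym (ι-+ (# V (V i)) (κ i))) (cong ι (sym (splits i)))))
               (part-difference s known V valid total≡ i))) ⟩
        ∑ (λ i → L (suc s) (∏ (series V [ i ]≔ q (length (V i)))) - L (suc s) (∏ (series V [ i ]≔ q (suc (length (V i))))))
          ≡⟨ subst (λ t → L t (∏ (series V)) ≡ ∑ (λ i → L t (∏ (series V [ i ]≔ q (length (V i)))) - L t (∏ (series V [ i ]≔ q (suc (length (V i)))))))
               total≡ (L-∏-q (length ∘ V) 0<total) ⟨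
        L (suc s) (∏ (series V)) ∎
        where
        identity : ∀ a b → b ≡ (a + b) - a
        identity = solve-∀ ℚ-ring

    source-claim : ∀ s → SourceClaim s
    source-claim zero    = total⇒source 0 total-0 difference-0
    source-claim (suc s) = total⇒source (suc s) (total-suc s (source-claim s)) (difference s (source-claim s))

    total-claim : ∀ s → TotalClaim s
    total-claim zero    = total-0
    total-claim (suc s) = total-suc s (source-claim s)

  -- Parts of equal size

  ∏-const : ∀ r Q → ∏ {r} (λ _ → Q) ≗ pow Q r
  ∏-const zero    Q m = refl
  ∏-const (suc r) Q   = conv-cong {f = Q} (λ _ → refl) (∏-const r Q)

  size-const : ∀ r k → size {r} (λ _ → k) ≡ r ℕ.* k
  size-const zero    k = refl
  size-const (suc r) k = cong (k ℕ.+_) (size-const r k)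

  C-formula : ∀ k r → ι (C k r) ≡ conv (pow (q k) r) fact (k ℕ.* r)
  C-formula k r = begin-equality
    ι (C k r)
      ≡⟨ cong ι (trans (count-cong (isAcyclicOrientation? G) (admissible? V [])
           (λ {D} o → isAcyclicOrientation-resp G (graph V) (λ {i} {j} x≁y → (member i , member j) , x≁y) proj₂ D o , [])
           (λ {D} o → isAcyclicOrientation-resp (graph V) G proj₂ (λ {i} {j} x≁y → (member i , member j) , x≁y) D (proj₁ o))
           (digraphs (r ℕ.* k))) (sym (#-def V []))) ⟩
    ι (# V [])
      ≡⟨ total-claim (k ℕ.* r) V valid (trans (size-cong len) (trans (size-const r k) (ℕ.*-comm r k))) ⟩
    L (k ℕ.* r) (∏ (series V))
      ≡⟨ L-cong (k ℕ.* r) (λ m → trans (∏-cong (λ i m → cong (λ l → q l m) (len i)) m) (∏-const r (q k) m)) ⟩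
    L (k ℕ.* r) (pow (q k) r)
      ≡⟨ L-def (k ℕ.* r) (pow (q k) r) ⟩
    conv (pow (q k) r) fact (k ℕ.* r) ∎
    where
    G = completeMultipartite k r
    open Multipartite {r ℕ.* k} {r} (quotient k)
    open Counting {r ℕ.* k} {r} (quotient k)
    V : Family
    V i = map (combine i) (allFin k)
    len : ∀ i → length (V i) ≡ k
    len i = trans (length-map (combine i) (allFin k)) (length-tabulate id)
    member : ∀ x → x ∈ᶠ V
    member x = subst (_∈ V (quotient {r} k x)) (combine-remQuot {r} k x) (∈-map⁺ (combine (quotient {r} k x)) (∈-allFin (proj₂ (remQuot {r} k x))))
    valid : Valid V
    valid i = Unique.map⁺ (combine-injectiveʳ i _ i _) (Unique.allFin⁺ k) , part-of
      where
      part-of : ∀ {x} → x ∈ V i → quotient k x ≡ i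
      part-of x∈ with ∈-map⁻ (combine i) x∈
      ... | j , _ , refl = cong proj₁ (remQuot-combine i j)

open Enumeration

module Limit where
  open import Data.Rational using (_+_; _*_; _-_; -_; ∣_∣; _≤_; _<_)
  open ℚ.≤-Reasoning

  -- Explicit constants

  -- S(n, n - 1) = n (n - 1)/2, by the recurrence of `q`.
  q-1 : ∀ n → (1ℚ + 1ℚ) * q n 1 ≡ - (ι n * (ι n - 1ℚ))
  q-1 zero    = refl
  q-1 (suc n) = begin-equality
    (1ℚ + 1ℚ) * (q n 1 - (ι n - 0ℚ) * q n 0)
      ≡⟨ cong (λ t → (1ℚ + 1ℚ) * (q n 1 - (ι n - 0ℚ) * t)) (q₀≡1 n) ⟩
    (1ℚ + 1ℚ) * (q n 1 - (ι n - 0ℚ) * 1ℚ)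
      ≡⟨ identity₁ (q n 1) (ι n) ⟩
    (1ℚ + 1ℚ) * q n 1 - (1ℚ + 1ℚ) * ι n
      ≡⟨ cong (_- (1ℚ + 1ℚ) * ι n) (q-1 n) ⟩
    - (ι n * (ι n - 1ℚ)) - (1ℚ + 1ℚ) * ι n
      ≡⟨ identity₂ (ι n) ⟩
    - ((1ℚ + ι n) * (1ℚ + ι n - 1ℚ))
      ≡⟨ cong (λ i → - (i * (i - 1ℚ))) (ι-suc n) ⟨
    - (ι (suc n) * (ι (suc n) - 1ℚ)) ∎
    where
    identity₁ : ∀ x i → (1ℚ + 1ℚ) * (x - (i - 0ℚ) * 1ℚ) ≡ (1ℚ + 1ℚ) * x - (1ℚ + 1ℚ) * i
    identity₁ = solve-∀ ℚ-ring
    identity₂ : ∀ i → - (i * (i - 1ℚ)) - (1ℚ + 1ℚ) * i ≡ - ((1ℚ + i) * (1ℚ + i - 1ℚ))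
    identity₂ = solve-∀ ℚ-ring

  -- S(n, n - 2) = C(n, 3) + 3 C(n, 4), cleared of its denominator 24.
  q-2 : ∀ n → ι 24 * q n 2 ≡ ι n * (ι n - 1ℚ) * (ι n - ι 2) * (ι 3 * ι n - ι 5)
  q-2 zero    = refl
  q-2 (suc n) = begin-equality
    ι 24 * (q n 2 - (ι n - 1ℚ) * q n 1)
      ≡⟨ identity₁ (q n 2) (ι n) (q n 1) ⟩
    ι 24 * q n 2 - ι 12 * (ι n - 1ℚ) * ((1ℚ + 1ℚ) * q n 1)
      ≡⟨ cong₂ (λ s t → s - ι 12 * (ι n - 1ℚ) * t) (q-2 n) (q-1 n) ⟩
    ι n * (ι n - 1ℚ) * (ι n - ι 2) * (ι 3 * ι n - ι 5) - ι 12 * (ι n - 1ℚ) * - (ι n * (ι n - 1ℚ))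
      ≡⟨ identity₂ (ι n) ⟩
    (1ℚ + ι n) * (1ℚ + ι n - 1ℚ) * (1ℚ + ι n - ι 2) * (ι 3 * (1ℚ + ι n) - ι 5)
      ≡⟨ cong (λ i → i * (i - 1ℚ) * (i - ι 2) * (ι 3 * i - ι 5)) (ι-suc n) ⟨
    ι (suc n) * (ι (suc n) - 1ℚ) * (ι (suc n) - ι 2) * (ι 3 * ι (suc n) - ι 5) ∎
    where
    identity₁ : ∀ x i y → ι 24 * (x - (i - 1ℚ) * y) ≡ ι 24 * x - ι 12 * (i - 1ℚ) * ((1ℚ + 1ℚ) * y)
    identity₁ = solve-∀ ℚ-ring
    identity₂ : ∀ i → i * (i - 1ℚ) * (i - ι 2) * (ι 3 * i - ι 5) - ι 12 * (i - 1ℚ) * - (i * (i - 1ℚ))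
              ≡ (1ℚ + i) * (1ℚ + i - 1ℚ) * (1ℚ + i - ι 2) * (ι 3 * (1ℚ + i) - ι 5)
    identity₂ = solve-∀ ℚ-ring

  module Constants (d : ℕ) where

    k : ℕ
    k = suc d

    κ m a e : ℚ
    κ = recip k
    m = ι d
    a = q k 1
    e = κ * a

    ι-k : ι k ≡ 1ℚ + m
    ι-k = ι-suc d

    κ*k : κ * (1ℚ + m) ≡ 1ℚ
    κ*k = trans (ℚ.*-comm κ (1ℚ + m)) (trans (cong (_* κ) (sym ι-k)) (ι*recip k))

    e≡ : e ≡ - (½ * m)
    e≡ = begin-equality
      κ * a                                        ≡⟨ identity₁ κ a ⟩
      ½ * (κ * ((1ℚ + 1ℚ) * a))                    ≡⟨ cong (λ t → ½ * (κ * t)) (q-1 k) ⟩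
      ½ * (κ * - (ι k * (ι k - 1ℚ)))               ≡⟨ cong (λ n → ½ * (κ * - (n * (n - 1ℚ)))) ι-k ⟩
      ½ * (κ * - ((1ℚ + m) * (1ℚ + m - 1ℚ)))       ≡⟨ identity₂ κ m ⟩
      - (½ * (κ * (1ℚ + m) * m))                   ≡⟨ cong (λ t → - (½ * (t * m))) κ*k ⟩
      - (½ * (1ℚ * m))                             ≡⟨ cong (λ t → - (½ * t)) (ℚ.*-identityˡ m) ⟩
      - (½ * m)                                    ∎
      where
      identity₁ : ∀ k a → k * a ≡ ½ * (k * ((1ℚ + 1ℚ) * a))
      identity₁ = solve-∀ ℚ-ring
      identity₂ : ∀ k m → ½ * (k * - ((1ℚ + m) * (1ℚ + m - 1ℚ))) ≡ - (½ * (k * (1ℚ + m) * m))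
      identity₂ = solve-∀ ℚ-ring

    -- Supplies the hypothesis `small` of `Estimate`.
    ∣e∣≤ : ∣ e ∣ ≤ m
    ∣e∣≤ = begin
      ∣ e ∣            ≡⟨ trans (cong ∣_∣ e≡) (ℚ.∣-p∣≡∣p∣ (½ * m)) ⟩
      ∣ ½ * m ∣        ≡⟨ ℚ.0≤p⇒∣p∣≡p (0≤* (ℚ.nonNegative⁻¹ ½) (0≤ι d)) ⟩
      ½ * m            ≤⟨ p≤p+q (0≤* (ℚ.nonNegative⁻¹ ½) (0≤ι d)) ⟩
      ½ * m + ½ * m    ≡⟨ identity m ⟩
      m                ∎
      where
      identity : ∀ m → ½ * m + ½ * m ≡ m
      identity = solve-∀ ℚ-ring

    exponent≡ : (ℤ.- (ℤ.+ k ℤ.- ℤ.+ 1)) ℚ./ 2 ≡ e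
    exponent≡ = trans (/≡/1*recip (ℤ.- ℤ.+ d) 2) (trans (cong (_* ½) (/1-homo-neg (ℤ.+ d)))
      (trans (identity m) (sym e≡)))
      where
      identity : ∀ m → - m * ½ ≡ - (½ * m)
      identity = solve-∀ ℚ-ring

    open Estimate d (q k) (q₀≡1 k) (q-expBounded k) (q-vanishes k) ∣e∣≤ public
      using (β; target; psum-target; UniformBound; estimate)

    -- Here σ = q_k[2] - a²/2 and κ a = e, so β = κ e²/2 + κ² q_k[2] - e²/2, into which `e≡` and
    -- `q-2` are substituted.
    correction≡ : - β ≡ m * (ι 5 * (1ℚ + m) - ι 7) * recip 24 * κ
    correction≡ = begin-equality
      - (½ * κ * (e * e) + (q k 2 - term a 2) * (κ * κ))
        ≡⟨ identity₁ κ a (q k 2) ⟩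
      - (½ * κ * (e * e) + recip 24 * (κ * κ * (ι 24 * q k 2)) - ½ * (e * e))
        ≡⟨ cong₂ (λ e s → - (½ * κ * (e * e) + recip 24 * (κ * κ * s) - ½ * (e * e))) e≡
             (trans (q-2 k) (cong (λ n → n * (n - 1ℚ) * (n - ι 2) * (ι 3 * n - ι 5)) ι-k)) ⟩
      - (½ * κ * (h * h) + recip 24 * (κ * κ * ((1ℚ + m) * (1ℚ + m - 1ℚ) * (1ℚ + m - ι 2) * (ι 3 * (1ℚ + m) - ι 5))) - ½ * (h * h))
        ≡⟨ identity₂ κ m ⟩
      - (½ * κ * (h * h) + recip 24 * (κ * (κ * (1ℚ + m)) * s) - ½ * (h * h) * 1ℚ)
        -- κ k = 1 is used in both directions: it cancels in the middle term and is inserted in the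
        -- last, so that all three share one factor κ.
        ≡⟨ cong₂ (λ x y → - (½ * κ * (h * h) + recip 24 * (κ * x * s) - ½ * (h * h) * y)) κ*k (sym κ*k) ⟩
      - (½ * κ * (h * h) + recip 24 * (κ * 1ℚ * s) - ½ * (h * h) * (κ * (1ℚ + m)))
        ≡⟨ identity₃ κ m ⟩
      m * (ι 5 * (1ℚ + m) - ι 7) * recip 24 * κ ∎
      where
      h s : ℚ
      h = - (½ * m)
      s = (1ℚ + m - 1ℚ) * (1ℚ + m - ι 2) * (ι 3 * (1ℚ + m) - ι 5)
      identity₁ : ∀ k a x → - (½ * k * (k * a * (k * a)) + (x - a * (a * 1ℚ) * ½) * (k * k))
        ≡ - (½ * k * (k * a * (k * a)) + recip 24 * (k * k * (ι 24 * x)) - ½ * (k * a * (k * a)))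
      identity₁ = solve-∀ ℚ-ring
      identity₂ : ∀ k m → - (½ * k * (- (½ * m) * - (½ * m)) + recip 24 * (k * k * ((1ℚ + m) * (1ℚ + m - 1ℚ) * (1ℚ + m - ι 2) * (ι 3 * (1ℚ + m) - ι 5))) - ½ * (- (½ * m) * - (½ * m)))
        ≡ - (½ * k * (- (½ * m) * - (½ * m)) + recip 24 * (k * (k * (1ℚ + m)) * ((1ℚ + m - 1ℚ) * (1ℚ + m - ι 2) * (ι 3 * (1ℚ + m) - ι 5))) - ½ * (- (½ * m) * - (½ * m)) * 1ℚ)
      identity₂ = solve-∀ ℚ-ring
      identity₃ : ∀ k m → - (½ * k * (- (½ * m) * - (½ * m)) + recip 24 * (k * 1ℚ * ((1ℚ + m - 1ℚ) * (1ℚ + m - ι 2) * (ι 3 * (1ℚ + m) - ι 5))) - ½ * (- (½ * m) * - (½ * m)) * (k * (1ℚ + m)))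
        ≡ m * (ι 5 * (1ℚ + m) - ι 7) * recip 24 * k
      identity₃ = solve-∀ ℚ-ring

    coefficient : ∀ r .{{_ : NonZero r}} → ℚ
    coefficient r = (((ℤ.+ k ℤ.- ℤ.+ 1) ℤ.* (ℤ.+ 5 ℤ.* ℤ.+ k ℤ.- ℤ.+ 7)) ℚ./ (24 ℕ.* k ℕ.* r)) {{m*n≢0 (24 ℕ.* k) r {{m*n≢0 24 k}}}}

    coefficient≡ : ∀ r .{{_ : NonZero r}} → coefficient r ≡ - (recip r * β)
    coefficient≡ r = begin-equality
      coefficient r
        ≡⟨ /≡/1*recip (ℤ.+ d ℤ.* (ℤ.+ 5 ℤ.* ℤ.+ k ℤ.- ℤ.+ 7)) (24 ℕ.* k ℕ.* r) {{24kr≢0}} ⟩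
      ((ℤ.+ d ℤ.* (ℤ.+ 5 ℤ.* ℤ.+ k ℤ.- ℤ.+ 7)) ℚ./ 1) * recip (24 ℕ.* k ℕ.* r) {{24kr≢0}}
        ≡⟨ cong₂ _*_ numerator denominator ⟩
      m * (ι 5 * (1ℚ + m) - ι 7) * (recip 24 * κ * recip r)
        ≡⟨ identity (m * (ι 5 * (1ℚ + m) - ι 7)) (recip 24) κ (recip r) ⟩
      recip r * (m * (ι 5 * (1ℚ + m) - ι 7) * recip 24 * κ)
        ≡⟨ cong (recip r *_) correction≡ ⟨
      recip r * - β
        ≡⟨ ℚ.neg-distribʳ-* (recip r) β ⟨
      - (recip r * β) ∎
      where
      24kr≢0 : NonZero (24 ℕ.* k ℕ.* r)
      24kr≢0 = m*n≢0 (24 ℕ.* k) r {{m*n≢0 24 k}}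
      identity : ∀ x u v w → x * (u * v * w) ≡ w * (x * u * v)
      identity = solve-∀ ℚ-ring
      numerator : (ℤ.+ d ℤ.* (ℤ.+ 5 ℤ.* ℤ.+ k ℤ.- ℤ.+ 7)) ℚ./ 1 ≡ m * (ι 5 * (1ℚ + m) - ι 7)
      numerator = trans (/1-homo-* (ℤ.+ d) (ℤ.+ 5 ℤ.* ℤ.+ k ℤ.- ℤ.+ 7)) (cong (m *_)
        (trans (/1-homo-+ (ℤ.+ 5 ℤ.* ℤ.+ k) (ℤ.- ℤ.+ 7)) (cong (_- ι 7)
          (trans (/1-homo-* (ℤ.+ 5) (ℤ.+ k)) (cong (ι 5 *_) ι-k)))))
      denominator : recip (24 ℕ.* k ℕ.* r) {{24kr≢0}} ≡ recip 24 * κ * recip r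
      denominator = trans (recip-* (24 ℕ.* k) r {{m*n≢0 24 k}} {{it}} {{24kr≢0}})
        (cong (_* recip r) (recip-* 24 k {{_}} {{_}} {{m*n≢0 24 k}}))

    -- Passing to the limit

    ratio : ∀ r → ℚ
    ratio r = ι (C k r) * recip ((k ℕ.* r) !) {{(k ℕ.* r) !≢0}}

    -- The n-th approximation to the remainder, obtained by solving the asserted equation for it
    -- with exp(-e) in place of 1/exp(e).
    error : ∀ r .{{_ : NonZero r}} → ℕ → ℚ
    error r n = partialSum (- e) n * ratio r - 1ℚ + coefficient r

    -- By the choice of `error` everything cancels except C_k(r) times the defect of exp(e) exp(-e)
    -- = 1 at stage n.
    expansion : ∀ r .{{_ : NonZero r}} ε → 0ℚ < ε → ∃[ n₀ ] (∀ n → n₀ ℕ.≤ n →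
      ∣ ι (C k r) - partialSum e n * fact (k ℕ.* r) * (1ℚ - coefficient r + error r n) ∣ ≤ ε)
    expansion r ε 0<ε = conclude (divide ε (1ℚ + c) 0<ε (ℚ.+-mono-<-≤ (ℚ.positive⁻¹ 1ℚ) (0≤ι (C k r))))
      where
      c : ℚ
      c = ι (C k r)
      close : ∀ n {δ} → 0ℚ ≤ δ → δ * (1ℚ + c) ≡ ε → ∣ partialSum e n * partialSum (- e) n - 1ℚ ∣ ≤ δ →
        ∣ c - partialSum e n * fact (k ℕ.* r) * (1ℚ - coefficient r + error r n) ∣ ≤ ε
      close n {δ} 0≤δ δ≡ε inverse = begin
        ∣ c - S * F * (1ℚ - coefficient r + (S′ * (c * F⁻¹) - 1ℚ + coefficient r)) ∣
          ≡⟨ cong ∣_∣ (identity c S F (coefficient r) S′ F⁻¹) ⟩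
        ∣ c - (F * F⁻¹) * (S * S′ * c) ∣
          ≡⟨ cong (λ t → ∣ c - t * (S * S′ * c) ∣) (ι*recip ((k ℕ.* r) !) {{(k ℕ.* r) !≢0}}) ⟩
        ∣ c - 1ℚ * (S * S′ * c) ∣
          ≡⟨ cong ∣_∣ (identity₂ c (S * S′)) ⟩
        ∣ - ((S * S′ - 1ℚ) * c) ∣
          ≡⟨ ℚ.∣-p∣≡∣p∣ ((S * S′ - 1ℚ) * c) ⟩
        ∣ (S * S′ - 1ℚ) * c ∣
          ≤⟨ ∣*∣≤ inverse (∣0≤∣≤ (0≤ι (C k r)) (p≤q+p 0≤1)) ⟩
        δ * (1ℚ + c)
          ≡⟨ δ≡ε ⟩
        ε ∎
        where
        S S′ F F⁻¹ : ℚ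
        S = partialSum e n
        S′ = partialSum (- e) n
        F = fact (k ℕ.* r)
        F⁻¹ = recip ((k ℕ.* r) !) {{(k ℕ.* r) !≢0}}
        identity : ∀ c s f x t g → c - s * f * (1ℚ - x + (t * (c * g) - 1ℚ + x)) ≡ c - (f * g) * (s * t * c)
        identity = solve-∀ ℚ-ring
        identity₂ : ∀ c t → c - 1ℚ * (t * c) ≡ - ((t - 1ℚ) * c)
        identity₂ = solve-∀ ℚ-ring
      conclude : ∃[ δ ] 0ℚ < δ × δ * (1ℚ + c) ≡ ε → ∃[ n₀ ] (∀ n → n₀ ℕ.≤ n →
        ∣ ι (C k r) - partialSum e n * fact (k ℕ.* r) * (1ℚ - coefficient r + error r n) ∣ ≤ ε)
      conclude (δ , 0<δ , δ≡ε) = proj₁ (exp-inverse e δ 0<δ) , λ n n₀≤n →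
        close n (ℚ.<⇒≤ 0<δ) δ≡ε (proj₂ (exp-inverse e δ 0<δ) n n₀≤n)

    EventualBound : ℚ → Set
    EventualBound B = ∀ r .{{_ : NonZero r}} ε → 0ℚ < ε → ∃[ n₀ ] (∀ n → n₀ ℕ.≤ n →
      ∣ error r n ∣ ≤ B * (recip r * recip r) + ε)

    -- The bound must precede r. It is P K, with K from `estimate` and P a bound on the partial sums
    -- of exp(-e); all other contributions vanish as n grows with r fixed, and go into ε.
    error-bound : ∃ EventualBound
    error-bound = conclude estimate (eventually-bounded {partialSum (- e)} (partialSum-cauchy (- e)))
      where
      conclude : ∃[ K ] 0ℚ ≤ K × ∃[ n₀ ] UniformBound K n₀ → EventuallyBounded (partialSum (- e)) → ∃ EventualBound
      conclude (K , 0≤K , n₁ , uniform) (P , 0<P , n₂ , bounded) = P * K , λ r ε 0<ε →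
        limit r ε (divide ε (weight-of r) 0<ε (0<weight r))
        where
        b : ∀ r .{{_ : NonZero r}} → ℚ
        b r = recip r * β
        -- The total factor with which the two vanishing defects enter, so that δ = ε /
        -- `weight-of r`.
        weight-of : ∀ r .{{_ : NonZero r}} → ℚ
        weight-of r = (1ℚ + ∣ b r ∣) + ∣ b r ∣ * P
        0<weight : ∀ r .{{_ : NonZero r}} → 0ℚ < weight-of r
        0<weight r = ℚ.+-mono-<-≤ (ℚ.+-mono-<-≤ (ℚ.positive⁻¹ 1ℚ) (ℚ.0≤∣p∣ (b r))) (0≤* (ℚ.0≤∣p∣ (b r)) (ℚ.<⇒≤ 0<P))
        close : ∀ r .{{_ : NonZero r}} j {δ} → k ℕ.* r ℕ.≤ j → n₁ ℕ.≤ j → n₂ ℕ.≤ j →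
          ∣ partialSum e (2 ℕ.+ j) * partialSum (- e) (2 ℕ.+ j) - 1ℚ ∣ ≤ δ → ∣ partialSum e (2 ℕ.+ j) - partialSum e j ∣ ≤ δ →
          ∣ error r (2 ℕ.+ j) ∣ ≤ P * K * (recip r * recip r) + δ * weight-of r
        close r j {δ} N≤j n₁≤j n₂≤j inverse cauchy = begin
          ∣ S′ * x - 1ℚ + coefficient r ∣
            -- Three defects are separated: of the estimate for the ratio, of S S′ = 1, and of the
            -- lag between the partial sums `S` and `S₂`.
            ≡⟨ cong ∣_∣ (trans (cong (S′ * x - 1ℚ +_) (coefficient≡ r)) (identity₁ S′ x (b r) S S₂)) ⟩
          ∣ S′ * (x - (S + b r * S₂)) + ((1ℚ + b r) * (S * S′ - 1ℚ) - b r * S′ * (S - S₂)) ∣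
            ≤⟨ ∣+∣≤ (∣*∣≤ S′≤ main) (∣-∣≤ (∣*∣≤ 1+b≤ inverse) (∣*∣≤ (∣*∣≤ {b r} ℚ.≤-refl S′≤) cauchy)) ⟩
          P * (recip r * recip r * K) + ((1ℚ + ∣ b r ∣) * δ + ∣ b r ∣ * P * δ)
            ≡⟨ identity₂ P (recip r) K ∣ b r ∣ δ ⟩
          P * K * (recip r * recip r) + δ * weight-of r ∎
          where
          S S₂ S′ x : ℚ
          S = partialSum e (2 ℕ.+ j)
          S₂ = partialSum e j
          S′ = partialSum (- e) (2 ℕ.+ j)
          x = ratio r
          j≤2+j : ∀ {i} → i ℕ.≤ j → i ℕ.≤ 2 ℕ.+ j
          j≤2+j i≤j = ℕ.m≤n⇒m≤1+n (ℕ.m≤n⇒m≤1+n i≤j)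
          S′≤ : ∣ S′ ∣ ≤ P
          S′≤ = bounded (2 ℕ.+ j) (j≤2+j n₂≤j)
          1+b≤ : ∣ 1ℚ + b r ∣ ≤ 1ℚ + ∣ b r ∣
          1+b≤ = ∣+∣≤ {1ℚ} {b r} ℚ.≤-refl ℚ.≤-refl
          main : ∣ x - (S + b r * S₂) ∣ ≤ recip r * recip r * K
          main = subst₂ (λ s t → ∣ s * recip ((k ℕ.* r) !) {{(k ℕ.* r) !≢0}} - t ∣ ≤ recip r * recip r * K)
            (sym (C-formula k r)) (psum-target r j) (uniform r (2 ℕ.+ j) (ℕ.s≤s (ℕ.m≤n⇒m≤1+n N≤j)) (j≤2+j n₁≤j))
          identity₁ : ∀ t x b s u → t * x - 1ℚ + - b ≡ t * (x - (s + b * u)) + ((1ℚ + b) * (s * t - 1ℚ) - b * t * (s - u))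
          identity₁ = solve-∀ ℚ-ring
          identity₂ : ∀ p r k b δ → p * (r * r * k) + ((1ℚ + b) * δ + b * p * δ) ≡ p * k * (r * r) + δ * ((1ℚ + b) + b * p)
          identity₂ = solve-∀ ℚ-ring
        limit : ∀ r .{{_ : NonZero r}} ε → ∃[ δ ] 0ℚ < δ × δ * weight-of r ≡ ε → ∃[ n₀ ] (∀ n → n₀ ℕ.≤ n →
          ∣ error r n ∣ ≤ P * K * (recip r * recip r) + ε)
        limit r ε (δ , 0<δ , δ≡ε) = 2 ℕ.+ n₀ , λ
          { (suc (suc j)) (ℕ.s≤s (ℕ.s≤s n₀≤j)) → subst (λ t → ∣ error r (2 ℕ.+ j) ∣ ≤ P * K * (recip r * recip r) + t) δ≡ε
              (close r j (N≤ n₀≤j) (n₁≤ n₀≤j) (n₂≤ n₀≤j)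
                (proj₂ (exp-inverse e δ 0<δ) (2 ℕ.+ j) (up (n₃≤ n₀≤j)))
                (proj₂ (partialSum-cauchy e δ 0<δ) (2 ℕ.+ j) j (up (n₄≤ n₀≤j)) (n₄≤ n₀≤j))) }
          where
          n₃ n₄ n₀ : ℕ
          n₃ = proj₁ (exp-inverse e δ 0<δ)
          n₄ = proj₁ (partialSum-cauchy e δ 0<δ)
          n₀ = k ℕ.* r ℕ.⊔ n₁ ℕ.⊔ (n₂ ℕ.⊔ (n₃ ℕ.⊔ n₄))
          up : ∀ {i j} → i ℕ.≤ j → i ℕ.≤ 2 ℕ.+ j
          up i≤j = ℕ.m≤n⇒m≤1+n (ℕ.m≤n⇒m≤1+n i≤j)
          module _ {j : ℕ} (n₀≤j : n₀ ℕ.≤ j) where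
            left : k ℕ.* r ℕ.⊔ n₁ ℕ.≤ j
            left = ℕ.m⊔n≤o⇒m≤o (k ℕ.* r ℕ.⊔ n₁) _ n₀≤j
            right : n₂ ℕ.⊔ (n₃ ℕ.⊔ n₄) ℕ.≤ j
            right = ℕ.m⊔n≤o⇒n≤o (k ℕ.* r ℕ.⊔ n₁) _ n₀≤j
            N≤ : k ℕ.* r ℕ.≤ j
            N≤ = ℕ.m⊔n≤o⇒m≤o (k ℕ.* r) n₁ left
            n₁≤ : n₁ ℕ.≤ j
            n₁≤ = ℕ.m⊔n≤o⇒n≤o (k ℕ.* r) n₁ left
            n₂≤ : n₂ ℕ.≤ j
            n₂≤ = ℕ.m⊔n≤o⇒m≤o n₂ _ right
            n₃≤ : n₃ ℕ.≤ j
            n₃≤ = ℕ.m⊔n≤o⇒m≤o n₃ n₄ (ℕ.m⊔n≤o⇒n≤o n₂ _ right)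
            n₄≤ : n₄ ℕ.≤ j
            n₄≤ = ℕ.m⊔n≤o⇒n≤o n₃ n₄ (ℕ.m⊔n≤o⇒n≤o n₂ _ right)

  recip-cong : ∀ {m n} .{{_ : NonZero m}} .{{_ : NonZero n}} → m ≡ n → recip m ≡ recip n
  recip-cong refl = refl

  recip-square : ∀ r .{{_ : NonZero r}} .{{_ : NonZero (r ℕ.^ 2)}} → recip (r ℕ.^ 2) ≡ recip r * recip r
  recip-square r@(suc _) = trans (recip-cong (cong (r ℕ.*_) (ℕ.*-identityʳ r))) (recip-* r r)

open Limit

open import Data.Integer using (+_)
open Real using (_≈_; _≤_; _+_; _*_; _-_; -_; ∣_∣)

theorem6 :
  ∀ (k : ℕ) .{{_ : NonZero k}} →
  ∃[ E ] (E ∈O r^-2) ×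
    (∀ (r : ℕ) .{{_ : NonZero r}} →
      fromℕ (C k r) ≈
        exp ((ℤ.- (+ k ℤ.- + 1)) ℚ./ 2) * fromℕ ((k ℕ.* r) !) *
          (1ℝ - ⌜ (((+ k ℤ.- + 1) ℤ.* (+ 5 ℤ.* + k ℤ.- + 7)) ℚ./ (24 ℕ.* k ℕ.* r))
                    {{m*n≢0 (24 ℕ.* k) r {{m*n≢0 24 k}}}} ⌝ + E r))
-- The threshold is 0: the bound on the remainder holds for every r ≥ 1.
theorem6 (suc d) = E , (⌜ B ⌝ , 0 , λ r _ → E-bound r) , λ r →
  subst (λ x → fromℕ (C k r) ≈ exp x * fromℕ ((k ℕ.* r) !) * (1ℝ - ⌜ coefficient r ⌝ + E r))
    (sym exponent≡) (expansion r)
  where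
  open Constants d
  E : Sequence
  E r = exp (ℚ.- e) * ⌜ ratio r ⌝ - 1ℝ + ⌜ coefficient r ⌝
  B : ℚ
  B = proj₁ error-bound
  E-bound : ∀ r .{{_ : NonZero r}} → ∣ E r ∣ ≤ ⌜ B ⌝ * ∣ r^-2 r ∣
  E-bound r = subst (λ x → ∣ E r ∣ ≤ ⌜ B ⌝ * ⌜ x ⌝) (sym ∣r^-2∣) (proj₂ error-bound r)
    where
    r²≢0 : NonZero (r ℕ.^ 2)
    r²≢0 = ℕ.m^n≢0 r 2
    ∣r^-2∣ : ℚ.∣ recip (r ℕ.^ 2) {{r²≢0}} ∣ ≡ recip r ℚ.* recip r
    ∣r^-2∣ = trans (ℚ.0≤p⇒∣p∣≡p (0≤recip (r ℕ.^ 2) {{r²≢0}})) (recip-square r {{it}} {{r²≢0}})
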